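{- Let $g \ge 4$ and $r \ge 3$ be integers. For a graph $G$ let $|\mathcal{IG}|$ be the (random) cardinality of the independent set produced by the randomized GREEDY algorithm on $G$. Then $$\frac{1 - (r-1)^{ -\frac{2}{r-2} } }{2} -\frac{r(r-1)^{\lfloor \frac{g-2}{2} \rfloor }}{(\lfloor \frac{g-2}{2} \rfloor+1)!} \le \inf_{G \in G(g,r)} \mathbb{E}\left[\frac{|\mathcal{IG}|}{|V(G)|}\right] \le \sup_{G \in G(g,r)} \mathbb{E}\left[\frac{|\mathcal{IG}|}{|V(G)|}\right] \le \frac{1 - (r-1)^{ -\frac{2}{r-2}}}{2} + \frac{r(r-1)^{\lfloor \frac{g-2}{2} \rfloor }}{(\lfloor \frac{g-2}{2} \rfloor+1)!}.$$
   Context: All graphs are finite, simple and undirected; $V(G)$ is the node set of $G$. The girth of a graph is the length of its shortest cycle. $G(g,r)$ is the family of all $r$-regular graphs (every node has degree exactly $r$) with girth at least $g$. Randomized GREEDY for (unweighted) independent sets: iteratively select a node uniformly at random from all remaining nodes of the graph, add it to the independent set, delete it and all remaining nodes adjacent to it, and repeat until no nodes remain. The random output is denoted $\mathcal{IG}$. -}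

module Defs where

open import Data.Bool using (Bool; false; T; T?)
open import Data.Fin using (Fin; zero; suc; inject₁; fromℕ)
open import Data.Fin.Properties using (_≟_)
open import Data.Integer using (ℤ; +_; -[1+_])
open import Data.List using (List; []; _∷_; length; lookup; filter; allFin)
open import Data.List.Membership.Propositional using (lose)
open import Data.List.Membership.Propositional.Properties using (∈-lookup)
open import Data.List.Properties using (filter-notAll)
open import Data.Nat as ℕ using (ℕ; suc; NonZero; ⌊_/2⌋; _!)
open import Data.Nat.Induction using (Acc; acc; <-wellFounded)
open import Data.Nat.Properties as ℕ using (_!≢0; m^n≢0)
open import Data.Product using (∃-syntax; _×_; _,_; proj₁; proj₂)
open import Data.Rational as ℚ
  using (ℚ; 0ℚ; 1ℚ; ½; _/_; _+_; _-_; _*_; -_; _≤_; _<_)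
import Data.Rational.Properties as ℚ
open import Data.Rational.Solver using (module +-*-Solver)
open import Data.Rational.Unnormalised as ℚᵘ using (ℚᵘ)
open import Algebra.Properties.CommutativeMonoid.Sum ℚ.+-0-commutativeMonoid
  using (sum)
open import Function using (Injective)
open import Relation.Binary.PropositionalEquality
  using (_≡_; refl; sym; subst; subst₂)
open import Relation.Nullary using (¬_; ¬?; _×-dec_)
open import Relation.Unary using (Decidable)

-- Two-sided cuts of ℚ.  Neither side is required to be inhabited, so ±∞
-- are included, and locatedness is required only up to double negation,
-- so that arbitrary infima and suprema exist without choice.  Classically
-- this is exactly [-∞,+∞].

record ℝ̄ : Set₁ where
  field
    L U       : ℚ → Set
    L-down    : ∀ {p q} → p < q → L q → L p
    U-up      : ∀ {p q} → p < q → U p → U q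
    L-rounded : ∀ {p} → L p → ∃[ q ] p < q × L q
    U-rounded : ∀ {q} → U q → ∃[ p ] p < q × U p
    disjoint  : ∀ {p q} → L p → U q → p < q
    located   : ∀ {p q} → p < q → ¬ (¬ L p × ¬ U q)

open ℝ̄

infix 4 _≤ᴿ_

_≤ᴿ_ : ℝ̄ → ℝ̄ → Set
x ≤ᴿ y = (∀ {q} → L x q → L y q) × (∀ {q} → U y q → U x q)

-- Over an empty index set, inf is +∞ and sup is -∞.

inf sup : {I : Set} → (I → ℚ) → ℝ̄
inf f = record
  { L         = λ q → ∃[ l ] q < l × (∀ i → l ≤ f i)
  ; U         = λ q → ∃[ i ] f i < q
  ; L-down    = λ { p<q (l , q<l , h) → l , ℚ.<-trans p<q q<l , h }
  ; U-up      = λ { p<q (i , h) → i , ℚ.<-trans h p<q }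
  ; L-rounded = λ { (l , q<l , h) → let m , q<m , m<l = ℚ.<-dense q<l in
                    m , q<m , l , m<l , h }
  ; U-rounded = λ { (i , h) → let m , a , b = ℚ.<-dense h in m , b , i , a }
  ; disjoint  = λ { (l , p<l , h) (i , k) →
                    ℚ.<-trans (ℚ.<-≤-trans p<l (h i)) k }
  ; located   = λ { {p} {q} p<q (¬L , ¬U) →
                    ¬L (q , p<q , λ i → ℚ.≮⇒≥ (λ h → ¬U (i , h))) }
  }
sup f = record
  { L         = λ q → ∃[ i ] q < f i
  ; U         = λ q → ∃[ u ] u < q × (∀ i → f i ≤ u)
  ; L-down    = λ { p<q (i , h) → i , ℚ.<-trans p<q h }
  ; U-up      = λ { p<q (u , u<p , h) → u , ℚ.<-trans u<p p<q , h }
  ; L-rounded = λ { (i , h) → let m , a , b = ℚ.<-dense h in m , a , i , b }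
  ; U-rounded = λ { (u , u<q , h) → let m , u<m , m<q = ℚ.<-dense u<q in
                    m , m<q , u , u<m , h }
  ; disjoint  = λ { (i , k) (u , u<q , h) →
                    ℚ.<-trans (ℚ.<-≤-trans k (h i)) u<q }
  ; located   = λ { {p} {q} p<q (¬L , ¬U) →
                    ¬U (p , p<q , λ i → ℚ.≮⇒≥ (λ h → ¬L (i , h))) }
  }

private
  module _ where
    open +-*-Solver

    a-[a-q] : ∀ a q → a - (a - q) ≡ q
    a-[a-q] = solve 2 (λ a q → a :- (a :- q) := q) refl

    [q+a]-a : ∀ a q → (q + a) - a ≡ q
    [q+a]-a = solve 2 (λ a q → (q :+ a) :- a := q) refl

    [q-a]+a : ∀ a q → (q - a) + a ≡ q
    [q-a]+a = solve 2 (λ a q → (q :- a) :+ a := q) refl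

    half+half : ∀ q → ½ * q + ½ * q ≡ q
    half+half = solve 1 (λ q → con ½ :* q :+ con ½ :* q := q) refl

    half-double : ∀ q → ½ * (q + q) ≡ q
    half-double = solve 1 (λ q → con ½ :* (q :+ q) := q) refl

  reflect : ∀ a {p q} → p < q → a - q < a - p
  reflect a p<q = ℚ.+-monoʳ-< a (ℚ.neg-antimono-< p<q)

  reflectˡ : ∀ a {p q} → a - q < p → a - p < q
  reflectˡ a {q = q} h = subst (_ <_) (a-[a-q] a q) (reflect a h)

  reflectʳ : ∀ a {p q} → q < a - p → p < a - q
  reflectʳ a {p} h = subst (_< _) (a-[a-q] a p) (reflect a h)

  unreflect : ∀ a {p q} → a - p < a - q → q < p
  unreflect a {p} {q} h = subst₂ _<_ (a-[a-q] a q) (a-[a-q] a p) (reflect a h)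

  shift : ∀ a {p q} → p < q → p - a < q - a
  shift a = ℚ.+-monoˡ-< (- a)

  shiftˡ : ∀ a {p q} → p - a < q → p < q + a
  shiftˡ a {p} h = subst (_< _) ([q-a]+a a p) (ℚ.+-monoˡ-< a h)

  shiftʳ : ∀ a {p q} → q < p - a → q + a < p
  shiftʳ a {p} h = subst (_ <_) ([q-a]+a a p) (ℚ.+-monoˡ-< a h)

  unshift : ∀ a {p q} → p - a < q - a → p < q
  unshift a {p} {q} h =
    subst₂ _<_ ([q-a]+a a p) ([q-a]+a a q) (ℚ.+-monoˡ-< a h)

  double : ∀ {p q} → p < q → p + p < q + q
  double p<q = ℚ.+-mono-< p<q p<q

  halve : ∀ {p q} → p < q → ½ * p < ½ * q
  halve = ℚ.*-monoʳ-<-pos ½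

  halveˡ : ∀ {p q} → p + p < q → p < ½ * q
  halveˡ {p} h = subst (_< _) (half-double p) (halve h)

  halveʳ : ∀ {p q} → q < p + p → ½ * q < p
  halveʳ {p} h = subst (_ <_) (half-double p) (halve h)

  unhalve : ∀ {p q} → p + p < q + q → p < q
  unhalve {p} {q} h = subst (_ <_) (half-double q) (halveˡ h)

infixl 6 _⊖_ _⊕_
infixl 7 _/2

_⊖_ : ℚ → ℝ̄ → ℝ̄
a ⊖ x = record
  { L         = λ q → U x (a - q)
  ; U         = λ q → L x (a - q)
  ; L-down    = λ p<q → U-up x (reflect a p<q)
  ; U-up      = λ p<q → L-down x (reflect a p<q)
  ; L-rounded = λ h → let u , u< , k = U-rounded x h in
                  a - u , reflectʳ a u< , subst (U x) (sym (a-[a-q] a u)) k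
  ; U-rounded = λ h → let l , <l , k = L-rounded x h in
                  a - l , reflectˡ a <l , subst (L x) (sym (a-[a-q] a l)) k
  ; disjoint  = λ h k → unreflect a (disjoint x k h)
  ; located   = λ p<q (¬U , ¬L) → located x (reflect a p<q) (¬L , ¬U)
  }

_⊕_ : ℝ̄ → ℚ → ℝ̄
x ⊕ a = record
  { L         = λ q → L x (q - a)
  ; U         = λ q → U x (q - a)
  ; L-down    = λ p<q → L-down x (shift a p<q)
  ; U-up      = λ p<q → U-up x (shift a p<q)
  ; L-rounded = λ h → let l , <l , k = L-rounded x h in
                  l + a , shiftˡ a <l , subst (L x) (sym ([q+a]-a a l)) k
  ; U-rounded = λ h → let u , u< , k = U-rounded x h in
                  u + a , shiftʳ a u< , subst (U x) (sym ([q+a]-a a u)) k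
  ; disjoint  = λ h k → unshift a (disjoint x h k)
  ; located   = λ p<q → located x (shift a p<q)
  }

_/2 : ℝ̄ → ℝ̄
x /2 = record
  { L         = λ q → L x (q + q)
  ; U         = λ q → U x (q + q)
  ; L-down    = λ p<q → L-down x (double p<q)
  ; U-up      = λ p<q → U-up x (double p<q)
  ; L-rounded = λ h → let l , <l , k = L-rounded x h in
                  ½ * l , halveˡ <l , subst (L x) (sym (half+half l)) k
  ; U-rounded = λ h → let u , u< , k = U-rounded x h in
                  ½ * u , halveʳ u< , subst (U x) (sym (half+half u)) k
  ; disjoint  = λ h k → unhalve (disjoint x h k)
  ; located   = λ p<q → located x (double p<q)
  }

_^ℕ_ : ℚ → ℕ → ℚ
q ^ℕ ℕ.zero  = 1ℚ
q ^ℕ (suc n) = q * (q ^ℕ n)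

-- The nonnegative n-th root of a ≥ 0, for n ≥ 1.

root : ℕ → ℚ → ℝ̄
root n a = sup {∃[ t ] 0ℚ ≤ t × t ^ℕ n ≤ a} proj₁

_^ℤ_ : (b : ℕ) .{{_ : NonZero b}} → ℤ → ℚ
b ^ℤ (+ n)    = + (b ℕ.^ n) / 1
b ^ℤ -[1+ n ] = (+ 1 / (b ℕ.^ suc n)) {{m^n≢0 b (suc n)}}

_^ℚ_ : (b : ℕ) .{{_ : NonZero b}} → ℚᵘ → ℝ̄
b ^ℚ e = root (ℚᵘ.denominatorℕ e) (b ^ℤ ℚᵘ.numerator e)

-- The node set is nonempty, as is needed to divide by its size.

record Graph : Set where
  field
    order        : ℕ
    {{nonEmpty}} : NonZero order
    adj          : Fin order → Fin order → Bool
    adj-sym      : ∀ u v → adj u v ≡ adj v u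
    adj-irr      : ∀ v → adj v v ≡ false

  Node : Set
  Node = Fin order

  _~_ : Node → Node → Set
  u ~ v = T (adj u v)

  degree : Node → ℕ
  degree v = length (filter (λ w → T? (adj v w)) (allFin order))

open Graph using (order)

Regular : ℕ → Graph → Set
Regular r G = ∀ v → Graph.degree G v ≡ r

-- A cycle of length suc m.

record Cycle (G : Graph) (m : ℕ) : Set where
  open Graph G using (Node; _~_)
  field
    length≥3 : 3 ℕ.≤ suc m
    node     : Fin (suc m) → Node
    distinct : Injective _≡_ _≡_ node
    step     : ∀ (i : Fin m) → node (inject₁ i) ~ node (suc i)
    close    : node (fromℕ m) ~ node zero

-- Acyclic graphs have infinite girth.

Girth≥ : ℕ → Graph → Set
Girth≥ g G = ∀ {m} → Cycle G m → g ℕ.≤ suc m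

record 𝒢 (g r : ℕ) : Set where
  field
    graph   : Graph
    regular : Regular r graph
    girth   : Girth≥ g graph

data Rand (A : Set) : Set where
  return  : A → Rand A
  uniform : ∀ n .{{_ : NonZero n}} → (Fin n → Rand A) → Rand A

mapᴿ : {A B : Set} → (A → B) → Rand A → Rand B
mapᴿ f (return a)    = return (f a)
mapᴿ f (uniform n k) = uniform n (λ i → mapᴿ f (k i))

𝔼 : {A : Set} → (A → ℚ) → Rand A → ℚ
𝔼 X (return a)    = X a
𝔼 X (uniform n k) = (+ 1 / n) * sum (λ i → 𝔼 X (k i))

module Greedy (G : Graph) where
  open Graph G using (Node; _~_; adj)

  Survives : Node → Node → Set
  Survives v w = ¬ w ≡ v × ¬ v ~ w

  survives? : ∀ v → Decidable (Survives v)
  survives? v w = ¬? (w ≟ v) ×-dec ¬? (T? (adj v w))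

  delete : Node → List Node → List Node
  delete v = filter (survives? v)

  delete-< : ∀ ws i → length (delete (lookup ws i) ws) ℕ.< length ws
  delete-< ws i = filter-notAll (survives? (lookup ws i)) ws
    (lose (∈-lookup {xs = ws} i) (λ s → proj₁ s refl))

  -- ws lists the remaining nodes; the outcome lists the selected nodes,
  -- without repetition since a selected node is deleted.

  run : (ws : List Node) → Acc ℕ._<_ (length ws) → Rand (List Node)
  run []           _         = return []
  run ws@(_ ∷ _) (acc rs) = uniform (length ws) λ i →
    mapᴿ (lookup ws i ∷_) (run (delete (lookup ws i) ws) (rs (delete-< ws i)))

  𝓘𝓖 : Rand (List Node)
  𝓘𝓖 = run (allFin (order G)) (<-wellFounded _)

expectedRatio : Graph → ℚ
expectedRatio G = 𝔼 (λ S → + length S / order G) (Greedy.𝓘𝓖 G)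

limit : ∀ r → 3 ℕ.≤ r → ℝ̄
limit r r≥3 = (1ℚ ⊖ (r ℕ.∸ 1) ^ℚ (-[1+ 1 ] ℚᵘ./ (r ℕ.∸ 2))) /2
  where
  instance
    r∸1≢0 : NonZero (r ℕ.∸ 1)
    r∸1≢0 = ℕ.>-nonZero (ℕ.m<n⇒0<n∸m (ℕ.<-trans (ℕ.n<1+n 1) r≥3))
    r∸2≢0 : NonZero (r ℕ.∸ 2)
    r∸2≢0 = ℕ.>-nonZero (ℕ.m<n⇒0<n∸m r≥3)

error : ℕ → ℕ → ℚ
error g r = (+ (r ℕ.* (r ℕ.∸ 1) ℕ.^ h) / (suc h !)) {{suc h !≢0}}
  where h = ⌊ g ℕ.∸ 2 /2⌋

{-# OPTIONS --safe #-}
module Submission where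

-- Give the nodes independent uniform labels in {0, …, N-1} and let each node be accepted unless an accepted neighbour
-- has a smaller label. Up to O(1/N), the probability of a tie, this is randomized greedy. Truncating the recursion at
-- depth k gives over- and underestimates alternately, and by the girth condition the truncation at depth k ≤ (g-2)/2
-- only sees a tree, where independence yields the sums ρ k below. The same sums enclose ρ∞, the value for the infinite
-- tree, and consecutive ones differ by at most r (r-1)^(k-1) / (k+1)!. Finally 2 ρ∞ telescopes to 1 - y(N)² up to O(1/N),
-- where y(N) is an Euler approximation of (r-1)^(-1/(r-2)), and N is arbitrary.
-- For inf ≤ sup one graph is needed: the Schreier graph of r involutions acting on a ball of the r-regular tree,
-- made free enough by letting them act on enumerations of the ball.

open import Data.Bool using (Bool; true; false; T; T?; if_then_else_; _∧_; not)
open import Data.Empty using (⊥; ⊥-elim)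
open import Data.Fin using (Fin; zero; suc; punchIn; inject₁; fromℕ; toℕ)
open import Data.Fin.Induction using (<-weakInduction)
open import Data.Fin.Properties using (_≟_; any?; punchInᵢ≢i; injective⇒≤; toℕ-inject₁; toℕ-fromℕ; toℕ<n)
open import Data.Integer as ℤ using (ℤ)
import Data.Integer.Properties as ℤ
open import Data.List as List using (List; []; _∷_; length; lookup; filter; allFin; _++_; map; cartesianProductWith; deduplicate)
open import Data.List.Membership.DecPropositional using (_∈?_)
open import Data.List.Membership.Propositional using (_∈_)
open import Data.List.Membership.Propositional.Properties
  using (∈-lookup; ∈-allFin; ∈-tabulate⁺; ∈-tabulate⁻; ∈-filter⁺; ∈-filter⁻; ∈-deduplicate⁺; ∈-deduplicate⁻; ∈-cartesianProductWith⁺; ∈-cartesianProductWith⁻; ∈-map⁺)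
import Data.List.Properties as List
open import Data.List.Relation.Unary.All as All using (All; []; _∷_; all?)
import Data.List.Relation.Unary.All.Properties as All
open import Data.List.Relation.Unary.AllPairs using ([]; _∷_)
open import Data.List.Relation.Unary.Any using (here; there; index)
open import Data.List.Relation.Unary.Any.Properties using (lookup-index)
open import Data.List.Relation.Unary.Unique.DecPropositional.Properties using (deduplicate-!)
open import Data.List.Relation.Unary.Unique.Propositional using (Unique)
open import Data.List.Relation.Unary.Unique.Propositional.Properties using (tabulate⁺; allFin⁺; filter⁺)
open import Data.Maybe using (Maybe; just; nothing)
import Data.Maybe.Properties as Maybe
open import Data.Nat as ℕ using (ℕ; zero; suc; NonZero; _!; ⌊_/2⌋)
open import Data.Nat.Induction using (Acc; acc; <-wellFounded)
import Data.Nat.Properties as ℕ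
open import Data.Product using (∃-syntax; _×_; _,_; proj₁; proj₂)
open import Data.Rational as ℚ
  using (ℚ; mkℚ; 0ℚ; 1ℚ; ½; _/_; _+_; _-_; _*_; -_; _≤_; _<_; nonNegative; positive; fromℚᵘ; ∣_∣)
import Data.Rational.Properties as ℚ
open import Data.Rational.Solver using (module +-*-Solver)
open import Data.Rational.Unnormalised as ℚᵘ using (mkℚᵘ; *≡*)
import Data.Rational.Unnormalised.Properties as ℚᵘ
open import Data.Sum using (_⊎_; inj₁; inj₂)
open import Data.Unit using (⊤; tt)
open import Data.Vec as Vec using (Vec; []; _∷_; insertAt)
import Data.Vec.Properties as Vec
open import Function using (_∘_; id; mk⇔)
open import Relation.Binary.Definitions using (DecidableEquality)
open import Relation.Binary.PropositionalEquality hiding ([_])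
open import Relation.Nullary using (¬_; Dec; yes; no; contradiction; does; ¬?; _×-dec_; _⊎-dec_)
open import Relation.Nullary.Decidable using (does-⇔; dec-true; dec-false)
open import Algebra.Properties.CommutativeMonoid.Sum ℚ.+-0-commutativeMonoid
  using (sum; sum-cong-≗; sum-remove; ∑-distrib-+; sum-replicate-zero)
open import Algebra.Properties.CommutativeMonoid.Sum ℚ.*-1-commutativeMonoid
  using () renaming (sum to prod; sum-cong-≗ to prod-cong; sum-remove to prod-remove)
open import Defs
open +-*-Solver using (solve; _:+_; _:-_; _:*_; _:=_; con; :-_)

-- Arithmetic in ℚ

-- With labels uniform in [0,1] and d = r-1, the probability that a given child does not block a
-- parent of label t would solve y′ = - y^d, y(0) = 1. Hence y(1)^2 = (r-1)^(-2/(r-2)), and a node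
-- is picked with probability equal to the integral of y^(d+1) = - y y′, which is (1 - y(1)^2)/2.
-- Since the theorem compares cuts of ℚ, the integrals are replaced by sums with weight w = 1/N, and
-- N grows only at the very end. Labels model greedy because, without ties, the smallest label sits
-- at a uniformly random node, and deciding that node leaves the same problem on the others. In the
-- formal induction the blocked nodes stay in the label vector as dead ones, which must be shown not
-- to disturb the mean. Alternation comes from acceptance being order-reversing in the acceptance of
-- the neighbours. The factorial comes from Picard iteration: each further level of the tree
-- integrates the previous difference once more and contributes a Lipschitz factor r-1 (r at the
-- root).

≤-from : ∀ {a b d} → 0ℚ ≤ d → b ≡ a + d → a ≤ b
≤-from {a} {b} {d} 0≤d refl = subst (_≤ a + d) (ℚ.+-identityʳ a) (ℚ.+-monoʳ-≤ a 0≤d)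

0≤-diff : ∀ {a b} → a ≤ b → 0ℚ ≤ b - a
0≤-diff {a} {b} a≤b = subst (_≤ b - a) (ℚ.+-inverseʳ a) (ℚ.+-monoˡ-≤ (- a) a≤b)

*-mono : ∀ {a b c d} → 0ℚ ≤ a → a ≤ b → 0ℚ ≤ c → c ≤ d → a * c ≤ b * d
*-mono {a} {b} {c} {d} 0≤a a≤b 0≤c c≤d = ℚ.≤-trans
  (ℚ.*-monoˡ-≤-nonNeg a {{nonNegative 0≤a}} c≤d)
  (ℚ.*-monoʳ-≤-nonNeg d {{nonNegative (ℚ.≤-trans 0≤c c≤d)}} a≤b)

*-nonneg : ∀ {a b} → 0ℚ ≤ a → 0ℚ ≤ b → 0ℚ ≤ a * b
*-nonneg {a} {b} p q = subst (_≤ a * b) (ℚ.*-zeroˡ 0ℚ) (*-mono ℚ.≤-refl p ℚ.≤-refl q)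

+-nonneg : ∀ {a b} → 0ℚ ≤ a → 0ℚ ≤ b → 0ℚ ≤ a + b
+-nonneg = ℚ.+-mono-≤

*-monoˡ : ∀ {a b c} → 0ℚ ≤ a → b ≤ c → a * b ≤ a * c
*-monoˡ {a} p = ℚ.*-monoˡ-≤-nonNeg a {{nonNegative p}}

*-monoʳ : ∀ {a b c} → 0ℚ ≤ a → b ≤ c → b * a ≤ c * a
*-monoʳ {a} p = ℚ.*-monoʳ-≤-nonNeg a {{nonNegative p}}

*-cancelʳ : ∀ {a b c} → 0ℚ < c → a * c ≤ b * c → a ≤ b
*-cancelʳ {c = c} p = ℚ.*-cancelʳ-≤-pos c {{positive p}}

0≤1 : 0ℚ ≤ 1ℚ
0≤1 = ℚ.nonNegative⁻¹ 1ℚ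

0<1 : 0ℚ < 1ℚ
0<1 = ℚ.positive⁻¹ 1ℚ

-‿mono : ∀ {a b c d} → a ≤ b → c ≤ d → a - d ≤ b - c
-‿mono p q = ℚ.+-mono-≤ p (ℚ.neg-antimono-≤ q)

1-≤1 : ∀ {a} → 0ℚ ≤ a → 1ℚ - a ≤ 1ℚ
1-≤1 p = -‿mono ℚ.≤-refl p

ι : ℕ → ℚ
ι n = ℤ.+ n / 1

fromℚᵘ-+ : ∀ p q → fromℚᵘ p + fromℚᵘ q ≡ fromℚᵘ (p ℚᵘ.+ q)
fromℚᵘ-+ p q = ℚ.toℚᵘ-injective (ℚᵘ.≃-trans (ℚ.toℚᵘ-homo-+ (fromℚᵘ p) (fromℚᵘ q))
  (ℚᵘ.≃-trans (ℚᵘ.+-cong (ℚ.toℚᵘ-fromℚᵘ p) (ℚ.toℚᵘ-fromℚᵘ q)) (ℚᵘ.≃-sym (ℚ.toℚᵘ-fromℚᵘ (p ℚᵘ.+ q)))))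

fromℚᵘ-* : ∀ p q → fromℚᵘ p * fromℚᵘ q ≡ fromℚᵘ (p ℚᵘ.* q)
fromℚᵘ-* p q = ℚ.toℚᵘ-injective (ℚᵘ.≃-trans (ℚ.toℚᵘ-homo-* (fromℚᵘ p) (fromℚᵘ q))
  (ℚᵘ.≃-trans (ℚᵘ.*-cong (ℚ.toℚᵘ-fromℚᵘ p) (ℚ.toℚᵘ-fromℚᵘ q)) (ℚᵘ.≃-sym (ℚ.toℚᵘ-fromℚᵘ (p ℚᵘ.* q)))))

ι-+ : ∀ m n → ι (m ℕ.+ n) ≡ ι m + ι n
ι-+ m n = sym (trans (fromℚᵘ-+ (mkℚᵘ (ℤ.+ m) 0) (mkℚᵘ (ℤ.+ n) 0))
  (ℚ.fromℚᵘ-cong {mkℚᵘ (ℤ.+ m) 0 ℚᵘ.+ mkℚᵘ (ℤ.+ n) 0} {mkℚᵘ (ℤ.+ (m ℕ.+ n)) 0} (*≡* (cong (ℤ._* ℤ.+ 1)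
    (trans (cong₂ ℤ._+_ (ℤ.*-identityʳ (ℤ.+ m)) (ℤ.*-identityʳ (ℤ.+ n))) (sym (ℤ.pos-+ m n)))))))

ι-* : ∀ m n → ι (m ℕ.* n) ≡ ι m * ι n
ι-* m n = sym (trans (fromℚᵘ-* (mkℚᵘ (ℤ.+ m) 0) (mkℚᵘ (ℤ.+ n) 0))
  (ℚ.fromℚᵘ-cong {mkℚᵘ (ℤ.+ m) 0 ℚᵘ.* mkℚᵘ (ℤ.+ n) 0} {mkℚᵘ (ℤ.+ (m ℕ.* n)) 0} (*≡* (cong (ℤ._* ℤ.+ 1) (sym (ℤ.pos-* m n))))))

/-*ι : ∀ a b .{{_ : NonZero b}} → (ℤ.+ a / b) * ι b ≡ ι a
/-*ι a (suc b) = trans (fromℚᵘ-* (mkℚᵘ (ℤ.+ a) b) (mkℚᵘ (ℤ.+ suc b) 0))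
  (ℚ.fromℚᵘ-cong {mkℚᵘ (ℤ.+ a) b ℚᵘ.* mkℚᵘ (ℤ.+ suc b) 0} {mkℚᵘ (ℤ.+ a) 0} (*≡* (trans (ℤ.*-identityʳ (ℤ.+ a ℤ.* ℤ.+ suc b)) (cong (λ k → ℤ.+ a ℤ.* ℤ.+ suc k) (sym (ℕ.*-identityʳ b))))))

ι-suc : ∀ n → ι (suc n) ≡ 1ℚ + ι n
ι-suc n = ι-+ 1 n

0≤/ : ∀ a b .{{_ : NonZero b}} → 0ℚ ≤ ℤ.+ a / b
0≤/ a b = ℚ.nonNegative⁻¹ _ {{ℚ.normalize-nonNeg a b}}

0≤ι : ∀ n → 0ℚ ≤ ι n
0≤ι n = 0≤/ n 1

0<ι : ∀ n .{{_ : NonZero n}} → 0ℚ < ι n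
0<ι n = ℚ.positive⁻¹ _ {{ℚ.normalize-pos n 1}}

ι-mono : ∀ {m n} → m ℕ.≤ n → ι m ≤ ι n
ι-mono {m} {n} m≤n = ≤-from (0≤ι (n ℕ.∸ m))
  (trans (cong ι (sym (ℕ.m+[n∸m]≡n m≤n))) (ι-+ m (n ℕ.∸ m)))

ι-^ : ∀ b n → ι (b ℕ.^ n) ≡ ι b ^ℕ n
ι-^ b zero = refl
ι-^ b (suc n) = trans (ι-* b (b ℕ.^ n)) (cong (ι b *_) (ι-^ b n))

^-nonneg : ∀ {a} n → 0ℚ ≤ a → 0ℚ ≤ a ^ℕ n
^-nonneg zero p = 0≤1
^-nonneg (suc n) p = *-nonneg p (^-nonneg n p)

^-mono : ∀ {a b} n → 0ℚ ≤ a → a ≤ b → a ^ℕ n ≤ b ^ℕ n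
^-mono zero p q = ℚ.≤-refl
^-mono (suc n) p q = *-mono p q (^-nonneg n p) (^-mono n p q)

1^ : ∀ n → 1ℚ ^ℕ n ≡ 1ℚ
1^ zero = refl
1^ (suc n) = trans (ℚ.*-identityˡ _) (1^ n)

^≤1 : ∀ {a} n → 0ℚ ≤ a → a ≤ 1ℚ → a ^ℕ n ≤ 1ℚ
^≤1 {a} n p q = subst (a ^ℕ n ≤_) (1^ n) (^-mono n p q)

^-distrib-* : ∀ a b n → (a * b) ^ℕ n ≡ a ^ℕ n * b ^ℕ n
^-distrib-* a b zero = refl
^-distrib-* a b (suc n) = trans (cong (a * b *_) (^-distrib-* a b n))
  (solve 4 (λ a b c d → a :* b :* (c :* d) := a :* c :* (b :* d)) refl a b (a ^ℕ n) (b ^ℕ n))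

^-mono-< : ∀ {a b} n → 0ℚ ≤ a → a < b → a ^ℕ suc n < b ^ℕ suc n
^-mono-< {a} {b} n p q = ℚ.≤-<-trans (*-monoˡ p (^-mono n p (ℚ.<⇒≤ q)))
  (ℚ.*-monoˡ-<-pos (b ^ℕ n) {{positive (^-pos n)}} q)
  where
  0<b : 0ℚ < b
  0<b = ℚ.≤-<-trans p q
  ^-pos : ∀ n → 0ℚ < b ^ℕ n
  ^-pos zero = 0<1
  ^-pos (suc n) = ℚ.positive⁻¹ _
    {{ℚ.pos*pos⇒pos b {{positive 0<b}} (b ^ℕ n) {{positive (^-pos n)}}}}

^-cancel-≤ : ∀ {a b} n .{{_ : NonZero n}} → 0ℚ ≤ b → a ^ℕ n ≤ b ^ℕ n → a ≤ b
^-cancel-≤ (suc n) p q = ℚ.≮⇒≥ (λ b<a → ℚ.<-irrefl refl (ℚ.<-≤-trans (^-mono-< n p b<a) q))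

bernoulli : ∀ {x} n → 0ℚ ≤ x → 1ℚ + ι n * x ≤ (1ℚ + x) ^ℕ n
bernoulli {x} zero p = ℚ.≤-reflexive (trans (cong (λ z → 1ℚ + z) (ℚ.*-zeroˡ x)) (ℚ.+-identityʳ 1ℚ))
bernoulli {x} (suc n) p = ℚ.≤-trans
  (≤-from (*-nonneg (0≤ι n) (*-nonneg p p))
    (trans (solve 2 (λ n x → (con 1ℚ :+ x) :* (con 1ℚ :+ n :* x) := (con 1ℚ :+ (con 1ℚ :+ n) :* x) :+ n :* (x :* x)) refl (ι n) x)
      (cong (λ k → (1ℚ + k * x) + ι n * (x * x)) (sym (ι-suc n)))))
  (*-monoˡ (+-nonneg 0≤1 p) (bernoulli n p))

bernoulli-neg : ∀ {x} n → 0ℚ ≤ x → x ≤ 1ℚ → 1ℚ - ι n * x ≤ (1ℚ - x) ^ℕ n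
bernoulli-neg {x} zero p q = ℚ.≤-reflexive (trans (cong (λ z → 1ℚ - z) (ℚ.*-zeroˡ x)) (ℚ.+-identityʳ 1ℚ))
bernoulli-neg {x} (suc n) p q = ℚ.≤-trans
  (≤-from (*-nonneg (0≤ι n) (*-nonneg p p))
    (trans (solve 2 (λ n x → (con 1ℚ :- x) :* (con 1ℚ :- n :* x) := (con 1ℚ :- (con 1ℚ :+ n) :* x) :+ n :* (x :* x)) refl (ι n) x)
      (cong (λ k → (1ℚ - k * x) + ι n * (x * x)) (sym (ι-suc n)))))
  (*-monoˡ (0≤-diff q) (bernoulli-neg n p q))

-- The Lipschitz constant of the n-th power on [0,1], by induction along y b - x a = (y - x) b + x
-- (b - a).
^-diff : ∀ {x y} n → 0ℚ ≤ x → x ≤ y → y ≤ 1ℚ → y ^ℕ n - x ^ℕ n ≤ ι n * (y - x)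
^-diff {x} {y} zero p q s = ℚ.≤-reflexive (trans (ℚ.+-inverseʳ 1ℚ) (sym (ℚ.*-zeroˡ (y - x))))
^-diff {x} {y} (suc n) p q s = ℚ.≤-trans
  (ℚ.≤-reflexive (solve 4 (λ x y a b → y :* b :- x :* a := (y :- x) :* b :+ x :* (b :- a)) refl x y (x ^ℕ n) (y ^ℕ n)))
  (ℚ.≤-trans (ℚ.+-mono-≤ (*-monoˡ (0≤-diff q) (^≤1 n (ℚ.≤-trans p q) s))
     (ℚ.≤-trans (*-monoʳ (0≤-diff (^-mono n p q)) (ℚ.≤-trans q s)) (ℚ.≤-trans (ℚ.≤-reflexive (ℚ.*-identityˡ _)) (^-diff n p q s))))
   (ℚ.≤-reflexive (trans
     (solve 3 (λ x y n → (y :- x) :* con 1ℚ :+ n :* (y :- x) := (con 1ℚ :+ n) :* (y :- x)) refl x y (ι n))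
     (cong (_* (y - x)) (sym (ι-suc n))))))

-- The recursion on the infinite tree

-- Truncations at depth k over- and underestimate alternately.
Side : ℕ → ℚ → ℚ → Set
Side zero    a b = b ≤ a
Side (suc k) a b = Side k b a

-- Going from `k` to `suc k` only swaps the two sides, so the induction swaps `u` and `v` until a
-- plain inequality remains. `Q` carries the range on which `φ` is monotone.
side-mono : {I : Set} (Q : (I → ℚ) → Set) (φ : (I → ℚ) → ℚ) →
  (∀ u v → Q u → Q v → (∀ i → u i ≤ v i) → φ u ≤ φ v) →
  ∀ k u v → Q u → Q v → (∀ i → Side k (u i) (v i)) → Side k (φ u) (φ v)
side-mono Q φ mono zero    u v qu qv h = mono v u qv qu h
side-mono Q φ mono (suc k) u v qu qv h = side-mono Q φ mono k v u qv qu h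

side-anti : {I : Set} (Q : (I → ℚ) → Set) (φ : (I → ℚ) → ℚ) →
  (∀ u v → Q u → Q v → (∀ i → u i ≤ v i) → φ v ≤ φ u) →
  ∀ k u v → Q u → Q v → (∀ i → Side k (u i) (v i)) → Side k (φ v) (φ u)
side-anti Q φ anti zero    u v qu qv h = anti v u qv qu h
side-anti Q φ anti (suc k) u v qu qv h = side-anti Q φ anti k v u qv qu h

-- Both `x` and `y` lie between `a` and `b`, in an order that depends on the parity of `k`. The
-- hypotheses on `b` are `Side (suc k) b x` and `Side (suc k) b y` unfolded.
side-gap : ∀ k {a b x y} → Side k a x → Side k x b → Side k a y → Side k y b → x - y ≤ ∣ a - b ∣
side-gap zero    {a} {b} x≤a b≤x y≤a b≤y = ℚ.≤-trans (-‿mono x≤a b≤y)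
  (ℚ.≤-reflexive (sym (ℚ.0≤p⇒∣p∣≡p (0≤-diff (ℚ.≤-trans b≤x x≤a)))))
side-gap (suc k) {a} {b} p q p′ q′ = ℚ.≤-trans (side-gap k q p q′ p′)
  (ℚ.≤-reflexive (trans (sym (ℚ.∣-p∣≡∣p∣ (b - a))) (cong ∣_∣ (solve 2 (λ a b → :- (b :- a) := a :- b) refl a b))))

∑< : ℕ → (ℕ → ℚ) → ℚ
∑< zero    f = 0ℚ
∑< (suc n) f = ∑< n f + f n

∑<-mono : ∀ n {f g} → (∀ i → i ℕ.< n → f i ≤ g i) → ∑< n f ≤ ∑< n g
∑<-mono zero    h = ℚ.≤-refl
∑<-mono (suc n) h = ℚ.+-mono-≤ (∑<-mono n (λ i i<n → h i (ℕ.m<n⇒m<1+n i<n))) (h n ℕ.≤-refl)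

∑<-cong : ∀ n {f g} → (∀ i → i ℕ.< n → f i ≡ g i) → ∑< n f ≡ ∑< n g
∑<-cong zero    h = refl
∑<-cong (suc n) h = cong₂ _+_ (∑<-cong n (λ i i<n → h i (ℕ.m<n⇒m<1+n i<n))) (h n ℕ.≤-refl)

∑<-*ˡ : ∀ n c f → ∑< n (λ i → c * f i) ≡ c * ∑< n f
∑<-*ˡ zero    c f = sym (ℚ.*-zeroʳ c)
∑<-*ˡ (suc n) c f = trans (cong (_+ c * f n) (∑<-*ˡ n c f)) (sym (ℚ.*-distribˡ-+ c (∑< n f) (f n)))

∑<-+ : ∀ n f g → ∑< n (λ i → f i + g i) ≡ ∑< n f + ∑< n g
∑<-+ zero    f g = refl
∑<-+ (suc n) f g = trans (cong (_+ (f n + g n)) (∑<-+ n f g))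
  (solve 4 (λ a b c d → a :+ b :+ (c :+ d) := a :+ c :+ (b :+ d)) refl (∑< n f) (∑< n g) (f n) (g n))

∑<-const : ∀ n c → ∑< n (λ _ → c) ≡ ι n * c
∑<-const zero    c = sym (ℚ.*-zeroˡ c)
∑<-const (suc n) c = trans (cong (_+ c) (∑<-const n c))
  (trans (solve 2 (λ n c → n :* c :+ c := (con 1ℚ :+ n) :* c) refl (ι n) c) (cong (_* c) (sym (ι-suc n))))

∑<-nonneg : ∀ n {f} → (∀ i → i ℕ.< n → 0ℚ ≤ f i) → 0ℚ ≤ ∑< n f
∑<-nonneg n {f} h = subst (_≤ ∑< n f) (trans (∑<-const n 0ℚ) (ℚ.*-zeroʳ (ι n))) (∑<-mono n h)

∣∑<-∑<∣ : ∀ n f g → ∣ ∑< n f - ∑< n g ∣ ≤ ∑< n (λ i → ∣ f i - g i ∣)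
∣∑<-∑<∣ zero    f g = ℚ.≤-refl
∣∑<-∑<∣ (suc n) f g = ℚ.≤-trans
  (ℚ.≤-reflexive (cong ∣_∣ (solve 4 (λ a b c d → a :+ c :- (b :+ d) := a :- b :+ (c :- d)) refl (∑< n f) (∑< n g) (f n) (g n))))
  (ℚ.≤-trans (ℚ.∣p+q∣≤∣p∣+∣q∣ (∑< n f - ∑< n g) (f n - g n)) (ℚ.+-monoˡ-≤ ∣ f n - g n ∣ (∣∑<-∑<∣ n f g)))

∣-∣-sym : ∀ a b → ∣ a - b ∣ ≡ ∣ b - a ∣
∣-∣-sym a b = trans (sym (ℚ.∣-p∣≡∣p∣ (a - b))) (cong ∣_∣ (solve 2 (λ a b → :- (a :- b) := b :- a) refl a b))

∣^-^∣ : ∀ {x y} n → 0ℚ ≤ x → x ≤ 1ℚ → 0ℚ ≤ y → y ≤ 1ℚ → ∣ x ^ℕ n - y ^ℕ n ∣ ≤ ι n * ∣ x - y ∣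
∣^-^∣ {x} {y} n 0≤x x≤1 0≤y y≤1 with ℚ.≤-total x y
... | inj₁ x≤y = ℚ.≤-trans (ℚ.≤-reflexive (trans (∣-∣-sym (x ^ℕ n) (y ^ℕ n)) (ℚ.0≤p⇒∣p∣≡p (0≤-diff (^-mono n 0≤x x≤y)))))
  (ℚ.≤-trans (^-diff n 0≤x x≤y y≤1)
   (ℚ.≤-reflexive (cong (ι n *_) (sym (trans (∣-∣-sym x y) (ℚ.0≤p⇒∣p∣≡p (0≤-diff x≤y)))))))
... | inj₂ y≤x = ℚ.≤-trans (ℚ.≤-reflexive (ℚ.0≤p⇒∣p∣≡p (0≤-diff (^-mono n 0≤y y≤x))))
  (ℚ.≤-trans (^-diff n 0≤y y≤x x≤1) (ℚ.≤-reflexive (cong (ι n *_) (sym (ℚ.0≤p⇒∣p∣≡p (0≤-diff y≤x))))))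

^-step : ∀ {x w} n → 0ℚ ≤ x → 0ℚ ≤ w → x ^ℕ suc n + ι (suc n) * (w * x ^ℕ n) ≤ (x + w) ^ℕ suc n
^-step {x} {w} zero p q = ℚ.≤-reflexive (solve 2 (λ x w → x :* con 1ℚ :+ con 1ℚ :* (w :* con 1ℚ) := (x :+ w) :* con 1ℚ) refl x w)
^-step {x} {w} (suc n) p q = ℚ.≤-trans
  (≤-from (*-nonneg (0≤ι (suc n)) (*-nonneg (*-nonneg q q) (^-nonneg n p)))
    (trans (solve 4 (λ x w a k → (x :+ w) :* (x :* a :+ k :* (w :* a)) :=
              x :* (x :* a) :+ (con 1ℚ :+ k) :* (w :* (x :* a)) :+ k :* (w :* w :* a)) refl x w (x ^ℕ n) (ι (suc n)))
      (cong (λ k → x * (x * x ^ℕ n) + k * (w * (x * x ^ℕ n)) + ι (suc n) * (w * w * x ^ℕ n)) (sym (ι-suc (suc n))))))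
  (*-monoˡ (+-nonneg p q) (^-step n p q))

-- A left Riemann sum of the increasing function s^k stays below its integral; `^-step` is the
-- comparison on one cell.
∑<-power : ∀ {w} k j → 0ℚ ≤ w → ι (suc k) * ∑< j (λ i → w * (ι i * w) ^ℕ k) ≤ (ι j * w) ^ℕ suc k
∑<-power {w} k zero p = ℚ.≤-reflexive (trans (ℚ.*-zeroʳ (ι (suc k))) (sym (trans (cong (_* (0ℚ * w) ^ℕ k) (ℚ.*-zeroˡ w)) (ℚ.*-zeroˡ ((0ℚ * w) ^ℕ k)))))
∑<-power {w} k (suc j) p = ℚ.≤-trans
  (ℚ.≤-reflexive (ℚ.*-distribˡ-+ (ι (suc k)) (∑< j (λ i → w * (ι i * w) ^ℕ k)) (w * (ι j * w) ^ℕ k)))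
  (ℚ.≤-trans (ℚ.+-monoˡ-≤ _ (∑<-power k j p))
  (ℚ.≤-trans (^-step k (*-nonneg (0≤ι j) p) p)
  (ℚ.≤-reflexive (cong (_^ℕ suc k) (trans (solve 2 (λ n w → n :* w :+ w := (con 1ℚ :+ n) :* w) refl (ι j) w) (cong (_* w) (sym (ι-suc j))))))))

ι-inverse≤1 : ∀ N {w} → 0ℚ ≤ w → ι N * w ≡ 1ℚ → w ≤ 1ℚ
ι-inverse≤1 zero    {w} _   Nw≡1 = contradiction (trans (sym (ℚ.*-zeroˡ w)) Nw≡1) (λ ())
ι-inverse≤1 (suc N) {w} 0≤w Nw≡1 = ≤-from (*-nonneg (0≤ι N) 0≤w) (trans (sym Nw≡1)
  (trans (cong (_* w) (ι-suc N)) (solve 2 (λ n w → (con 1ℚ :+ n) :* w := w :+ n :* w) refl (ι N) w)))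

module Recursion (m N : ℕ) (w : ℚ) (0≤w : 0ℚ ≤ w) (Nw≡1 : ι N * w ≡ 1ℚ) where

  -- With r = `m` + 2 this is r - 1, the number of children of every node of the r-regular tree
  -- except the root.
  d : ℕ
  d = suc m

  -- In the infinite tree, truncated at depth k, β k j is the probability that a given child of a node is not
  -- accepted with a label below j. Its limit y in k is the Euler scheme of y′ = - y^d, that is y^(-m) = 1 + m t.
  β : ℕ → ℕ → ℚ
  β zero    j = 1ℚ
  β (suc k) j = 1ℚ - ∑< j (λ i → w * β k i ^ℕ d)

  y : ℕ → ℚ
  y zero    = 1ℚ
  y (suc j) = y j - w * y j ^ℕ d

  y-∑< : ∀ j → y j ≡ 1ℚ - ∑< j (λ i → w * y i ^ℕ d)
  y-∑< zero = refl
  y-∑< (suc j) = trans (cong (_- w * y j ^ℕ d) (y-∑< j))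
    (solve 2 (λ a b → con 1ℚ :- a :- b := con 1ℚ :- (a :+ b)) refl (∑< j (λ i → w * y i ^ℕ d)) (w * y j ^ℕ d))

  jw≤1 : ∀ {j} → j ℕ.≤ N → ι j * w ≤ 1ℚ
  jw≤1 {j} j≤N = subst (ι j * w ≤_) Nw≡1 (*-monoʳ 0≤w (ι-mono j≤N))

  w≤1 : w ≤ 1ℚ
  w≤1 = ι-inverse≤1 N 0≤w Nw≡1

  ∑<-≤ : ∀ {f : ℕ → ℚ} j → (∀ i → i ℕ.< j → f i ≤ 1ℚ) → ∑< j (λ i → w * f i) ≤ ι j * w
  ∑<-≤ {f} j h = ℚ.≤-trans (∑<-mono j (λ i i<j → subst (w * f i ≤_) (ℚ.*-identityʳ w) (*-monoˡ 0≤w (h i i<j))))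
    (ℚ.≤-reflexive (∑<-const j w))

  β-bounds : ∀ k {j} → j ℕ.≤ N → 0ℚ ≤ β k j × β k j ≤ 1ℚ
  β-bounds zero    j≤N = 0≤1 , ℚ.≤-refl
  β-bounds (suc k) {j} j≤N =
    0≤-diff (ℚ.≤-trans (∑<-≤ {λ i → β k i ^ℕ d} j (λ i i<j → ^≤1 d (proj₁ (b i<j)) (proj₂ (b i<j)))) (jw≤1 j≤N)) ,
    1-≤1 (∑<-nonneg j (λ i i<j → *-nonneg 0≤w (^-nonneg d (proj₁ (b i<j)))))
    where
    b : ∀ {i} → i ℕ.< j → 0ℚ ≤ β k i × β k i ≤ 1ℚ
    b i<j = β-bounds k (ℕ.≤-trans (ℕ.<⇒≤ i<j) j≤N)

  y-bounds : ∀ j → 0ℚ ≤ y j × y j ≤ 1ℚ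
  y-bounds zero = 0≤1 , ℚ.≤-refl
  y-bounds (suc j) with y-bounds j
  ... | p , q =
    ℚ.≤-trans (*-nonneg p (0≤-diff (*-≤1 0≤w w≤1 (^-nonneg m p) (^≤1 m p q))))
      (ℚ.≤-reflexive (solve 3 (λ y w a → y :* (con 1ℚ :- w :* a) := y :- w :* (y :* a)) refl (y j) w (y j ^ℕ m))) ,
    ℚ.≤-trans (-‿mono q (*-nonneg 0≤w (^-nonneg d p))) ℚ.≤-refl
    where
    *-≤1 : ∀ {a b} → 0ℚ ≤ a → a ≤ 1ℚ → 0ℚ ≤ b → b ≤ 1ℚ → a * b ≤ 1ℚ
    *-≤1 = *-mono

  -- `side-mono` and `side-anti` want bounds at all indices, but `β k` is bounded only up to `N`.
  -- Clamping the index supplies them and changes no summand.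
  clamp-∑< : ∀ (f : ℕ → ℚ) e {j} → j ℕ.≤ N → ∑< j (λ i → w * f (i ℕ.⊓ N) ^ℕ e) ≡ ∑< j (λ i → w * f i ^ℕ e)
  clamp-∑< f e j≤N = ∑<-cong _ (λ i i<j → cong (λ i → w * f i ^ℕ e) (ℕ.m≤n⇒m⊓n≡m (ℕ.≤-trans (ℕ.<⇒≤ i<j) j≤N)))

  ∑<-^-mono : ∀ e j (u v : ℕ → ℚ) → (∀ i → 0ℚ ≤ u i) → (∀ i → u i ≤ v i) →
    ∑< j (λ i → w * u i ^ℕ e) ≤ ∑< j (λ i → w * v i ^ℕ e)
  ∑<-^-mono e j u v 0≤u u≤v = ∑<-mono j (λ i _ → *-monoˡ 0≤w (^-mono e (0≤u i) (u≤v i)))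

  -- `y` is the fixed point of the order-reversing operator that takes `β k` to `β (suc k)`, and
  -- `β 0` lies above it; each application changes the side.
  side-β : ∀ k {j} → j ℕ.≤ N → Side k (β k j) (y j)
  side-β zero {j} _ = proj₂ (y-bounds j)
  side-β (suc k) {j} j≤N = subst₂ (Side k)
    (trans (cong (λ z → 1ℚ - z) (clamp-∑< y d j≤N)) (sym (y-∑< j)))
    (cong (λ z → 1ℚ - z) (clamp-∑< (β k) d j≤N))
    (side-anti (λ u → ∀ i → 0ℚ ≤ u i) (λ u → 1ℚ - ∑< j (λ i → w * u i ^ℕ d))
      (λ u v 0≤u _ u≤v → -‿mono {1ℚ} ℚ.≤-refl (∑<-^-mono d j u v 0≤u u≤v))
      k (λ i → β k (i ℕ.⊓ N)) (λ i → y (i ℕ.⊓ N))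
      (λ i → proj₁ (β-bounds k (ℕ.m⊓n≤n i N))) (λ i → proj₁ (y-bounds (i ℕ.⊓ N)))
      (λ i → side-β k (ℕ.m⊓n≤n i N)))

  -- The probability that the root is accepted at truncation depth `k`: `j` is its own label, and
  -- none of its `suc d` = r children may block it.
  ρ : ℕ → ℚ
  ρ k = ∑< N (λ j → w * β k j ^ℕ suc d)

  ρ∞ : ℚ
  ρ∞ = ∑< N (λ j → w * y j ^ℕ suc d)

  side-ρ : ∀ k → Side k (ρ k) ρ∞
  side-ρ k = subst₂ (Side k) (clamp-∑< (β k) (suc d) ℕ.≤-refl) (clamp-∑< y (suc d) ℕ.≤-refl)
    (side-mono (λ u → ∀ i → 0ℚ ≤ u i) (λ u → ∑< N (λ i → w * u i ^ℕ suc d))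
      (λ u v 0≤u _ u≤v → ∑<-^-mono (suc d) N u v 0≤u u≤v)
      k (λ i → β k (i ℕ.⊓ N)) (λ i → y (i ℕ.⊓ N))
      (λ i → proj₁ (β-bounds k (ℕ.m⊓n≤n i N))) (λ i → proj₁ (y-bounds (i ℕ.⊓ N)))
      (λ i → side-β k (ℕ.m⊓n≤n i N)))

  -- One Picard step. Taking the `e`-th power costs the Lipschitz constant `e`, and summing (i
  -- w)^(k+1) against `w` produces (j w)^(k+2) / (k+2).
  ∑<-^-gap : ∀ e k j → j ℕ.≤ N →
    (∀ i → i ℕ.≤ N → ι (suc k !) * ∣ β (suc k) i - β k i ∣ ≤ ι d ^ℕ k * (ι i * w) ^ℕ suc k) →
    ι (suc (suc k) !) * ∣ ∑< j (λ i → w * β (suc k) i ^ℕ e) - ∑< j (λ i → w * β k i ^ℕ e) ∣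
      ≤ ι e * ι d ^ℕ k * (ι j * w) ^ℕ suc (suc k)
  ∑<-^-gap e k j j≤N gap = begin
    ι (suc (suc k) !) * ∣ ∑< j (λ i → w * β (suc k) i ^ℕ e) - ∑< j (λ i → w * β k i ^ℕ e) ∣
      ≤⟨ *-monoˡ (0≤ι (suc (suc k) !)) (∣∑<-∑<∣ j _ _) ⟩
    ι (suc (suc k) !) * ∑< j (λ i → ∣ w * β (suc k) i ^ℕ e - w * β k i ^ℕ e ∣)
      ≡⟨ trans (cong (_* S) (ι-* (suc (suc k)) (suc k !))) (trans (ℚ.*-assoc (ι (suc (suc k))) (ι (suc k !)) S)
           (cong (ι (suc (suc k)) *_) (sym (∑<-*ˡ j (ι (suc k !)) _)))) ⟩
    ι (suc (suc k)) * ∑< j (λ i → ι (suc k !) * ∣ w * β (suc k) i ^ℕ e - w * β k i ^ℕ e ∣)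
      ≤⟨ *-monoˡ (0≤ι (suc (suc k))) (∑<-mono j (λ i i<j → term i (ℕ.≤-trans (ℕ.<⇒≤ i<j) j≤N))) ⟩
    ι (suc (suc k)) * ∑< j (λ i → ι e * ι d ^ℕ k * (w * (ι i * w) ^ℕ suc k))
      ≡⟨ trans (cong (ι (suc (suc k)) *_) (∑<-*ˡ j (ι e * ι d ^ℕ k) _))
          (solve 3 (λ a b c → a :* (b :* c) := b :* (a :* c)) refl (ι (suc (suc k))) (ι e * ι d ^ℕ k) (∑< j (λ i → w * (ι i * w) ^ℕ suc k))) ⟩
    ι e * ι d ^ℕ k * (ι (suc (suc k)) * ∑< j (λ i → w * (ι i * w) ^ℕ suc k))
      ≤⟨ *-monoˡ (*-nonneg (0≤ι e) (^-nonneg k (0≤ι d))) (∑<-power (suc k) j 0≤w) ⟩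
    ι e * ι d ^ℕ k * (ι j * w) ^ℕ suc (suc k) ∎
    where
    open ℚ.≤-Reasoning
    S = ∑< j (λ i → ∣ w * β (suc k) i ^ℕ e - w * β k i ^ℕ e ∣)
    term : ∀ i → i ℕ.≤ N → ι (suc k !) * ∣ w * β (suc k) i ^ℕ e - w * β k i ^ℕ e ∣ ≤ ι e * ι d ^ℕ k * (w * (ι i * w) ^ℕ suc k)
    term i i≤N = begin
      ι (suc k !) * ∣ w * β (suc k) i ^ℕ e - w * β k i ^ℕ e ∣
        ≡⟨ cong (λ z → ι (suc k !) * z) (trans (cong ∣_∣ (solve 3 (λ a b c → a :* b :- a :* c := a :* (b :- c)) refl w (β (suc k) i ^ℕ e) (β k i ^ℕ e)))
            (trans (ℚ.∣p*q∣≡∣p∣*∣q∣ w _) (cong (_* ∣ β (suc k) i ^ℕ e - β k i ^ℕ e ∣) (ℚ.0≤p⇒∣p∣≡p 0≤w)))) ⟩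
      ι (suc k !) * (w * ∣ β (suc k) i ^ℕ e - β k i ^ℕ e ∣)
        ≤⟨ *-monoˡ (0≤ι (suc k !)) (*-monoˡ 0≤w (∣^-^∣ e (proj₁ (β-bounds (suc k) i≤N)) (proj₂ (β-bounds (suc k) i≤N))
              (proj₁ (β-bounds k i≤N)) (proj₂ (β-bounds k i≤N)))) ⟩
      ι (suc k !) * (w * (ι e * ∣ β (suc k) i - β k i ∣))
        ≡⟨ solve 4 (λ a b c d → a :* (b :* (c :* d)) := c :* b :* (a :* d)) refl (ι (suc k !)) w (ι e) ∣ β (suc k) i - β k i ∣ ⟩
      ι e * w * (ι (suc k !) * ∣ β (suc k) i - β k i ∣)
        ≤⟨ *-monoˡ (*-nonneg (0≤ι e) 0≤w) (gap i i≤N) ⟩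
      ι e * w * (ι d ^ℕ k * (ι i * w) ^ℕ suc k)
        ≡⟨ solve 4 (λ a b c d → a :* b :* (c :* d) := a :* c :* (b :* d)) refl (ι e) w (ι d ^ℕ k) ((ι i * w) ^ℕ suc k) ⟩
      ι e * ι d ^ℕ k * (w * (ι i * w) ^ℕ suc k) ∎

  β-gap : ∀ k j → j ℕ.≤ N → ι (suc k !) * ∣ β (suc k) j - β k j ∣ ≤ ι d ^ℕ k * (ι j * w) ^ℕ suc k
  β-gap zero j j≤N = ℚ.≤-reflexive (trans (ℚ.*-identityˡ _) (trans (cong ∣_∣ (trans
    (cong (λ z → 1ℚ - z - 1ℚ) (trans (∑<-cong j {λ i → w * β zero i ^ℕ d} (λ i _ → trans (cong (w *_) (1^ d)) (ℚ.*-identityʳ w))) (∑<-const j w)))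
    (solve 1 (λ x → con 1ℚ :- x :- con 1ℚ := :- x) refl (ι j * w))))
    (trans (ℚ.∣-p∣≡∣p∣ (ι j * w)) (trans (ℚ.0≤p⇒∣p∣≡p (*-nonneg (0≤ι j) 0≤w))
      (solve 1 (λ x → x := con 1ℚ :* (x :* con 1ℚ)) refl (ι j * w))))))
  β-gap (suc k) j j≤N = subst (λ z → ι (suc (suc k) !) * z ≤ ι d ^ℕ suc k * (ι j * w) ^ℕ suc (suc k))
    (trans (∣-∣-sym (∑< j (λ i → w * β (suc k) i ^ℕ d)) (∑< j (λ i → w * β k i ^ℕ d))) (cong ∣_∣
      (solve 2 (λ a b → a :- b := (con 1ℚ :- b) :- (con 1ℚ :- a)) refl
        (∑< j (λ i → w * β k i ^ℕ d)) (∑< j (λ i → w * β (suc k) i ^ℕ d)))))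
    (∑<-^-gap d k j j≤N (β-gap k))

  ρ-gap : ∀ k → ι (suc (suc k) !) * ∣ ρ (suc k) - ρ k ∣ ≤ ι (suc d) * ι d ^ℕ k
  ρ-gap k = ℚ.≤-trans (∑<-^-gap (suc d) k N ℕ.≤-refl (β-gap k))
    (ℚ.≤-reflexive (trans (cong (λ z → ι (suc d) * ι d ^ℕ k * z ^ℕ suc (suc k)) Nw≡1)
      (trans (cong (ι (suc d) * ι d ^ℕ k *_) (1^ (suc (suc k)))) (ℚ.*-identityʳ _))))

  -- With s = w y_j^d the Euler step gives y_j^2 - y_(j+1)^2 = 2 y_j s - s^2, and y_j s is the
  -- summand. The sum telescopes, and `e` collects the squares s^2, each at most w^2.
  2ρ∞ : ∀ j → ∃[ e ] 0ℚ ≤ e × e ≤ ι j * w * w ×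
    ∑< j (λ i → w * y i ^ℕ suc d) + ∑< j (λ i → w * y i ^ℕ suc d) ≡ 1ℚ - y j * y j + e
  2ρ∞ zero = 0ℚ , ℚ.≤-refl , ℚ.≤-reflexive (sym (trans (cong (_* w) (ℚ.*-zeroˡ w)) (ℚ.*-zeroˡ w))) , refl
  2ρ∞ (suc j) with 2ρ∞ j
  ... | e , 0≤e , e≤ , eq = e + w * w * (y j ^ℕ d * y j ^ℕ d) ,
    +-nonneg 0≤e (*-nonneg (*-nonneg 0≤w 0≤w) (*-nonneg y^≥0 y^≥0)) ,
    ℚ.≤-trans (ℚ.+-mono-≤ e≤ (*-monoˡ (*-nonneg 0≤w 0≤w) (*-mono y^≥0 y^≤1 y^≥0 y^≤1)))
      (ℚ.≤-reflexive (trans (solve 2 (λ n w → n :* w :* w :+ w :* w :* (con 1ℚ :* con 1ℚ) := (con 1ℚ :+ n) :* w :* w) refl (ι j) w)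
        (cong (λ n → n * w * w) (sym (ι-suc j))))) ,
    trans (solve 2 (λ s t → s :+ t :+ (s :+ t) := (s :+ s) :+ (t :+ t)) refl (∑< j (λ i → w * y i ^ℕ suc d)) (w * y j ^ℕ suc d))
      (trans (cong (_+ (w * y j ^ℕ suc d + w * y j ^ℕ suc d)) eq)
        (solve 4 (λ y e w a → con 1ℚ :- y :* y :+ e :+ (w :* (y :* a) :+ w :* (y :* a)) :=
            con 1ℚ :- (y :- w :* a) :* (y :- w :* a) :+ (e :+ w :* w :* (a :* a))) refl (y j) e w (y j ^ℕ d)))
    where
    y^≥0 : 0ℚ ≤ y j ^ℕ d
    y^≥0 = ^-nonneg d (proj₁ (y-bounds j))
    y^≤1 : y j ^ℕ d ≤ 1ℚ
    y^≤1 = ^≤1 d (proj₁ (y-bounds j)) (proj₂ (y-bounds j))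

  y-suc : ∀ j → y (suc j) ^ℕ m ≡ y j ^ℕ m * (1ℚ - w * y j ^ℕ m) ^ℕ m
  y-suc j = trans (cong (_^ℕ m) (solve 3 (λ y w a → y :- w :* (y :* a) := y :* (con 1ℚ :- w :* a)) refl (y j) w (y j ^ℕ m)))
    (^-distrib-* (y j) (1ℚ - w * y j ^ℕ m) m)

  wu-bounds : ∀ j → 0ℚ ≤ w * y j ^ℕ m × w * y j ^ℕ m ≤ 1ℚ
  wu-bounds j = *-nonneg 0≤w u≥0 , *-mono 0≤w w≤1 u≥0 (^≤1 m (proj₁ (y-bounds j)) (proj₂ (y-bounds j)))
    where
    u≥0 : 0ℚ ≤ y j ^ℕ m
    u≥0 = ^-nonneg m (proj₁ (y-bounds j))

  M : ℚ
  M = ι m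

  -- Discrete form of (y^(-m))′ = m. For x = w y_j^m one step multiplies y^m by (1 - x)^m, and (1 -
  -- x)^m (1 + m x) ≤ (1 - x^2)^m ≤ 1.
  y^m≤ : ∀ j → y j ^ℕ m * (1ℚ + M * (ι j * w)) ≤ 1ℚ
  y^m≤ zero = ℚ.≤-reflexive (trans (cong₂ _*_ (1^ m) (cong (λ z → 1ℚ + M * z) (ℚ.*-zeroˡ w)))
    (solve 1 (λ m → con 1ℚ :* (con 1ℚ :+ m :* con 0ℚ) := con 1ℚ) refl M))
  y^m≤ (suc j) = begin
    y (suc j) ^ℕ m * (1ℚ + M * (ι (suc j) * w))
      ≡⟨ cong₂ (λ a b → a * (1ℚ + M * (b * w))) (y-suc j) (ι-suc j) ⟩
    u * (1ℚ - x) ^ℕ m * (1ℚ + M * ((1ℚ + ι j) * w))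
      ≡⟨ solve 5 (λ u v m j w → u :* v :* (con 1ℚ :+ m :* ((con 1ℚ :+ j) :* w)) := v :* (u :* (con 1ℚ :+ m :* (j :* w)) :+ m :* (w :* u)))
          refl u ((1ℚ - x) ^ℕ m) M (ι j) w ⟩
    (1ℚ - x) ^ℕ m * (u * (1ℚ + M * (ι j * w)) + M * x)
      ≤⟨ *-monoˡ (^-nonneg m 0≤1-x) (ℚ.+-monoˡ-≤ (M * x) (y^m≤ j)) ⟩
    (1ℚ - x) ^ℕ m * (1ℚ + M * x)
      ≤⟨ *-monoˡ (^-nonneg m 0≤1-x) (bernoulli m 0≤x) ⟩
    (1ℚ - x) ^ℕ m * (1ℚ + x) ^ℕ m
      ≡⟨ sym (^-distrib-* (1ℚ - x) (1ℚ + x) m) ⟩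
    ((1ℚ - x) * (1ℚ + x)) ^ℕ m
      ≤⟨ ^≤1 m (*-nonneg 0≤1-x (+-nonneg 0≤1 0≤x)) (≤-from (*-nonneg 0≤x 0≤x)
          (solve 1 (λ x → con 1ℚ := (con 1ℚ :- x) :* (con 1ℚ :+ x) :+ x :* x) refl x)) ⟩
    1ℚ ∎
    where
    open ℚ.≤-Reasoning
    u x : ℚ
    u = y j ^ℕ m
    x = w * u
    0≤x : 0ℚ ≤ x
    0≤x = proj₁ (wu-bounds j)
    0≤1-x : 0ℚ ≤ 1ℚ - x
    0≤1-x = 0≤-diff (proj₂ (wu-bounds j))

  c : ℚ
  c = M * M + M * M

  0≤c : 0ℚ ≤ c
  0≤c = +-nonneg (*-nonneg (0≤ι m) (0≤ι m)) (*-nonneg (0≤ι m) (0≤ι m))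

  -- The extra c w² per step absorbs the second-order term of (1 - x)^(-m).
  y^m≥ : (M + M) * w ≤ 1ℚ → ∀ j → 1ℚ ≤ y j ^ℕ m * (1ℚ + (M + c * w) * (ι j * w))
  y^m≥ small zero = ℚ.≤-reflexive (sym (trans (cong₂ _*_ (1^ m) (cong (λ z → 1ℚ + (M + c * w) * z) (ℚ.*-zeroˡ w)))
    (solve 1 (λ m → con 1ℚ :* (con 1ℚ :+ m :* con 0ℚ) := con 1ℚ) refl (M + c * w))))
  y^m≥ small (suc j) = begin
    1ℚ
      -- The constant `c` = 2 M^2 leaves the slack M^2 x^2 (1 - 2 M x), which `small` makes
      -- nonnegative because x ≤ w.
      ≤⟨ ≤-from (*-nonneg (*-nonneg (*-nonneg 0≤M 0≤M) (*-nonneg 0≤x 0≤x)) (0≤-diff 2Mx≤1))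
          (solve 2 (λ m x → (con 1ℚ :- m :* x) :* (con 1ℚ :+ m :* x :+ (m :* m :+ m :* m) :* x :* x)
            := con 1ℚ :+ m :* m :* (x :* x) :* (con 1ℚ :- (m :+ m) :* x)) refl M x) ⟩
    (1ℚ - M * x) * (1ℚ + M * x + c * x * x)
      ≤⟨ *-monoʳ (+-nonneg (+-nonneg 0≤1 (*-nonneg 0≤M 0≤x)) (*-nonneg (*-nonneg 0≤c 0≤x) 0≤x)) (bernoulli-neg m 0≤x x≤1) ⟩
    (1ℚ - x) ^ℕ m * (1ℚ + M * x + c * x * x)
      ≤⟨ *-monoˡ (^-nonneg m 0≤1-x) (ℚ.+-mono-≤ (ℚ.+-monoˡ-≤ (M * x) (y^m≥ small j)) (*-monoˡ (*-nonneg 0≤c 0≤x) x≤w)) ⟩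
    (1ℚ - x) ^ℕ m * (u * (1ℚ + (M + c * w) * (ι j * w)) + M * x + c * x * w)
      ≡⟨ solve 6 (λ u v m c j w → v :* (u :* (con 1ℚ :+ (m :+ c :* w) :* (j :* w)) :+ m :* (w :* u) :+ c :* (w :* u) :* w)
          := u :* v :* (con 1ℚ :+ (m :+ c :* w) :* ((con 1ℚ :+ j) :* w)))
          refl u ((1ℚ - x) ^ℕ m) M c (ι j) w ⟩
    u * (1ℚ - x) ^ℕ m * (1ℚ + (M + c * w) * ((1ℚ + ι j) * w))
      ≡⟨ sym (cong₂ (λ a b → a * (1ℚ + (M + c * w) * (b * w))) (y-suc j) (ι-suc j)) ⟩
    y (suc j) ^ℕ m * (1ℚ + (M + c * w) * (ι (suc j) * w)) ∎
    where
    open ℚ.≤-Reasoning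
    u x : ℚ
    u = y j ^ℕ m
    x = w * u
    0≤M : 0ℚ ≤ M
    0≤M = 0≤ι m
    0≤x : 0ℚ ≤ x
    0≤x = proj₁ (wu-bounds j)
    x≤1 : x ≤ 1ℚ
    x≤1 = proj₂ (wu-bounds j)
    0≤1-x : 0ℚ ≤ 1ℚ - x
    0≤1-x = 0≤-diff x≤1
    x≤w : x ≤ w
    x≤w = subst (x ≤_) (ℚ.*-identityʳ w) (*-monoˡ 0≤w (^≤1 m (proj₁ (y-bounds j)) (proj₂ (y-bounds j))))
    2Mx≤1 : (M + M) * x ≤ 1ℚ
    2Mx≤1 = ℚ.≤-trans (*-monoˡ (+-nonneg 0≤M 0≤M) x≤w) small

-- Averages over labelings

sum-*ˡ : ∀ n c (f : Fin n → ℚ) → sum (λ i → c * f i) ≡ c * sum f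
sum-*ˡ zero    c f = sym (ℚ.*-zeroʳ c)
sum-*ˡ (suc n) c f = trans (cong (c * f zero +_) (sum-*ˡ n c (f ∘ suc))) (sym (ℚ.*-distribˡ-+ c (f zero) (sum (f ∘ suc))))

sum-mono : ∀ n {f g : Fin n → ℚ} → (∀ i → f i ≤ g i) → sum f ≤ sum g
sum-mono zero    h = ℚ.≤-refl
sum-mono (suc n) h = ℚ.+-mono-≤ (h zero) (sum-mono n (h ∘ suc))

sum-const : ∀ n c → sum {n} (λ _ → c) ≡ ι n * c
sum-const zero    c = sym (ℚ.*-zeroˡ c)
sum-const (suc n) c = trans (cong (c +_) (sum-const n c))
  (trans (solve 2 (λ n c → c :+ n :* c := (con 1ℚ :+ n) :* c) refl (ι n) c) (cong (_* c) (sym (ι-suc n))))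

∑<-suc : ∀ n f → ∑< (suc n) f ≡ f 0 + ∑< n (f ∘ suc)
∑<-suc zero    f = ℚ.+-comm 0ℚ (f 0)
∑<-suc (suc n) f = trans (cong (_+ f (suc n)) (∑<-suc n f)) (ℚ.+-assoc (f 0) (∑< n (f ∘ suc)) (f (suc n)))

∑<-sum : ∀ n {m} (f : ℕ → Fin m → ℚ) → ∑< n (λ j → sum (f j)) ≡ sum (λ i → ∑< n (λ j → f j i))
∑<-sum zero    {m} f = sym (trans (sum-const m 0ℚ) (ℚ.*-zeroʳ (ι m)))
∑<-sum (suc n) f = trans (cong (_+ sum (f n)) (∑<-sum n f)) (sym (∑-distrib-+ (λ i → ∑< n (λ j → f j i)) (f n)))

Avg : ℚ → ℕ → ∀ n → (Vec ℕ n → ℚ) → ℚ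
Avg w N zero    f = f []
Avg w N (suc n) f = ∑< N (λ j → w * Avg w N n (λ t → f (j ∷ t)))

module _ (w : ℚ) (N : ℕ) where

  Avg-cong : ∀ n {f g} → (∀ t → f t ≡ g t) → Avg w N n f ≡ Avg w N n g
  Avg-cong zero    h = h []
  Avg-cong (suc n) h = ∑<-cong N (λ j _ → cong (w *_) (Avg-cong n (λ t → h (j ∷ t))))

  Avg-+ : ∀ n f g → Avg w N n (λ t → f t + g t) ≡ Avg w N n f + Avg w N n g
  Avg-+ zero    f g = refl
  Avg-+ (suc n) f g = trans
    (∑<-cong N (λ j _ → trans (cong (w *_) (Avg-+ n (λ t → f (j ∷ t)) (λ t → g (j ∷ t)))) (ℚ.*-distribˡ-+ w _ _)))
    (∑<-+ N _ _)

  Avg-*ˡ : ∀ n c f → Avg w N n (λ t → c * f t) ≡ c * Avg w N n f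
  Avg-*ˡ zero    c f = refl
  Avg-*ˡ (suc n) c f = trans
    (∑<-cong N (λ j _ → trans (cong (w *_) (Avg-*ˡ n c (λ t → f (j ∷ t))))
       (solve 3 (λ w c a → w :* (c :* a) := c :* (w :* a)) refl w c (Avg w N n (λ t → f (j ∷ t))))))
    (∑<-*ˡ N c _)

  Avg-sum : ∀ n m (f : Vec ℕ n → Fin m → ℚ) → Avg w N n (λ t → sum (f t)) ≡ sum (λ i → Avg w N n (λ t → f t i))
  Avg-sum n zero f = trans (Avg-*ˡ n 0ℚ (λ _ → 0ℚ)) (ℚ.*-zeroˡ (Avg w N n (λ _ → 0ℚ)))
  Avg-sum n (suc m) f = trans (Avg-+ n (λ t → f t zero) (λ t → sum (f t ∘ suc)))
    (cong (Avg w N n (λ t → f t zero) +_) (Avg-sum n m (λ t → f t ∘ suc)))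

  module _ (0≤w : 0ℚ ≤ w) where

    Avg-mono : ∀ n {f g} → (∀ t → f t ≤ g t) → Avg w N n f ≤ Avg w N n g
    Avg-mono zero    h = h []
    Avg-mono (suc n) h = ∑<-mono N (λ j _ → *-monoˡ 0≤w (Avg-mono n (λ t → h (j ∷ t))))

  module _ (Nw≡1 : ι N * w ≡ 1ℚ) where

    ∑<-w : ∀ c → ∑< N (λ _ → w * c) ≡ c
    ∑<-w c = trans (∑<-const N (w * c)) (trans (sym (ℚ.*-assoc (ι N) w c)) (trans (cong (_* c) Nw≡1) (ℚ.*-identityˡ c)))

    Avg-const : ∀ n c → Avg w N n (λ _ → c) ≡ c
    Avg-const zero    c = refl
    Avg-const (suc n) c = trans (∑<-cong N (λ j _ → cong (w *_) (Avg-const n c))) (∑<-w c)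

neq : ℕ → ℕ → ℚ
neq zero    zero    = 0ℚ
neq zero    (suc b) = 1ℚ
neq (suc a) zero    = 1ℚ
neq (suc a) (suc b) = neq a b

fresh : ∀ {n} → ℕ → Vec ℕ n → ℚ
fresh j []      = 1ℚ
fresh j (i ∷ t) = neq j i * fresh j t

-- Avg with the labelings that are not injective counted as 0, and not renormalised.
AvgInj : ℚ → ℕ → ∀ n → (Vec ℕ n → ℚ) → ℚ
AvgInj w N zero    f = f []
AvgInj w N (suc n) f = ∑< N (λ j → w * AvgInj w N n (λ t → fresh j t * f (j ∷ t)))

fresh-zero-map : ∀ {n} (t : Vec ℕ n) → fresh 0 (Vec.map suc t) ≡ 1ℚ
fresh-zero-map []      = refl
fresh-zero-map (i ∷ t) = trans (ℚ.*-identityˡ _) (fresh-zero-map t)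

fresh-suc-map : ∀ {n} j (t : Vec ℕ n) → fresh (suc j) (Vec.map suc t) ≡ fresh j t
fresh-suc-map j []      = refl
fresh-suc-map j (i ∷ t) = cong (neq j i *_) (fresh-suc-map j t)

-- All labelings with the value 0 at `i` and nowhere else have this form, and `push i` preserves
-- injectivity.
push : ∀ {n} → Fin (suc n) → Vec ℕ n → Vec ℕ (suc n)
push i t = insertAt (Vec.map suc t) i 0

fresh-zero-push : ∀ {n} i (t : Vec ℕ n) → fresh 0 (push i t) ≡ 0ℚ
fresh-zero-push zero    t       = ℚ.*-zeroˡ (fresh 0 (Vec.map suc t))
fresh-zero-push (suc i) (x ∷ t) = trans (ℚ.*-identityˡ _) (fresh-zero-push i t)

fresh-suc-push : ∀ {n} j i (t : Vec ℕ n) → fresh (suc j) (push i t) ≡ fresh j t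
fresh-suc-push j zero    t       = trans (ℚ.*-identityˡ _) (fresh-suc-map j t)
fresh-suc-push j (suc i) (x ∷ t) = cong (neq j x *_) (fresh-suc-push j i t)

module _ (w : ℚ) where

  AvgInj-cong : ∀ N n {f g} → (∀ t → f t ≡ g t) → AvgInj w N n f ≡ AvgInj w N n g
  AvgInj-cong N zero    h = h []
  AvgInj-cong N (suc n) h = ∑<-cong N (λ j _ → cong (w *_) (AvgInj-cong N n (λ t → cong (fresh j t *_) (h (j ∷ t)))))

  AvgInj-+ : ∀ N n f g → AvgInj w N n (λ t → f t + g t) ≡ AvgInj w N n f + AvgInj w N n g
  AvgInj-+ N zero    f g = refl
  AvgInj-+ N (suc n) f g = trans
    (∑<-cong N (λ j _ → trans (cong (w *_) (trans
      (AvgInj-cong N n (λ t → ℚ.*-distribˡ-+ (fresh j t) (f (j ∷ t)) (g (j ∷ t))))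
      (AvgInj-+ N n (λ t → fresh j t * f (j ∷ t)) (λ t → fresh j t * g (j ∷ t))))) (ℚ.*-distribˡ-+ w _ _)))
    (∑<-+ N _ _)

  AvgInj-*ˡ : ∀ N n c f → AvgInj w N n (λ t → c * f t) ≡ c * AvgInj w N n f
  AvgInj-*ˡ N zero    c f = refl
  AvgInj-*ˡ N (suc n) c f = trans
    (∑<-cong N (λ j _ → trans (cong (w *_) (trans
       (AvgInj-cong N n (λ t → solve 3 (λ w c a → w :* (c :* a) := c :* (w :* a)) refl (fresh j t) c (f (j ∷ t))))
       (AvgInj-*ˡ N n c (λ t → fresh j t * f (j ∷ t)))))
       (solve 3 (λ w c a → w :* (c :* a) := c :* (w :* a)) refl w c (AvgInj w N n (λ t → fresh j t * f (j ∷ t))))))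
    (∑<-*ˡ N c _)

  AvgInj-const : ∀ N n c → AvgInj w N n (λ _ → c) ≡ c * AvgInj w N n (λ _ → 1ℚ)
  AvgInj-const N n c = trans (AvgInj-cong N n (λ _ → sym (ℚ.*-identityʳ c))) (AvgInj-*ˡ N n c (λ _ → 1ℚ))

  AvgInj-0 : ∀ N n {f} → (∀ t → f t ≡ 0ℚ) → AvgInj w N n f ≡ 0ℚ
  AvgInj-0 N n h = trans (AvgInj-cong N n h) (trans (AvgInj-const N n 0ℚ) (ℚ.*-zeroˡ (AvgInj w N n (λ _ → 1ℚ))))

  -- The part of the average over `suc N` labels that comes from labelings with some entry 0, sorted
  -- by that entry. The weight `w` is independent of `N`, so it survives the induction on the number
  -- of labels.
  pushed : ℕ → ∀ n → (Vec ℕ n → ℚ) → ℚ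
  pushed N zero    f = 0ℚ
  pushed N (suc n) f = w * sum (λ i → AvgInj w N n (λ t → f (push i t)))

  pushed-0 : ∀ N n {f} → (∀ {m} (e : n ≡ suc m) i t → f (subst (Vec ℕ) (sym e) (push i t)) ≡ 0ℚ) → pushed N n f ≡ 0ℚ
  pushed-0 N zero    h = refl
  pushed-0 N (suc n) h = trans (cong (w *_) (trans (sum-cong-≗ (λ i → AvgInj-0 N n (h refl i))) (sum-replicate-zero (suc n)))) (ℚ.*-zeroʳ w)

  ∑<-pushed : ∀ N n (f : Vec ℕ (suc n) → ℚ) → ∑< N (λ j → w * pushed N n (λ t → fresh (suc j) t * f (suc j ∷ t)))
    ≡ w * sum (λ (i : Fin n) → AvgInj w N _ (λ t → f (push (suc i) t)))
  ∑<-pushed N zero    f = trans (∑<-const N (w * 0ℚ))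
    (solve 2 (λ n w → n :* (w :* con 0ℚ) := w :* con 0ℚ) refl (ι N) w)
  ∑<-pushed N (suc n) f = trans (∑<-*ˡ N w _) (cong (w *_) (trans
    (∑<-cong N (λ j _ → trans
      (sym (sum-*ˡ (suc n) w (λ i → AvgInj w N n (λ t → fresh (suc j) (push i t) * f (suc j ∷ push i t))))) (sum-cong-≗ (λ i → cong (w *_)
      (AvgInj-cong N n (λ t → cong (_* f (suc j ∷ push i t)) (fresh-suc-push j i t)))))))
    (∑<-sum N {suc n} (λ j i → w * AvgInj w N n (λ t → fresh j t * f (suc j ∷ push i t))))))

  -- Split according to which entry, if any, carries the label 0.
  AvgInj-suc : ∀ N n f → AvgInj w (suc N) n f ≡ AvgInj w N n (f ∘ Vec.map suc) + pushed N n f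
  AvgInj-suc N zero    f = sym (ℚ.+-identityʳ (f []))
  AvgInj-suc N (suc n) f = begin
    ∑< (suc N) (λ j → w * AvgInj w (suc N) n (g j))
      ≡⟨ ∑<-cong (suc N) (λ j _ → trans (cong (w *_) (AvgInj-suc N n (g j))) (ℚ.*-distribˡ-+ w _ _)) ⟩
    ∑< (suc N) (λ j → w * AvgInj w N n (g j ∘ Vec.map suc) + w * pushed N n (g j))
      ≡⟨ ∑<-suc N _ ⟩
    w * AvgInj w N n (g 0 ∘ Vec.map suc) + w * pushed N n (g 0) +
      ∑< N (λ j → w * AvgInj w N n (g (suc j) ∘ Vec.map suc) + w * pushed N n (g (suc j)))
      ≡⟨ cong₂ _+_
          (trans (cong₂ (λ a b → w * a + w * b)
             (AvgInj-cong N n (λ t → trans (cong (_* f (0 ∷ Vec.map suc t)) (fresh-zero-map t)) (ℚ.*-identityˡ _)))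
             (pushed-0 N n (λ { refl i t → trans (cong (_* f (0 ∷ push i t)) (fresh-zero-push i t)) (ℚ.*-zeroˡ (f (0 ∷ push i t))) })))
             (solve 2 (λ w a → w :* a :+ w :* con 0ℚ := w :* a) refl w a₀))
          (trans (∑<-+ N _ _) (cong₂ _+_
             (∑<-cong N (λ j _ → cong (w *_) (AvgInj-cong N n (λ t → cong (_* f (suc j ∷ Vec.map suc t)) (fresh-suc-map j t)))))
             (∑<-pushed N n f))) ⟩
    w * a₀ + (AvgInj w N (suc n) (f ∘ Vec.map suc) + w * rest)
      ≡⟨ solve 4 (λ w a b c → w :* a :+ (b :+ w :* c) := b :+ w :* (a :+ c)) refl w a₀ (AvgInj w N (suc n) (f ∘ Vec.map suc)) rest ⟩
    AvgInj w N (suc n) (f ∘ Vec.map suc) + w * (a₀ + rest) ∎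
    where
    open ≡-Reasoning
    g : ℕ → Vec ℕ n → ℚ
    g j t = fresh j t * f (j ∷ t)
    a₀ rest : ℚ
    a₀ = AvgInj w N n (λ t → f (push zero t))
    rest = sum (λ i → AvgInj w N n (λ t → f (push (suc i) t)))

  pushed-1 : ∀ N n → pushed N (suc n) (λ _ → 1ℚ) ≡ w * (ι (suc n) * AvgInj w N n (λ _ → 1ℚ))
  pushed-1 N n = cong (w *_) (sum-const (suc n) _)

neq-bounds : ∀ a b → 0ℚ ≤ neq a b × neq a b ≤ 1ℚ
neq-bounds zero    zero    = ℚ.≤-refl , 0≤1
neq-bounds zero    (suc b) = 0≤1 , ℚ.≤-refl
neq-bounds (suc a) zero    = 0≤1 , ℚ.≤-refl
neq-bounds (suc a) (suc b) = neq-bounds a b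

fresh-bounds : ∀ {n} j (t : Vec ℕ n) → 0ℚ ≤ fresh j t × fresh j t ≤ 1ℚ
fresh-bounds j []      = 0≤1 , ℚ.≤-refl
fresh-bounds j (i ∷ t) with neq-bounds j i | fresh-bounds j t
... | p , q | p′ , q′ = *-nonneg p p′ , *-mono p q p′ q′

∑<-neq : ∀ N i → ∑< N (λ j → 1ℚ - neq j i) ≤ 1ℚ
∑<-neq zero    i = 0≤1
∑<-neq (suc N) zero = ℚ.≤-reflexive (trans (∑<-suc N _) (trans (cong (λ z → 1ℚ - 0ℚ + z) (trans (∑<-const N 0ℚ) (ℚ.*-zeroʳ (ι N)))) refl))
∑<-neq (suc N) (suc i) = ℚ.≤-trans (ℚ.≤-reflexive (trans (∑<-suc N _) (ℚ.+-identityˡ _))) (∑<-neq N i)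

∑<-fresh : ∀ N {n} (t : Vec ℕ n) → ∑< N (λ j → 1ℚ - fresh j t) ≤ ι n
∑<-fresh N []      = ℚ.≤-reflexive (trans (∑<-const N 0ℚ) (ℚ.*-zeroʳ (ι N)))
∑<-fresh N {suc n} (i ∷ t) = ℚ.≤-trans
  (∑<-mono N (λ j _ → ≤-from (*-nonneg (0≤-diff (proj₂ (neq-bounds j i))) (0≤-diff (proj₂ (fresh-bounds j t))))
    (solve 2 (λ a b → con 1ℚ :- a :+ (con 1ℚ :- b) := con 1ℚ :- a :* b :+ (con 1ℚ :- a) :* (con 1ℚ :- b)) refl (neq j i) (fresh j t))))
  (ℚ.≤-trans (ℚ.≤-reflexive (∑<-+ N (λ j → 1ℚ - neq j i) (λ j → 1ℚ - fresh j t)))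
   (ℚ.≤-trans (ℚ.+-mono-≤ (∑<-neq N i) (∑<-fresh N t)) (ℚ.≤-reflexive (sym (ι-suc n)))))

∑<-Avg : ∀ w N M n (f : ℕ → Vec ℕ n → ℚ) → ∑< M (λ j → Avg w N n (f j)) ≡ Avg w N n (λ t → ∑< M (λ j → f j t))
∑<-Avg w N zero    n f = sym (trans (Avg-*ˡ w N n 0ℚ (λ _ → 0ℚ)) (ℚ.*-zeroˡ (Avg w N n (λ _ → 0ℚ))))
∑<-Avg w N (suc M) n f = trans (cong (_+ Avg w N n (f M)) (∑<-Avg w N M n f)) (sym (Avg-+ w N n (λ t → ∑< M (λ j → f j t)) (f M)))

module _ (w : ℚ) (N : ℕ) (0≤w : 0ℚ ≤ w) (Nw≡1 : ι N * w ≡ 1ℚ) where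

  AvgInj≤Avg : ∀ n f → (∀ t → 0ℚ ≤ f t) → AvgInj w N n f ≤ Avg w N n f
  AvgInj≤Avg zero    f 0≤f = ℚ.≤-refl
  AvgInj≤Avg (suc n) f 0≤f = ∑<-mono N (λ j _ → *-monoˡ 0≤w (ℚ.≤-trans
    (AvgInj≤Avg n (λ t → fresh j t * f (j ∷ t)) (λ t → *-nonneg (proj₁ (fresh-bounds j t)) (0≤f (j ∷ t))))
    (Avg-mono w N 0≤w n (λ t → ℚ.≤-trans (*-monoʳ (0≤f (j ∷ t)) (proj₂ (fresh-bounds j t))) (ℚ.≤-reflexive (ℚ.*-identityˡ _))))))

  -- A union bound: each entry agrees with one of the at most n later entries with probability at
  -- most n w, and a labeling lost in this way weighs at most `b`.
  Avg≤AvgInj : ∀ n b f → 0ℚ ≤ b → (∀ t → 0ℚ ≤ f t) → (∀ t → f t ≤ b) →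
    Avg w N n f ≤ AvgInj w N n f + b * (ι n * ι n) * w
  Avg≤AvgInj zero    b f 0≤b 0≤f f≤b = ≤-from (*-nonneg (*-nonneg 0≤b (*-nonneg (0≤ι 0) (0≤ι 0))) 0≤w) refl
  Avg≤AvgInj (suc n) b f 0≤b 0≤f f≤b = begin
    ∑< N (λ j → w * Avg w N n (λ t → f (j ∷ t)))
      ≤⟨ ∑<-mono N (λ j _ → *-monoˡ 0≤w (split j)) ⟩
    ∑< N (λ j → w * (AvgInj w N n (g j) + k + b * Avg w N n (λ t → 1ℚ - fresh j t)))
      ≡⟨ trans (∑<-cong N (λ j _ → solve 5 (λ w s k b a → w :* (s :+ k :+ b :* a) := w :* s :+ w :* k :+ b :* w :* a) refl
            w (AvgInj w N n (g j)) k b (Avg w N n (λ t → 1ℚ - fresh j t))))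
          (trans (∑<-+ N _ _) (cong₂ _+_ (trans (∑<-+ N _ _) (cong (AvgInj w N (suc n) f +_) (∑<-w w N Nw≡1 k)))
            (trans (∑<-*ˡ N (b * w) _) (cong (b * w *_) (∑<-Avg w N N n _))))) ⟩
    AvgInj w N (suc n) f + k + b * w * Avg w N n (λ t → ∑< N (λ j → 1ℚ - fresh j t))
      ≤⟨ ℚ.+-monoʳ-≤ (AvgInj w N (suc n) f + k) (*-monoˡ (*-nonneg 0≤b 0≤w)
          (ℚ.≤-trans (Avg-mono w N 0≤w n (∑<-fresh N)) (ℚ.≤-reflexive (Avg-const w N Nw≡1 n (ι n))))) ⟩
    AvgInj w N (suc n) f + k + b * w * ι n
      ≤⟨ ≤-from (*-nonneg (*-nonneg 0≤b 0≤w) (+-nonneg 0≤1 (0≤ι n)))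
          (trans (cong (λ z → AvgInj w N (suc n) f + b * (z * z) * w) (ι-suc n))
           (solve 4 (λ s b n w → s :+ b :* ((con 1ℚ :+ n) :* (con 1ℚ :+ n)) :* w :=
              s :+ b :* (n :* n) :* w :+ b :* w :* n :+ b :* w :* (con 1ℚ :+ n)) refl (AvgInj w N (suc n) f) b (ι n) w)) ⟩
    AvgInj w N (suc n) f + b * (ι (suc n) * ι (suc n)) * w ∎
    where
    open ℚ.≤-Reasoning
    g : ℕ → Vec ℕ n → ℚ
    g j t = fresh j t * f (j ∷ t)
    k : ℚ
    k = b * (ι n * ι n) * w
    split : ∀ j → Avg w N n (λ t → f (j ∷ t)) ≤ AvgInj w N n (g j) + k + b * Avg w N n (λ t → 1ℚ - fresh j t)
    split j = ℚ.≤-trans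
      (Avg-mono w N 0≤w n (λ t → ℚ.≤-trans
        (ℚ.≤-reflexive (solve 2 (λ a b → b := a :* b :+ b :* (con 1ℚ :- a)) refl (fresh j t) (f (j ∷ t))))
        (ℚ.+-monoʳ-≤ (g j t) (*-monoʳ (0≤-diff (proj₂ (fresh-bounds j t))) (f≤b (j ∷ t))))))
      (ℚ.≤-trans (ℚ.≤-reflexive (trans (Avg-+ w N n (g j) _) (cong (Avg w N n (g j) +_) (Avg-*ˡ w N n b _))))
       (ℚ.+-monoˡ-≤ _ (Avg≤AvgInj n b (g j) 0≤b (λ t → *-nonneg (proj₁ (fresh-bounds j t)) (0≤f (j ∷ t)))
         (λ t → ℚ.≤-trans (*-mono (proj₁ (fresh-bounds j t)) (proj₂ (fresh-bounds j t)) (0≤f (j ∷ t)) (f≤b (j ∷ t))) (ℚ.≤-reflexive (ℚ.*-identityˡ b))))))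

-- Greedy driven by labels

-- Strict, so equal labels do not block each other. Acceptance thus refers to strictly smaller
-- labels only and is well-founded even when there are ties.
lt : ℕ → ℕ → ℚ
lt a       zero    = 0ℚ
lt zero    (suc b) = 1ℚ
lt (suc a) (suc b) = lt a b

lt-01 : ∀ a b → (a ℕ.< b × lt a b ≡ 1ℚ) ⊎ (b ℕ.≤ a × lt a b ≡ 0ℚ)
lt-01 a       zero    = inj₂ (ℕ.z≤n , refl)
lt-01 zero    (suc b) = inj₁ (ℕ.s≤s ℕ.z≤n , refl)
lt-01 (suc a) (suc b) with lt-01 a b
... | inj₁ (p , e) = inj₁ (ℕ.s≤s p , e)
... | inj₂ (p , e) = inj₂ (ℕ.s≤s p , e)

lt-bounds : ∀ a b → 0ℚ ≤ lt a b × lt a b ≤ 1ℚ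
lt-bounds a       zero    = ℚ.≤-refl , 0≤1
lt-bounds zero    (suc b) = 0≤1 , ℚ.≤-refl
lt-bounds (suc a) (suc b) = lt-bounds a b

lt-cong : ∀ a b {x y} → (a ℕ.< b → x ≡ y) → lt a b * x ≡ lt a b * y
lt-cong a b {x} {y} h with lt-01 a b
... | inj₁ (a<b , _) = cong (lt a b *_) (h a<b)
... | inj₂ (_ , e) rewrite e = trans (ℚ.*-zeroˡ x) (sym (ℚ.*-zeroˡ y))

-- al v is 1 for a living node v and 0 for a dead one; K c v is 1 if choosing c kills v and 0 otherwise.
blocking : ∀ {n} → (Fin n → Fin n → ℚ) → Vec ℕ n → (Fin n → ℚ) → Fin n → Fin n → ℚ
blocking K t X v c = lt (Vec.lookup t c) (Vec.lookup t v) * (K c v * X c)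

accept : ∀ {n} → (Fin n → ℚ) → (Fin n → Fin n → ℚ) → Vec ℕ n → (Fin n → ℚ) → Fin n → ℚ
accept al K t X v = al v * prod (λ c → 1ℚ - blocking K t X v c)

iter : ∀ {n} → (Fin n → ℚ) → (Fin n → Fin n → ℚ) → Vec ℕ n → ℕ → Fin n → ℚ
iter al K t zero    v = 1ℚ
iter al K t (suc k) v = accept al K t (iter al K t k) v

-- Labels decrease along a chain of blocking nodes, so this many rounds reach the fixed point.
chosen : ∀ {n} → (Fin n → ℚ) → (Fin n → Fin n → ℚ) → Vec ℕ n → Fin n → ℚ
chosen al K t = iter al K t (suc (Vec.sum t))

module _ {n} (al : Fin n → ℚ) (K : Fin n → Fin n → ℚ) (t : Vec ℕ n) where

  accept-cong : ∀ {X Y} v → (∀ c → Vec.lookup t c ℕ.< Vec.lookup t v → X c ≡ Y c) → accept al K t X v ≡ accept al K t Y v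
  accept-cong v h = cong (al v *_) (prod-cong (λ c → cong (λ z → 1ℚ - z)
    (lt-cong (Vec.lookup t c) (Vec.lookup t v) (λ c<v → cong (K c v *_) (h c c<v)))))

  -- Acceptance at `v` looks only at smaller labels, so strong induction on the label, bounded by
  -- `b`, determines every value.
  unique : ∀ {X Y} → (∀ v → X v ≡ accept al K t X v) → (∀ v → Y v ≡ accept al K t Y v) → ∀ b v → Vec.lookup t v ℕ.< b → X v ≡ Y v
  unique {X} {Y} hX hY (suc b) v v<b = trans (hX v) (trans
    (accept-cong v (λ c c<v → unique hX hY b c (ℕ.<-≤-trans c<v (ℕ.s≤s⁻¹ v<b)))) (sym (hY v)))

  iter-stable : ∀ k v → Vec.lookup t v ℕ.< k → iter al K t k v ≡ iter al K t (suc k) v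
  iter-stable (suc k) v v<k = accept-cong v (λ c c<v → iter-stable k c (ℕ.<-≤-trans c<v (ℕ.s≤s⁻¹ v<k)))

lookup≤sum : ∀ {n} (t : Vec ℕ n) v → Vec.lookup t v ℕ.≤ Vec.sum t
lookup≤sum (x ∷ t) zero    = ℕ.m≤m+n x (Vec.sum t)
lookup≤sum (x ∷ t) (suc v) = ℕ.≤-trans (lookup≤sum t v) (ℕ.m≤n+m (Vec.sum t) x)

chosen-accept : ∀ {n} al K (t : Vec ℕ n) v → chosen al K t v ≡ accept al K t (chosen al K t) v
chosen-accept al K t v = iter-stable al K t (suc (Vec.sum t)) v (ℕ.s≤s (lookup≤sum t v))

-- The way all identities between chosen sets are obtained: it suffices to check the fixed-point
-- equation.
chosen-unique : ∀ {n} al K (t : Vec ℕ n) {X} → (∀ v → X v ≡ accept al K t X v) → ∀ v → X v ≡ chosen al K t v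
chosen-unique al K t hX v = unique al K t hX (chosen-accept al K t) _ v ℕ.≤-refl

size : ∀ {n} → (Fin n → ℚ) → (Fin n → Fin n → ℚ) → Vec ℕ n → ℚ
size al K t = sum (chosen al K t)

size-cong : ∀ {n} {al al′ : Fin n → ℚ} K (t : Vec ℕ n) → (∀ v → al v ≡ al′ v) → size al K t ≡ size al′ K t
size-cong {al = al} {al′} K t h = sum-cong-≗ (chosen-unique al′ K t (λ v → trans (chosen-accept al K t v)
  (cong (_* prod (λ c → 1ℚ - blocking K t (chosen al K t) v c)) (h v))))

size-map : ∀ {n} al K (t : Vec ℕ n) → size al K (Vec.map suc t) ≡ size al K t
size-map al K t = sum-cong-≗ (chosen-unique al K t (λ v → trans (chosen-accept al K (Vec.map suc t) v)
  (cong (al v *_) (prod-cong (λ c → cong₂ (λ a b → 1ℚ - lt a b * (K c v * chosen al K (Vec.map suc t) c))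
    (Vec.lookup-map c suc t) (Vec.lookup-map v suc t))))))

from-does : ∀ {P : Set} (P? : Dec P) → T (does P?) → P
from-does (yes p) _ = p

prod-1 : ∀ n {f : Fin n → ℚ} → (∀ i → f i ≡ 1ℚ) → prod f ≡ 1ℚ
prod-1 zero    h = refl
prod-1 (suc n) h = cong₂ _*_ (h zero) (prod-1 n (h ∘ suc))

push-lookup : ∀ {n} i (t : Vec ℕ n) → Vec.lookup (push i t) i ≡ 0
push-lookup i t = Vec.insertAt-lookup (Vec.map suc t) i 0

push-punchIn : ∀ {n} i (t : Vec ℕ n) v → Vec.lookup (push i t) (punchIn i v) ≡ suc (Vec.lookup t v)
push-punchIn i t v = trans (Vec.insertAt-punchIn (Vec.map suc t) i 0 v) (Vec.lookup-map v suc t)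

-- The node labelled 0 decides first; afterwards the others play among themselves, those it blocks being dead.
size-push : ∀ {n} (al : Fin (suc n) → ℚ) K i (t : Vec ℕ n) →
  size al K (push i t) ≡ al i + size (λ v → al (punchIn i v) * (1ℚ - K i (punchIn i v) * al i)) (λ c v → K (punchIn i c) (punchIn i v)) t
size-push {n} al K i t = trans (sum-remove {i = i} X) (cong₂ _+_ Xi (sum-cong-≗ (chosen-unique al′ K′ t X-accept)))
  where
  X : Fin (suc n) → ℚ
  X = chosen al K (push i t)
  al′ : Fin n → ℚ
  al′ v = al (punchIn i v) * (1ℚ - K i (punchIn i v) * al i)
  K′ : Fin n → Fin n → ℚ
  K′ c v = K (punchIn i c) (punchIn i v)
  Xi : X i ≡ al i
  Xi = trans (chosen-accept al K (push i t) i) (trans (cong (al i *_) (prod-1 (suc n) (λ c →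
    trans (cong (λ z → 1ℚ - lt (Vec.lookup (push i t) c) z * (K c i * X c)) (push-lookup i t))
      (cong (λ z → 1ℚ - z) (ℚ.*-zeroˡ (K c i * X c)))))) (ℚ.*-identityʳ (al i)))
  X-accept : ∀ v → X (punchIn i v) ≡ accept al′ K′ t (X ∘ punchIn i) v
  X-accept v = trans (chosen-accept al K (push i t) (punchIn i v))
    (trans (cong (al (punchIn i v) *_) (trans (prod-remove {i = i} (λ c → 1ℚ - blocking K (push i t) X (punchIn i v) c))
      (cong₂ _*_
        (trans (cong₂ (λ a b → 1ℚ - lt a b * (K i (punchIn i v) * X i)) (push-lookup i t) (push-punchIn i t v))
          (cong (λ z → 1ℚ - z) (trans (ℚ.*-identityˡ (K i (punchIn i v) * X i)) (cong (K i (punchIn i v) *_) Xi))))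
        (prod-cong (λ c → cong₂ (λ a b → 1ℚ - lt a b * (K′ c v * X (punchIn i c))) (push-punchIn i t c) (push-punchIn i t v))))))
    (sym (ℚ.*-assoc (al (punchIn i v)) (1ℚ - K i (punchIn i v) * al i) _)))

-- Randomized greedy as an average over injective labelings

𝟙 : Bool → ℚ
𝟙 b = if b then 1ℚ else 0ℚ

tabulate-filter-remove : ∀ {A : Set} {P : A → Set} (P? : ∀ x → Dec (P x)) n (ns : Fin (suc n) → A) i → ¬ P (ns i) →
  filter P? (List.tabulate ns) ≡ filter P? (List.tabulate (ns ∘ punchIn i))
tabulate-filter-remove P? n ns zero ¬p = List.filter-reject P? ¬p
tabulate-filter-remove P? (suc n) ns (suc i) ¬p with does (P? (ns zero))
... | true  = cong (ns zero ∷_) (tabulate-filter-remove P? n (ns ∘ suc) i ¬p)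
... | false = tabulate-filter-remove P? n (ns ∘ suc) i ¬p

-- The indices outside `L` number n - |L| and contribute `c` each; moving |L| c to the left avoids
-- the subtraction.
sum-filter : ∀ {A : Set} n (ns : Fin n → A) (al : A → Bool) (φ : A → ℚ) c →
  let L = filter (T? ∘ al) (List.tabulate ns) in
  sum (λ i → if al (ns i) then φ (ns i) else c) + ι (length L) * c ≡ sum (λ i → φ (lookup L i)) + ι n * c
sum-filter zero    ns al φ c = refl
sum-filter (suc n) ns al φ c with al (ns zero) | sum-filter n (ns ∘ suc) al φ c
... | true | ih = trans (cong (λ z → φ (ns zero) + s + z * c) (ι-suc l))
    (trans (solve 4 (λ a s l c → a :+ s :+ (con 1ℚ :+ l) :* c := a :+ c :+ (s :+ l :* c)) refl (φ (ns zero)) s (ι l) c)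
    (trans (cong (φ (ns zero) + c +_) ih)
    (trans (solve 4 (λ a s n c → a :+ c :+ (s :+ n :* c) := a :+ s :+ (con 1ℚ :+ n) :* c) refl (φ (ns zero)) s′ (ι n) c)
      (cong (λ z → φ (ns zero) + s′ + z * c) (sym (ι-suc n))))))
  where
  l : ℕ
  l = length (filter (T? ∘ al) (List.tabulate (ns ∘ suc)))
  s s′ : ℚ
  s = sum (λ i → if al (ns (suc i)) then φ (ns (suc i)) else c)
  s′ = sum (λ i → φ (lookup (filter (T? ∘ al) (List.tabulate (ns ∘ suc))) i))
... | false | ih = trans (ℚ.+-assoc c s (ι l * c)) (trans (cong (c +_) ih)
    (trans (solve 3 (λ s n c → c :+ (s :+ n :* c) := s :+ (con 1ℚ :+ n) :* c) refl s′ (ι n) c)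
      (cong (λ z → s′ + z * c) (sym (ι-suc n)))))
  where
  l : ℕ
  l = length (filter (T? ∘ al) (List.tabulate (ns ∘ suc)))
  s s′ : ℚ
  s = sum (λ i → if al (ns (suc i)) then φ (ns (suc i)) else c)
  s′ = sum (λ i → φ (lookup (filter (T? ∘ al) (List.tabulate (ns ∘ suc))) i))

𝔼-* : ∀ {A : Set} c (X : A → ℚ) ω → 𝔼 (λ a → c * X a) ω ≡ c * 𝔼 X ω
𝔼-* c X (return a) = refl
𝔼-* c X (uniform n k) = trans (cong ((ℤ.+ 1 / n) *_) (trans (sum-cong-≗ (λ i → 𝔼-* c X (k i))) (sum-*ˡ n c _)))
  (solve 3 (λ a c s → a :* (c :* s) := c :* (a :* s)) refl (ℤ.+ 1 / n) c (sum (λ i → 𝔼 X (k i))))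

𝔼-cong : ∀ {A : Set} {X Y : A → ℚ} → (∀ a → X a ≡ Y a) → ∀ ω → 𝔼 X ω ≡ 𝔼 Y ω
𝔼-cong h (return a) = h a
𝔼-cong h (uniform n k) = cong ((ℤ.+ 1 / n) *_) (sum-cong-≗ (λ i → 𝔼-cong h (k i)))

𝔼-length-∷ : ∀ {A : Set} (x : A) ω → 𝔼 (ι ∘ length) (mapᴿ (x ∷_) ω) ≡ 1ℚ + 𝔼 (ι ∘ length) ω
𝔼-length-∷ x (return xs) = ι-suc (length xs)
𝔼-length-∷ x (uniform n k) = trans (cong (δ *_) (trans (sum-cong-≗ (λ i → 𝔼-length-∷ x (k i)))
    (trans (∑-distrib-+ {n} (λ _ → 1ℚ) (λ i → 𝔼 (ι ∘ length) (k i))) (cong (_+ s) (sum-const n 1ℚ)))))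
  (trans (solve 3 (λ d n s → d :* (n :* con 1ℚ :+ s) := d :* n :+ d :* s) refl δ (ι n) s)
    (cong (_+ δ * s) (/-*ι 1 n)))
  where
  δ s : ℚ
  δ = ℤ.+ 1 / n
  s = sum (λ i → 𝔼 (ι ∘ length) (k i))

0≤𝔼-length : ∀ {A : Set} (ω : Rand (List A)) → 0ℚ ≤ 𝔼 (ι ∘ length) ω
0≤𝔼-length (return xs) = 0≤ι (length xs)
0≤𝔼-length (uniform n k) = *-nonneg (0≤/ 1 n) (subst (_≤ sum (λ i → 𝔼 (ι ∘ length) (k i))) (trans (sum-const n 0ℚ) (ℚ.*-zeroʳ (ι n))) (sum-mono n (λ i → 0≤𝔼-length (k i))))

module GreedyRun (G : Graph) where
  open Graph G using (Node; order)
  open Greedy G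

  run-irrelevant : ∀ ws (a b : Acc ℕ._<_ (length ws)) → 𝔼 (ι ∘ length) (run ws a) ≡ 𝔼 (ι ∘ length) (run ws b)
  run-irrelevant []       a        b        = refl
  run-irrelevant ws@(_ ∷ _) (acc rs) (acc qs) = cong ((ℤ.+ 1 / length ws) *_) (sum-cong-≗ (λ i →
    trans (𝔼-length-∷ (lookup ws i) (run (delete (lookup ws i) ws) (rs (delete-< ws i)))) (trans (cong (λ z → 1ℚ + z) (run-irrelevant (delete (lookup ws i) ws) (rs (delete-< ws i)) (qs (delete-< ws i))))
      (sym (𝔼-length-∷ (lookup ws i) (run (delete (lookup ws i) ws) (qs (delete-< ws i))))))))

  mean : List Node → ℚ
  mean ws = 𝔼 (ι ∘ length) (run ws (<-wellFounded _))

  -- Multiplying by the number of remaining nodes lets the recursion of greedy cover the empty list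
  -- too. `run` unfolds only at an explicit `acc`, hence the exchange of the accessibility proof.
  mean-step : ∀ ws → ι (length ws) * mean ws ≡ sum (λ i → 1ℚ + mean (delete (lookup ws i) ws))
  mean-step ws = trans (cong (ι (length ws) *_) (run-irrelevant ws (<-wellFounded _) (acc (λ {y} _ → <-wellFounded y)))) (go ws)
    where
    go : ∀ ws → ι (length ws) * 𝔼 (ι ∘ length) (run ws (acc (λ {y} _ → <-wellFounded y))) ≡ sum (λ i → 1ℚ + mean (delete (lookup ws i) ws))
    go []         = refl
    go ws@(_ ∷ _) = trans (solve 3 (λ n d s → n :* (d :* s) := d :* n :* s) refl (ι (length ws)) (ℤ.+ 1 / length ws) s)
      (trans (cong (_* s) (/-*ι 1 (length ws))) (trans (ℚ.*-identityˡ s) (sum-cong-≗ (λ i → 𝔼-length-∷ (lookup ws i) (run (delete (lookup ws i) ws) (<-wellFounded (length (delete (lookup ws i) ws))))))))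
      where
      s : ℚ
      s = sum (λ i → 𝔼 (ι ∘ length) (mapᴿ (lookup ws i ∷_) (run (delete (lookup ws i) ws) (<-wellFounded _))))

  living : ∀ {n} → (Fin n → Node) → (Node → Bool) → List Node
  living ns al = filter (T? ∘ al) (List.tabulate ns)

  after : Node → (Node → Bool) → Node → Bool
  after u al w = if al u then al w ∧ does (survives? u w) else al w

  conflict : Node → Node → ℚ
  conflict u w = 1ℚ - 𝟙 (does (survives? u w))

  sizeᴳ : ∀ {n} → (Fin n → Node) → (Node → Bool) → Vec ℕ n → ℚ
  sizeᴳ ns al = size (𝟙 ∘ al ∘ ns) (λ c v → conflict (ns c) (ns v))

  𝟙-after : ∀ u al w → 𝟙 (al w) * (1ℚ - conflict u w * 𝟙 (al u)) ≡ 𝟙 (after u al w)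
  𝟙-after u al w with al u | al w | does (survives? u w)
  ... | true  | true  | true  = refl
  ... | true  | true  | false = refl
  ... | true  | false | true  = refl
  ... | true  | false | false = refl
  ... | false | true  | true  = refl
  ... | false | true  | false = refl
  ... | false | false | true  = refl
  ... | false | false | false = refl

  filter-∧ : ∀ u (al : Node → Bool) ws → filter (T? ∘ (λ w → al w ∧ does (survives? u w))) ws ≡ delete u (filter (T? ∘ al) ws)
  filter-∧ u al []       = refl
  filter-∧ u al (w ∷ ws) with al w
  ... | false = filter-∧ u al ws
  ... | true with does (survives? u w)
  ...   | true  = cong (w ∷_) (filter-∧ u al ws)
  ...   | false = filter-∧ u al ws

  mean-after : ∀ {n} (ns : Fin (suc n) → Node) al i →
    𝟙 (al (ns i)) + mean (living (ns ∘ punchIn i) (after (ns i) al))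
      ≡ (if al (ns i) then 1ℚ + mean (delete (ns i) (living ns al)) else mean (living ns al))
  mean-after {n} ns al i with al (ns i) in eq
  ... | true  = cong (λ l → 1ℚ + mean l) (trans
    (sym (tabulate-filter-remove (T? ∘ (λ w → al w ∧ does (survives? (ns i) w))) n ns i not-self)) (filter-∧ (ns i) al (List.tabulate ns)))
    where
    not-self : ¬ T (al (ns i) ∧ does (survives? (ns i) (ns i)))
    not-self h = proj₁ (from-does (survives? (ns i) (ns i)) (subst (λ b → T (b ∧ _)) eq h)) refl
  ... | false = trans (ℚ.+-identityˡ _) (cong mean (sym (tabulate-filter-remove (T? ∘ al) n ns i (λ h → subst T eq h))))

  -- Drawing uniformly among all nodes and doing nothing at a dead one has the same mean as a step
  -- of greedy: the idle draws contribute the mean itself, which cancels on both sides.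
  sum-mean-after : ∀ {n} (ns : Fin (suc n) → Node) al →
    sum (λ i → 𝟙 (al (ns i)) + mean (living (ns ∘ punchIn i) (after (ns i) al))) ≡ ι (suc n) * mean (living ns al)
  sum-mean-after {n} ns al = trans (sum-cong-≗ (mean-after ns al)) (cancel (trans
    (sum-filter (suc n) ns al (λ u → 1ℚ + mean (delete u L)) (mean L))
    (trans (cong (_+ ι (suc n) * mean L) (sym (mean-step L))) (ℚ.+-comm (ι (length L) * mean L) (ι (suc n) * mean L)))))
    where
    L : List Node
    L = living ns al
    cancel : ∀ {a b c} → a + c ≡ b + c → a ≡ b
    cancel {a} {b} {c} e = trans (solve 2 (λ a c → a := a :+ c :- c) refl a c)
      (trans (cong (_- c) e) (solve 2 (λ a c → a :+ c :- c := a) refl b c))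

  -- Induction on the number of labels. If no node has label 0, all labels shift down; otherwise
  -- exactly one has it, every node contributes with equal weight, and its decision is the first
  -- draw of greedy. The factor on the right is the total weight of injective labelings, which obeys
  -- the same recursion.
  AvgInj-size : ∀ w N n (ns : Fin n → Node) al →
    AvgInj w N n (sizeᴳ ns al) ≡ AvgInj w N n (λ _ → 1ℚ) * mean (living ns al)
  AvgInj-size w N       zero    ns al = refl
  AvgInj-size w zero    (suc n) ns al = sym (ℚ.*-zeroˡ (mean (living ns al)))
  AvgInj-size w (suc N) (suc n) ns al = begin
    AvgInj w (suc N) (suc n) (sizeᴳ ns al)
      ≡⟨ AvgInj-suc w N (suc n) (sizeᴳ ns al) ⟩
    AvgInj w N (suc n) (sizeᴳ ns al ∘ Vec.map suc) + w * sum (λ i → AvgInj w N n (λ t → sizeᴳ ns al (push i t)))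
      ≡⟨ cong₂ (λ a b → a + w * b)
          (trans (AvgInj-cong w N (suc n) (size-map (𝟙 ∘ al ∘ ns) (λ c v → conflict (ns c) (ns v)))) (AvgInj-size w N (suc n) ns al))
          (trans (sum-cong-≗ term) (trans (sum-*ˡ (suc n) p (λ i → 𝟙 (al (ns i)) + mean (living (ns ∘ punchIn i) (after (ns i) al)))) (cong (p *_) (sum-mean-after ns al)))) ⟩
    q * μ + w * (p * (ι (suc n) * μ))
      ≡⟨ solve 5 (λ q μ w p n → q :* μ :+ w :* (p :* (n :* μ)) := (q :+ w :* (n :* p)) :* μ) refl q μ w p (ι (suc n)) ⟩
    (q + w * (ι (suc n) * p)) * μ
      ≡⟨ cong (_* μ) (sym (trans (AvgInj-suc w N (suc n) (λ _ → 1ℚ)) (cong (q +_) (pushed-1 w N n)))) ⟩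
    AvgInj w (suc N) (suc n) (λ _ → 1ℚ) * μ ∎
    where
    open ≡-Reasoning
    μ p q : ℚ
    μ = mean (living ns al)
    p = AvgInj w N n (λ _ → 1ℚ)
    q = AvgInj w N (suc n) (λ _ → 1ℚ)
    term : ∀ i → AvgInj w N n (λ t → sizeᴳ ns al (push i t))
      ≡ p * (𝟙 (al (ns i)) + mean (living (ns ∘ punchIn i) (after (ns i) al)))
    term i = begin
      AvgInj w N n (λ t → sizeᴳ ns al (push i t))
        ≡⟨ AvgInj-cong w N n (λ t → trans (size-push (𝟙 ∘ al ∘ ns) (λ c v → conflict (ns c) (ns v)) i t) (cong (𝟙 (al (ns i)) +_)
             (size-cong (λ c v → conflict (ns (punchIn i c)) (ns (punchIn i v))) t (λ v → 𝟙-after (ns i) al (ns (punchIn i v)))))) ⟩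
      AvgInj w N n (λ t → 𝟙 (al (ns i)) + sizeᴳ (ns ∘ punchIn i) (after (ns i) al) t)
        ≡⟨ trans (AvgInj-+ w N n _ _) (cong₂ _+_ (AvgInj-const w N n (𝟙 (al (ns i)))) (AvgInj-size w N n (ns ∘ punchIn i) (after (ns i) al))) ⟩
      𝟙 (al (ns i)) * p + p * mean (living (ns ∘ punchIn i) (after (ns i) al))
        ≡⟨ solve 3 (λ a p m → a :* p :+ p :* m := p :* (a :+ m)) refl (𝟙 (al (ns i))) p _ ⟩
      p * (𝟙 (al (ns i)) + mean (living (ns ∘ punchIn i) (after (ns i) al))) ∎

-- Independence and truncation

DependsOn : ∀ {n} → (Fin n → Set) → (Vec ℕ n → ℚ) → Set
DependsOn A f = ∀ s t → (∀ v → A v → Vec.lookup s v ≡ Vec.lookup t v) → f s ≡ f t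

depends-∷ : ∀ {n} {A : Fin (suc n) → Set} {f} → DependsOn A f → ∀ j → DependsOn (A ∘ suc) (λ t → f (j ∷ t))
depends-∷ dep j s t h = dep (j ∷ s) (j ∷ t) (λ { zero _ → refl ; (suc v) → h v })

ignores-head : ∀ {n} {A : Fin (suc n) → Set} {f} → DependsOn A f → ¬ A zero → ∀ i j t → f (i ∷ t) ≡ f (j ∷ t)
ignores-head dep ¬A i j t = dep (i ∷ t) (j ∷ t) (λ { zero a → contradiction a ¬A ; (suc v) _ → refl })

∑<-comm : ∀ m n (f : ℕ → ℕ → ℚ) → ∑< m (λ i → ∑< n (f i)) ≡ ∑< n (λ j → ∑< m (λ i → f i j))
∑<-comm zero    n f = sym (trans (∑<-const n 0ℚ) (ℚ.*-zeroʳ (ι n)))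
∑<-comm (suc m) n f = trans (cong (_+ ∑< n (f m)) (∑<-comm m n f)) (sym (∑<-+ n (λ j → ∑< m (λ i → f i j)) (f m)))

module _ (w : ℚ) (N : ℕ) (Nw≡1 : ι N * w ≡ 1ℚ) where

  Avg-∷-const : ∀ n (f : Vec ℕ (suc n) → ℚ) i → (∀ j t → f (j ∷ t) ≡ f (i ∷ t)) → Avg w N (suc n) f ≡ Avg w N n (λ t → f (i ∷ t))
  Avg-∷-const n f i h = trans (∑<-cong N (λ j _ → cong (w *_) (Avg-cong w N n (h j)))) (∑<-w w N Nw≡1 (Avg w N n (λ t → f (i ∷ t))))

  -- Independence, one label at a time: `A?` tells which factor ignores the head label, and that
  -- factor leaves the sum. Its value at label 0 stands for all others.
  Avg-* : ∀ n {A : Fin n → Set} (A? : ∀ v → Dec (A v)) {f g} → DependsOn A f → DependsOn (¬_ ∘ A) g →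
    Avg w N n (λ t → f t * g t) ≡ Avg w N n f * Avg w N n g
  Avg-* zero    A? depf depg = refl
  Avg-* (suc n) A? {f} {g} depf depg with A? zero
  ... | yes a = begin
    ∑< N (λ j → w * Avg w N n (λ t → f (j ∷ t) * g (j ∷ t)))
      ≡⟨ ∑<-cong N (λ j _ → trans (cong (w *_) (trans (Avg-cong w N n (λ t → cong (f (j ∷ t) *_) (g₀ j t)))
            (Avg-* n (A? ∘ suc) (depends-∷ depf j) (depends-∷ depg 0))))
          (solve 3 (λ w a b → w :* (a :* b) := b :* (w :* a)) refl w (Avg w N n (λ t → f (j ∷ t))) G)) ⟩
    ∑< N (λ j → G * (w * Avg w N n (λ t → f (j ∷ t))))
      ≡⟨ trans (∑<-*ˡ N G _) (ℚ.*-comm G _) ⟩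
    Avg w N (suc n) f * G
      ≡⟨ cong (Avg w N (suc n) f *_) (sym (Avg-∷-const n g 0 g₀)) ⟩
    Avg w N (suc n) f * Avg w N (suc n) g ∎
    where
    open ≡-Reasoning
    G : ℚ
    G = Avg w N n (λ t → g (0 ∷ t))
    g₀ : ∀ j t → g (j ∷ t) ≡ g (0 ∷ t)
    g₀ j = ignores-head {f = g} depg (λ ¬a → ¬a a) j 0
  ... | no ¬a = begin
    ∑< N (λ j → w * Avg w N n (λ t → f (j ∷ t) * g (j ∷ t)))
      ≡⟨ ∑<-cong N (λ j _ → trans (cong (w *_) (trans (Avg-cong w N n (λ t → cong (_* g (j ∷ t)) (f₀ j t)))
            (Avg-* n (A? ∘ suc) (depends-∷ depf 0) (depends-∷ depg j))))
          (solve 3 (λ w a b → w :* (a :* b) := a :* (w :* b)) refl w F (Avg w N n (λ t → g (j ∷ t))))) ⟩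
    ∑< N (λ j → F * (w * Avg w N n (λ t → g (j ∷ t))))
      ≡⟨ ∑<-*ˡ N F _ ⟩
    F * Avg w N (suc n) g
      ≡⟨ cong (_* Avg w N (suc n) g) (sym (Avg-∷-const n f 0 f₀)) ⟩
    Avg w N (suc n) f * Avg w N (suc n) g ∎
    where
    open ≡-Reasoning
    F : ℚ
    F = Avg w N n (λ t → f (0 ∷ t))
    f₀ : ∀ j t → f (j ∷ t) ≡ f (0 ∷ t)
    f₀ j = ignores-head {f = f} depf ¬a j 0

  Avg-prod : ∀ n m {A : Fin m → Fin n → Set} (A? : ∀ i v → Dec (A i v)) {f : Fin m → Vec ℕ n → ℚ} →
    (∀ i → DependsOn (A i) (f i)) → (∀ i j v → A i v → A j v → i ≡ j) →
    Avg w N n (λ t → prod (λ i → f i t)) ≡ prod (λ i → Avg w N n (f i))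
  Avg-prod n zero    A? dep disjoint = Avg-const w N Nw≡1 n 1ℚ
  Avg-prod n (suc m) {A} A? {f} dep disjoint = trans
    (Avg-* n (A? zero) (dep zero) (λ s t h → prod-cong (λ i → dep (suc i) s t (λ v a → h v (λ a₀ → 0≢suc (disjoint zero (suc i) v a₀ a))))))
    (cong (Avg w N n (f zero) *_) (Avg-prod n m (A? ∘ suc) (dep ∘ suc) (λ i j v a b → suc-inj (disjoint (suc i) (suc j) v a b))))
    where
    0≢suc : ∀ {i : Fin m} → ¬ zero ≡ suc i
    0≢suc ()
    suc-inj : ∀ {i j : Fin m} → _≡_ {A = Fin (suc m)} (suc i) (suc j) → i ≡ j
    suc-inj refl = refl

  -- Conditioning on the label of `d`. It is a separate argument of `Φ`, so that the remaining
  -- dependence can be required to avoid entry `d`.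
  Avg-split : ∀ n (d : Fin n) (Φ : ℕ → Vec ℕ n → ℚ) → (∀ i → DependsOn (_≢ d) (Φ i)) →
    Avg w N n (λ t → Φ (Vec.lookup t d) t) ≡ ∑< N (λ i → w * Avg w N n (Φ i))
  Avg-split (suc n) zero Φ dep = ∑<-cong N (λ i _ → cong (w *_)
    (sym (Avg-∷-const n (Φ i) i (λ j t → ignores-head {f = Φ i} (dep i) (λ 0≢0 → 0≢0 refl) j i t))))
  Avg-split (suc n) (suc d) Φ dep = begin
    ∑< N (λ j → w * Avg w N n (λ t → Φ (Vec.lookup t d) (j ∷ t)))
      ≡⟨ ∑<-cong N (λ j _ → trans (cong (w *_) (Avg-split n d (λ i t → Φ i (j ∷ t))
            (λ i s t h → dep i (j ∷ s) (j ∷ t) (λ { zero _ → refl ; (suc v) v≢ → h v (λ e → v≢ (cong suc e)) }))))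
          (sym (∑<-*ˡ N w _))) ⟩
    ∑< N (λ j → ∑< N (λ i → w * (w * Avg w N n (λ t → Φ i (j ∷ t)))))
      ≡⟨ ∑<-comm N N _ ⟩
    ∑< N (λ i → ∑< N (λ j → w * (w * Avg w N n (λ t → Φ i (j ∷ t)))))
      ≡⟨ ∑<-cong N (λ i _ → ∑<-*ˡ N w _) ⟩
    ∑< N (λ i → w * Avg w N (suc n) (Φ i)) ∎
    where open ≡-Reasoning

∑<-lt : ∀ N j f → j ℕ.≤ N → ∑< N (λ i → lt i j * f i) ≡ ∑< j f
∑<-lt N zero f _ = trans (∑<-cong N {g = λ _ → 0ℚ} (λ i _ → ℚ.*-zeroˡ (f i))) (trans (∑<-const N 0ℚ) (ℚ.*-zeroʳ (ι N)))
∑<-lt (suc N) (suc j) f j≤N = trans (∑<-suc N _) (trans (cong₂ _+_ (ℚ.*-identityˡ (f 0)) (∑<-lt N j (f ∘ suc) (ℕ.s≤s⁻¹ j≤N))) (sym (∑<-suc j f)))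

prod-count : ∀ {A : Set} n (ns : Fin n → A) (b : A → Bool) x →
  prod (λ i → if b (ns i) then x else 1ℚ) ≡ x ^ℕ length (filter (T? ∘ b) (List.tabulate ns))
prod-count zero    ns b x = refl
prod-count (suc n) ns b x with b (ns zero) | prod-count n (ns ∘ suc) b x
... | true  | ih = cong (x *_) ih
... | false | ih = trans (ℚ.*-identityˡ _) ih

tabulate-filter-accept : ∀ {A : Set} {P : A → Set} (P? : ∀ x → Dec (P x)) n (ns : Fin (suc n) → A) i → P (ns i) →
  length (filter P? (List.tabulate ns)) ≡ suc (length (filter P? (List.tabulate (ns ∘ punchIn i))))
tabulate-filter-accept P? n ns zero p = cong length (List.filter-accept P? p)
tabulate-filter-accept P? (suc n) ns (suc i) p with does (P? (ns zero))
... | true  = cong suc (tabulate-filter-accept P? n (ns ∘ suc) i p)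
... | false = tabulate-filter-accept P? n (ns ∘ suc) i p

prod-count-without : ∀ n (p : Fin n) (b : Fin n → Bool) x k → T (b p) → length (filter (T? ∘ b) (allFin n)) ≡ suc k →
  prod (λ i → if b i ∧ not (does (p ≟ i)) then x else 1ℚ) ≡ x ^ℕ k
prod-count-without (suc n) p b x k bp count = begin
  prod (λ i → if b i ∧ not (does (p ≟ i)) then x else 1ℚ)
    ≡⟨ prod-remove {i = p} (λ i → if b i ∧ not (does (p ≟ i)) then x else 1ℚ) ⟩
  (if b p ∧ not (does (p ≟ p)) then x else 1ℚ) * prod (λ i → if b (punchIn p i) ∧ not (does (p ≟ punchIn p i)) then x else 1ℚ)
    ≡⟨ cong₂ _*_ at-p (prod-cong off-p) ⟩
  1ℚ * prod (λ i → if b (punchIn p i) then x else 1ℚ)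
    ≡⟨ trans (ℚ.*-identityˡ _) (prod-count n (punchIn p) b x) ⟩
  x ^ℕ length (filter (T? ∘ b) (List.tabulate (punchIn p)))
    ≡⟨ cong (x ^ℕ_) (ℕ.suc-injective (trans (sym (tabulate-filter-accept (T? ∘ b) n id p bp)) count)) ⟩
  x ^ℕ k ∎
  where
  open ≡-Reasoning
  at-p : (if b p ∧ not (does (p ≟ p)) then x else 1ℚ) ≡ 1ℚ
  at-p with b p | p ≟ p
  ... | false | _      = refl
  ... | true  | yes _  = refl
  ... | true  | no p≢p = contradiction refl p≢p
  off-p : ∀ i → (if b (punchIn p i) ∧ not (does (p ≟ punchIn p i)) then x else 1ℚ) ≡ (if b (punchIn p i) then x else 1ℚ)
  off-p i with b (punchIn p i) | p ≟ punchIn p i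
  ... | false | _      = refl
  ... | true  | no _   = refl
  ... | true  | yes e  = contradiction (sym e) (punchInᵢ≢i p i)

0≤𝟙 : ∀ b → 0ℚ ≤ 𝟙 b × 𝟙 b ≤ 1ℚ
0≤𝟙 true  = 0≤1 , ℚ.≤-refl
0≤𝟙 false = ℚ.≤-refl , 0≤1

prod-bounds : ∀ n {f : Fin n → ℚ} → (∀ i → 0ℚ ≤ f i × f i ≤ 1ℚ) → 0ℚ ≤ prod f × prod f ≤ 1ℚ
prod-bounds zero    h = 0≤1 , ℚ.≤-refl
prod-bounds (suc n) h with h zero | prod-bounds n (h ∘ suc)
... | p , q | p′ , q′ = *-nonneg p p′ , *-mono p q p′ q′

prod-mono : ∀ n {f g : Fin n → ℚ} → (∀ i → 0ℚ ≤ f i) → (∀ i → f i ≤ g i) → 0ℚ ≤ prod f × prod f ≤ prod g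
prod-mono zero    h k = 0≤1 , ℚ.≤-refl
prod-mono (suc n) h k with prod-mono n (h ∘ suc) (k ∘ suc)
... | p , q = *-nonneg (h zero) p , *-mono (h zero) (k zero) p q

In01 : {I : Set} → (I → ℚ) → Set
In01 u = ∀ i → 0ℚ ≤ u i × u i ≤ 1ℚ

module _ {n} (al : Fin n → ℚ) (K : Fin n → Fin n → ℚ) (t : Vec ℕ n) (al01 : In01 al) (K01 : ∀ c → In01 (K c)) where

  blocking01 : ∀ {u} → In01 u → ∀ v → In01 (blocking K t u v)
  blocking01 u01 v c with lt-bounds (Vec.lookup t c) (Vec.lookup t v) | K01 c v | u01 c
  ... | a , b | a′ , b′ | a″ , b″ = *-nonneg a (*-nonneg a′ a″) , *-mono a b (*-nonneg a′ a″) (*-mono a′ b′ a″ b″)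

  accept01 : ∀ {u} → In01 u → In01 (accept al K t u)
  accept01 {u} u01 v with al01 v | prod-bounds n {λ c → 1ℚ - blocking K t u v c} (λ c → 0≤-diff (proj₂ (blocking01 u01 v c)) , 1-≤1 (proj₁ (blocking01 u01 v c)))
  ... | a , b | a′ , b′ = *-nonneg a a′ , *-mono a b a′ b′

  iter01 : ∀ k → In01 (iter al K t k)
  iter01 zero    v = 0≤1 , ℚ.≤-refl
  iter01 (suc k) = accept01 (iter01 k)

  accept-anti : ∀ v a b → In01 a → In01 b → (∀ i → a i ≤ b i) → accept al K t b v ≤ accept al K t a v
  accept-anti v a b a01 b01 a≤b = *-monoˡ (proj₁ (al01 v)) (proj₂ (prod-mono n
    (λ c → 0≤-diff (proj₂ (blocking01 b01 v c)))
    (λ c → -‿mono {1ℚ} ℚ.≤-refl (*-monoˡ (proj₁ (lt-bounds (Vec.lookup t c) (Vec.lookup t v))) (*-monoˡ (proj₁ (K01 c v)) (a≤b c))))))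

  -- `chosen` is a fixed point of the order-reversing `accept` and lies below the initial value 1,
  -- so each round changes the side, as for `β`. This holds labeling by labeling, and averaging
  -- preserves it.
  side-iter : ∀ k v → Side k (iter al K t k v) (chosen al K t v)
  side-iter zero    v = proj₂ (iter01 (suc (Vec.sum t)) v)
  side-iter (suc k) v = subst (λ z → Side k z (iter al K t (suc k) v)) (sym (chosen-accept al K t v))
    (side-anti In01 (λ u → accept al K t u v) (accept-anti v) k (iter al K t k) (chosen al K t) (iter01 k) (iter01 (suc (Vec.sum t))) (side-iter k))

-- Walks in graphs of large girth

lookup-injective : ∀ {A : Set} {xs : List A} → Unique xs → ∀ i j → lookup xs i ≡ lookup xs j → i ≡ j
lookup-injective (_  ∷ _) zero    zero    _ = refl
lookup-injective (x≢ ∷ _) zero    (suc j) e = contradiction e (All.lookup x≢ (∈-lookup j))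
lookup-injective (x≢ ∷ _) (suc i) zero    e = contradiction (sym e) (All.lookup x≢ (∈-lookup i))
lookup-injective (_  ∷ u) (suc i) (suc j) e = cong suc (lookup-injective u i j e)

module Local (G : Graph) where
  open Graph G using (Node; order; adj; adj-sym; adj-irr; degree; _~_)

  ~-sym : ∀ {u v} → u ~ v → v ~ u
  ~-sym {u} {v} = subst T (adj-sym u v)

  ~-irr : ∀ {v} → ¬ v ~ v
  ~-irr {v} = subst T (adj-irr v)

  NonBacktracking : List Node → Set
  NonBacktracking []              = ⊤
  NonBacktracking (x ∷ [])        = ⊤
  NonBacktracking (x ∷ y ∷ [])    = x ~ y
  NonBacktracking (x ∷ y ∷ z ∷ l) = x ~ y × x ≢ z × NonBacktracking (y ∷ z ∷ l)

  nb-head : ∀ x y l → NonBacktracking (x ∷ y ∷ l) → x ~ y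
  nb-head x y []      e = e
  nb-head x y (z ∷ l) e = proj₁ e

  nb-tail : ∀ x l → NonBacktracking (x ∷ l) → NonBacktracking l
  nb-tail x []          _ = tt
  nb-tail x (y ∷ [])    _ = tt
  nb-tail x (y ∷ z ∷ l) (_ , _ , nb) = nb

  first-occurrence : ∀ {x : Node} {l} → x ∈ l → ∃[ ys ] ∃[ zs ] l ≡ ys ++ x ∷ zs × All (x ≢_) ys
  first-occurrence {x} {y ∷ l} x∈ with x ≟ y
  ... | yes refl = [] , l , refl , []
  first-occurrence {x} {y ∷ l} (here x≡y)  | no x≢y = contradiction x≡y x≢y
  first-occurrence {x} {y ∷ l} (there x∈l) | no x≢y with first-occurrence x∈l
  ... | ys , zs , eq , fresh = y ∷ ys , zs , cong (y ∷_) eq , x≢y ∷ fresh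

  nb-step : ∀ x ys {zs} → NonBacktracking (x ∷ ys ++ zs) → ∀ i → lookup (x ∷ ys) (inject₁ i) ~ lookup ys i
  nb-step x (y ∷ ys) {zs} nb zero    = nb-head x y (ys ++ zs) nb
  nb-step x (y ∷ ys) {zs} nb (suc i) = nb-step y ys (nb-tail x (y ∷ ys ++ zs) nb) i

  nb-last : ∀ x ys {z zs} → NonBacktracking (x ∷ ys ++ z ∷ zs) → lookup (x ∷ ys) (fromℕ (length ys)) ~ z
  nb-last x []       {z} {zs} nb = nb-head x z zs nb
  nb-last x (y ∷ ys) {z} {zs} nb = nb-last y ys (nb-tail x (y ∷ ys ++ z ∷ zs) nb)

  unique-++ˡ : ∀ ys {zs : List Node} → Unique (ys ++ zs) → Unique ys
  unique-++ˡ []       _        = []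
  unique-++ˡ (y ∷ ys) (y≢ ∷ u) = All.++⁻ˡ ys y≢ ∷ unique-++ˡ ys u

  module Girth (g : ℕ) (girth : Girth≥ g G) where

    -- The stretch from `x` to just before its first recurrence closes up to a cycle with fewer than
    -- `g` nodes. The nodes after `x` on it are distinct by induction on the tail, and avoid `x`
    -- because the recurrence is the first one.
    nb-unique : ∀ l → NonBacktracking l → length l ℕ.≤ g → Unique l
    nb-fresh : ∀ x l → NonBacktracking (x ∷ l) → length (x ∷ l) ℕ.≤ g → ¬ x ∈ l

    nb-unique []      nb len = []
    nb-unique (x ∷ l) nb len = All.¬Any⇒All¬ l (nb-fresh x l nb len) ∷ nb-unique l (nb-tail x l nb) (ℕ.<⇒≤ len)

    nb-fresh x l nb len x∈l with first-occurrence x∈l | nb-unique l (nb-tail x l nb) (ℕ.<⇒≤ len)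
    ... | ys , zs , refl , fresh | u = ℕ.<-irrefl refl (ℕ.<-≤-trans longer (girth cycle))
      where
      long : ∀ ys → NonBacktracking (x ∷ ys ++ x ∷ zs) → 3 ℕ.≤ suc (length ys)
      long []           nb = contradiction (nb-head x x zs nb) ~-irr
      long (y ∷ [])     (_ , x≢x , _) = contradiction refl x≢x
      long (y ∷ z ∷ ys) _  = ℕ.s≤s (ℕ.s≤s (ℕ.s≤s ℕ.z≤n))
      cycle : Cycle G (length ys)
      cycle = record
        { length≥3 = long ys nb
        ; node     = lookup (x ∷ ys)
        ; distinct = λ {i} {j} → lookup-injective (fresh ∷ unique-++ˡ ys u) i j
        ; step     = nb-step x ys nb
        ; close    = nb-last x ys nb
        }
      longer : suc (length ys) ℕ.< g
      longer = ℕ.≤-trans (ℕ.s≤s (ℕ.≤-trans (ℕ.m≤n+m _ (length zs)) (ℕ.≤-reflexive (trans (ℕ.+-comm (length zs) (suc (length ys)))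
        (sym (trans (List.length-++ ys) (ℕ.+-suc (length ys) (length zs)))))))) len

    Child : Maybe Node → Node → Node → Set
    Child mp c d = c ~ d × mp ≢ just d

    -- The nodes at depth 1, …, k below c in the tree of non-backtracking walks that reach c from mp.
    Below : ℕ → Maybe Node → Node → Node → Set
    Branch : ℕ → Maybe Node → Node → Node → Node → Set
    Below zero    mp c x = ⊥
    Below (suc k) mp c x = ∃[ d ] Branch k mp c d x
    Branch k mp c d x = Child mp c d × (x ≡ d ⊎ Below k (just c) d x)

    below? : ∀ k mp c x → Dec (Below k mp c x)
    branch? : ∀ k mp c d x → Dec (Branch k mp c d x)
    below? zero    mp c x = no (λ ())
    below? (suc k) mp c x = any? (λ d → branch? k mp c d x)
    branch? k mp c d x = (T? (adj c d) ×-dec ¬? (Maybe.≡-dec _≟_ mp (just d))) ×-dec (x ≟ d ⊎-dec below? k (just c) d x)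

    below-walk : ∀ k {p c x} → p ~ c → Below k (just p) c x →
      ∃[ l ] NonBacktracking (p ∷ c ∷ l) × x ∈ l × length l ℕ.≤ k
    below-walk (suc k) {p} {c} {x} p~c (d , (c~d , p≢d) , inj₁ refl) =
      d ∷ [] , (p~c , (λ e → p≢d (cong just e)) , c~d) , here refl , ℕ.s≤s ℕ.z≤n
    below-walk (suc k) {p} {c} {x} p~c (d , (c~d , p≢d) , inj₂ b) with below-walk k c~d b
    ... | l , nb , x∈l , len = d ∷ l , (p~c , (λ e → p≢d (cong just e)) , nb) , there x∈l , ℕ.s≤s len

    -- The descent from `c` to `x` is put in front of the given walk in reverse. At the turning
    -- point `c` the walk does not backtrack, as the first node of the descent differs from `e`.
    climb : ∀ k {c e x} l → NonBacktracking (c ∷ e ∷ l) → Below k (just e) c x →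
      ∃[ l′ ] NonBacktracking (x ∷ l′) × (∀ {z} → z ∈ e ∷ l → z ∈ l′) × length (x ∷ l′) ℕ.≤ k ℕ.+ length (c ∷ e ∷ l)
    climb (suc k) {c} {e} {x} l nb (d , (c~d , e≢d) , inj₁ refl) =
      c ∷ e ∷ l , (~-sym c~d , (λ d≡e → e≢d (cong just (sym d≡e))) , nb) , there , ℕ.s≤s (ℕ.m≤n+m _ k)
    climb (suc k) {c} {e} {x} l nb (d , (c~d , e≢d) , inj₂ b) with climb k (e ∷ l) (~-sym c~d , (λ d≡e → e≢d (cong just (sym d≡e))) , nb) b
    ... | l′ , nb′ , sub , len = l′ , nb′ , (λ z∈ → sub (there z∈)) , ℕ.≤-trans len (ℕ.≤-reflexive (ℕ.+-suc k _))

    -- If `x` were in two branches, the way from `x` up through `d` to `c` and down through `e` to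
    -- `x` would be a non-backtracking walk, since d ≢ e. It has at most 2k + 3 nodes and visits `x`
    -- twice.
    branch-disjoint : ∀ k {mp c d e x} → suc (suc k ℕ.+ suc k) ℕ.≤ g → Branch k mp c d x → Branch k mp c e x → d ≡ e
    branch-disjoint k {mp} {c} {d} {e} {x} 2k+3≤g (cd , xd) (ce , xe) with d ≟ e
    ... | yes d≡e = d≡e
    ... | no  d≢e = ⊥-elim (join xd (reach xe))
      where
      reach : x ≡ e ⊎ Below k (just c) e x → ∃[ l ] NonBacktracking (c ∷ e ∷ l) × x ∈ e ∷ l × length l ℕ.≤ k
      reach (inj₁ x≡e) = [] , proj₁ ce , here x≡e , ℕ.z≤n
      reach (inj₂ b) with below-walk k (proj₁ ce) b
      ... | l , nb , x∈l , len = l , nb , there x∈l , len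
      join : x ≡ d ⊎ Below k (just c) d x → ∃[ l ] NonBacktracking (c ∷ e ∷ l) × x ∈ e ∷ l × length l ℕ.≤ k → ⊥
      join (inj₁ refl) (l , nb , x∈ , len) = nb-fresh d (c ∷ e ∷ l) (~-sym (proj₁ cd) , d≢e , nb)
        (ℕ.≤-trans (ℕ.s≤s (ℕ.s≤s (ℕ.s≤s len))) (ℕ.≤-trans (ℕ.s≤s (ℕ.s≤s (ℕ.≤-trans (ℕ.m≤n+m (suc k) k) ℕ.≤-refl))) 2k+3≤g)) (there x∈)
      join (inj₂ b) (l , nb , x∈ , len) with climb k (e ∷ l) (~-sym (proj₁ cd) , d≢e , nb) b
      ... | l′ , nb′ , sub , len′ = nb-fresh x l′ nb′ (ℕ.≤-trans len′ (ℕ.≤-trans (ℕ.+-monoʳ-≤ k (ℕ.s≤s (ℕ.s≤s (ℕ.s≤s len))))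
          (ℕ.≤-trans (ℕ.≤-reflexive (trans (ℕ.+-suc k _) (cong suc (ℕ.+-suc k _)))) 2k+3≤g))) (sub (there x∈))

    below-≢ : ∀ k {mp c x} → suc k ℕ.≤ g → Below k mp c x → x ≢ c
    below-≢ (suc k) k≤g (d , (c~d , _) , inj₁ refl) refl = ~-irr c~d
    below-≢ (suc k) k≤g (d , (c~d , _) , inj₂ b)    refl with below-walk k c~d b
    ... | l , nb , x∈l , len = nb-fresh _ (d ∷ l) nb (ℕ.≤-trans (ℕ.s≤s (ℕ.s≤s len)) k≤g) (there x∈l)

-- Picking probabilities in a regular graph of large girth

module LocalLaw (G : Graph) (g : ℕ) (girth : Girth≥ g G) (m : ℕ) (regular : Regular (suc (suc m)) G)
  (N : ℕ) (w : ℚ) (0≤w : 0ℚ ≤ w) (Nw≡1 : ι N * w ≡ 1ℚ) where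

  open Graph G using (Node; order; adj; adj-sym; adj-irr; degree; _~_)
  open Greedy G using (survives?; 𝓘𝓖)
  open GreedyRun G
  open Local G
  open Girth g girth
  open Recursion m N w 0≤w Nw≡1

  child? : Maybe Node → Node → Node → Bool
  child? mp c d = adj c d ∧ not (does (Maybe.≡-dec _≟_ mp (just d)))

  child-sound : ∀ mp c d → T (child? mp c d) → Child mp c d
  child-sound mp c d h with adj c d | Maybe.≡-dec _≟_ mp (just d)
  ... | true | no mp≢d = tt , mp≢d

  child-complete : ∀ mp c d → mp ≢ just d → child? mp c d ≡ adj c d
  child-complete mp c d mp≢d with adj c d | Maybe.≡-dec _≟_ mp (just d)
  ... | false | _       = refl
  ... | true  | no _    = refl
  ... | true  | yes mp≡ = contradiction mp≡ mp≢d

  -- The probability, as a function of the labels strictly below c, that no child of c with label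
  -- below j is accepted at truncation depth k; mp is the node through which c was reached.
  free : ℕ → Maybe Node → Node → ℕ → Vec ℕ order → ℚ
  free-of : ℕ → Maybe Node → Node → ℕ → Node → Vec ℕ order → ℚ
  free zero    mp c j t = 1ℚ
  free (suc k) mp c j t = prod (λ d → free-of k mp c j d t)
  free-of k mp c j d t = if child? mp c d then 1ℚ - lt (Vec.lookup t d) j * free k (just c) d (Vec.lookup t d) t else 1ℚ

  free-depends : ∀ k mp c j → DependsOn (Below k mp c) (free k mp c j)
  free-of-depends : ∀ k mp c j d → DependsOn (Branch k mp c d) (free-of k mp c j d)
  free-depends zero    mp c j s t h = refl
  free-depends (suc k) mp c j s t h = prod-cong (λ d → free-of-depends k mp c j d s t (λ x b → h x (d , b)))
  free-of-depends k mp c j d s t h with child? mp c d | child-sound mp c d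
  ... | false | _     = refl
  ... | true  | sound = trans
    (cong (λ z → 1ℚ - lt z j * free k (just c) d z s) (h d (sound tt , inj₁ refl)))
    (cong (λ z → 1ℚ - lt (Vec.lookup t d) j * z) (free-depends k (just c) d (Vec.lookup t d) s t (λ x b → h x (sound tt , inj₂ b))))

  reach : Maybe Node → ℕ
  reach nothing  = suc d
  reach (just _) = d

  prod-children : ∀ mp c x → (∀ p → mp ≡ just p → p ~ c) → prod (λ d → if child? mp c d then x else 1ℚ) ≡ x ^ℕ reach mp
  prod-children nothing  c x _ = trans
    (prod-cong (λ d → cong (λ b → if b then x else 1ℚ) (child-complete nothing c d (λ ()))))
    (trans (prod-count order id (adj c) x) (cong (x ^ℕ_) (regular c)))
  prod-children (just p) c x h = prod-count-without order p (adj c) x (suc m) (~-sym (h p refl)) (regular c)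

  -- The branches at `c` involve disjoint sets of labels, so the mean of the product is the product
  -- of the means. Within a branch the label of its top node `d` is conditioned on, and the
  -- induction applies below `d`.
  mean-free : ∀ k mp c j → j ℕ.≤ N → suc (k ℕ.+ k) ℕ.≤ g → (∀ p → mp ≡ just p → p ~ c) →
    Avg w N order (free k mp c j) ≡ β k j ^ℕ reach mp
  mean-free zero    mp c j j≤N 2k<g h = trans (Avg-const w N Nw≡1 order 1ℚ) (sym (1^ (reach mp)))
  mean-free (suc k) mp c j j≤N 2k<g h = begin
    Avg w N order (λ t → prod (λ d → free-of k mp c j d t))
      ≡⟨ Avg-prod w N Nw≡1 order order (branch? k mp c) (free-of-depends k mp c j)
          (λ i i′ v b b′ → branch-disjoint k 2k<g b b′) ⟩
    prod (λ d → Avg w N order (free-of k mp c j d))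
      ≡⟨ prod-cong mean-free-of ⟩
    prod (λ d → if child? mp c d then β (suc k) j else 1ℚ)
      ≡⟨ prod-children mp c (β (suc k) j) h ⟩
    β (suc k) j ^ℕ reach mp ∎
    where
    open ≡-Reasoning
    k<g : suc k ℕ.≤ g
    k<g = ℕ.≤-trans (ℕ.s≤s (ℕ.≤-trans (ℕ.n≤1+n k) (ℕ.m≤m+n (suc k) (suc k)))) 2k<g
    2k<g′ : suc (k ℕ.+ k) ℕ.≤ g
    2k<g′ = ℕ.≤-trans (ℕ.s≤s (ℕ.≤-trans (ℕ.n≤1+n (k ℕ.+ k)) (ℕ.s≤s (ℕ.+-monoʳ-≤ k (ℕ.n≤1+n k))))) 2k<g
    accepted : ∀ d → c ~ d → Avg w N order (λ t → lt (Vec.lookup t d) j * free k (just c) d (Vec.lookup t d) t)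
      ≡ ∑< j (λ i → w * β k i ^ℕ suc m)
    accepted d c~d = begin
      Avg w N order (λ t → lt (Vec.lookup t d) j * free k (just c) d (Vec.lookup t d) t)
        ≡⟨ Avg-split w N Nw≡1 order d (λ i t → lt i j * free k (just c) d i t)
            (λ i s t h → cong (lt i j *_) (free-depends k (just c) d i s t (λ v b → h v (below-≢ k k<g b)))) ⟩
      ∑< N (λ i → w * Avg w N order (λ t → lt i j * free k (just c) d i t))
        ≡⟨ ∑<-cong N (λ i i<N → trans (cong (w *_) (trans (Avg-*ˡ w N order (lt i j) (free k (just c) d i))
              (cong (lt i j *_) (mean-free k (just c) d i (ℕ.<⇒≤ i<N) 2k<g′ (λ { p refl → c~d })))))
            (solve 3 (λ w l b → w :* (l :* b) := l :* (w :* b)) refl w (lt i j) (β k i ^ℕ suc m))) ⟩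
      ∑< N (λ i → lt i j * (w * β k i ^ℕ suc m))
        ≡⟨ ∑<-lt N j (λ i → w * β k i ^ℕ suc m) j≤N ⟩
      ∑< j (λ i → w * β k i ^ℕ suc m) ∎
    mean-free-of : ∀ d → Avg w N order (free-of k mp c j d) ≡ (if child? mp c d then β (suc k) j else 1ℚ)
    mean-free-of d with child? mp c d | child-sound mp c d
    ... | false | _     = Avg-const w N Nw≡1 order 1ℚ
    ... | true  | sound = begin
      Avg w N order (λ t → 1ℚ - F t)
        ≡⟨ Avg-cong w N order (λ t → cong (λ z → 1ℚ + z) (solve 1 (λ a → :- a := con (- 1ℚ) :* a) refl (F t))) ⟩
      Avg w N order (λ t → 1ℚ + - 1ℚ * F t)
        ≡⟨ trans (Avg-+ w N order (λ _ → 1ℚ) (λ t → - 1ℚ * F t))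
            (cong₂ _+_ (Avg-const w N Nw≡1 order 1ℚ) (trans (Avg-*ˡ w N order (- 1ℚ) F) (cong (- 1ℚ *_) (accepted d (proj₁ (sound tt)))))) ⟩
      1ℚ + - 1ℚ * ∑< j (λ i → w * β k i ^ℕ suc m)
        ≡⟨ cong (λ z → 1ℚ + z) (solve 1 (λ a → con (- 1ℚ) :* a := :- a) refl (∑< j (λ i → w * β k i ^ℕ suc m))) ⟩
      β (suc k) j ∎
      where
      F : Vec ℕ order → ℚ
      F t = lt (Vec.lookup t d) j * free k (just c) d (Vec.lookup t d) t

  everyone : Node → Bool
  everyone _ = true

  al : Node → ℚ
  al v = 𝟙 (everyone v)

  -- `iter` consults all neighbours, `free` only the children. The two agree because the parent has
  -- a label at least that of `c` and cannot block it; this passes on to every child that has a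
  -- smaller label.
  iter-free : ∀ k mp c (t : Vec ℕ order) → (∀ p → mp ≡ just p → Vec.lookup t c ℕ.≤ Vec.lookup t p) →
    iter al conflict t k c ≡ free k mp c (Vec.lookup t c) t
  iter-free zero    mp c t h = refl
  iter-free (suc k) mp c t h = trans (ℚ.*-identityˡ _) (prod-cong factor)
    where
    factor : ∀ d → 1ℚ - blocking conflict t (iter al conflict t k) c d ≡ free-of k mp c (Vec.lookup t c) d t
    factor d with lt-01 (Vec.lookup t d) (Vec.lookup t c)
    ... | inj₂ (_ , lt≡0) rewrite lt≡0 = trans (cong (λ z → 1ℚ - z) (ℚ.*-zeroˡ (conflict d c * iter al conflict t k d))) (sym one)
      where
      one : (if child? mp c d then 1ℚ - 0ℚ * free k (just c) d (Vec.lookup t d) t else 1ℚ) ≡ 1ℚ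
      one with child? mp c d
      ... | true  = cong (λ z → 1ℚ - z) (ℚ.*-zeroˡ (free k (just c) d (Vec.lookup t d) t))
      ... | false = refl
    ... | inj₁ (d<c , _) = trans
        (cong (λ z → 1ℚ - lt (Vec.lookup t d) (Vec.lookup t c) * (conflict d c * z))
          (iter-free k (just c) d t (λ { p refl → ℕ.<⇒≤ d<c })))
        (trans (cong (λ z → 1ℚ - lt (Vec.lookup t d) (Vec.lookup t c) * (z * free k (just c) d (Vec.lookup t d) t)) conflict≡)
          select)
      where
      d≢c : c ≢ d
      d≢c refl = ℕ.<-irrefl refl d<c
      mp≢d : mp ≢ just d
      mp≢d e = ℕ.<-irrefl refl (ℕ.<-≤-trans d<c (h d e))
      conflict≡ : conflict d c ≡ 𝟙 (child? mp c d)
      conflict≡ rewrite child-complete mp c d mp≢d | adj-sym c d with c ≟ d | adj d c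
      ... | yes c≡d | _     = contradiction c≡d d≢c
      ... | no _    | true  = refl
      ... | no _    | false = refl
      select : 1ℚ - lt (Vec.lookup t d) (Vec.lookup t c) * (𝟙 (child? mp c d) * free k (just c) d (Vec.lookup t d) t)
        ≡ free-of k mp c (Vec.lookup t c) d t
      select with child? mp c d
      ... | true  = cong (λ z → 1ℚ - lt (Vec.lookup t d) (Vec.lookup t c) * z) (ℚ.*-identityˡ _)
      ... | false = solve 2 (λ a b → con 1ℚ :- a :* (con 0ℚ :* b) := con 1ℚ) refl (lt (Vec.lookup t d) (Vec.lookup t c)) (free k (just c) d (Vec.lookup t d) t)

  mean-iter : ∀ k v → suc (k ℕ.+ k) ℕ.≤ g → Avg w N order (λ t → iter al conflict t k v) ≡ ρ k
  mean-iter k v 2k<g = begin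
    Avg w N order (λ t → iter al conflict t k v)
      ≡⟨ Avg-cong w N order (λ t → iter-free k nothing v t (λ p ())) ⟩
    Avg w N order (λ t → free k nothing v (Vec.lookup t v) t)
      ≡⟨ Avg-split w N Nw≡1 order v (free k nothing v) (λ i s t h → free-depends k nothing v i s t
          (λ x b → h x (below-≢ k (ℕ.≤-trans (ℕ.s≤s (ℕ.m≤m+n k k)) 2k<g) b))) ⟩
    ∑< N (λ i → w * Avg w N order (free k nothing v i))
      ≡⟨ ∑<-cong N (λ i i<N → cong (w *_) (mean-free k nothing v i (ℕ.<⇒≤ i<N) 2k<g (λ p ()))) ⟩
    ρ k ∎
    where open ≡-Reasoning

  conflict01 : ∀ c → In01 (conflict c)
  conflict01 c v with 0≤𝟙 (does (survives? c v))
  ... | p , q = 0≤-diff q , 1-≤1 p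

  al01 : In01 al
  al01 v = 0≤𝟙 true

  picked : Node → ℚ
  picked v = Avg w N order (λ t → chosen al conflict t v)

  side-picked : ∀ k v → suc (k ℕ.+ k) ℕ.≤ g → Side k (ρ k) (picked v)
  side-picked k v 2k<g = subst (λ z → Side k z (picked v)) (mean-iter k v 2k<g)
    (side-mono (λ _ → ⊤) (Avg w N order) (λ f f′ _ _ → Avg-mono w N 0≤w order) k _ _ tt tt
      (λ t → side-iter al conflict t al01 conflict01 k v))

  module _ (h : ℕ) (2h<g : suc (suc h ℕ.+ suc h) ℕ.≤ g) where

    -- The length of an interval that contains both `ρ∞` and the probability that a node is picked.
    γ : ℚ
    γ = ∣ ρ h - ρ (suc h) ∣

    2h<g′ : suc (h ℕ.+ h) ℕ.≤ g
    2h<g′ = ℕ.≤-trans (ℕ.s≤s (ℕ.+-mono-≤ (ℕ.n≤1+n h) (ℕ.n≤1+n h))) 2h<g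

    picked≤ : ∀ v → picked v ≤ ρ∞ + γ
    picked≤ v = ℚ.≤-trans (ℚ.≤-reflexive (solve 2 (λ a b → a := b :+ (a :- b)) refl (picked v) ρ∞))
      (ℚ.+-monoʳ-≤ ρ∞ (side-gap h (side-picked h v 2h<g′) (side-picked (suc h) v 2h<g) (side-ρ h) (side-ρ (suc h))))

    picked≥ : ∀ v → ρ∞ ≤ picked v + γ
    picked≥ v = ℚ.≤-trans (ℚ.≤-reflexive (solve 2 (λ a b → a := b :+ (a :- b)) refl ρ∞ (picked v)))
      (ℚ.+-monoʳ-≤ (picked v) (side-gap h (side-ρ h) (side-ρ (suc h)) (side-picked h v 2h<g′) (side-picked (suc h) v 2h<g)))

    n R E A S₁ : ℚ
    n = ι order
    R = mean (allFin order)
    E = expectedRatio G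
    A = Avg w N order (size al conflict)
    S₁ = AvgInj w N order (λ _ → 1ℚ)

    A≡sum : A ≡ sum picked
    A≡sum = Avg-sum w N order order (λ t → chosen al conflict t)

    A≤ : A ≤ n * (ρ∞ + γ)
    A≤ = subst₂ _≤_ (sym A≡sum) (sum-const order (ρ∞ + γ)) (sum-mono order picked≤)

    A≥ : n * ρ∞ ≤ A + n * γ
    A≥ = subst₂ _≤_ (sum-const order ρ∞) (trans (∑-distrib-+ picked (λ _ → γ)) (cong₂ _+_ (sym A≡sum) (sum-const order γ)))
      (sum-mono order picked≥)

    size01 : ∀ t → 0ℚ ≤ size al conflict t × size al conflict t ≤ n
    size01 t = subst (_≤ size al conflict t) (trans (sum-const order 0ℚ) (ℚ.*-zeroʳ n)) (sum-mono order (λ v → proj₁ (c01 v))) ,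
      subst (size al conflict t ≤_) (trans (sum-const order 1ℚ) (ℚ.*-identityʳ n)) (sum-mono order (λ v → proj₂ (c01 v)))
      where
      c01 : In01 (chosen al conflict t)
      c01 = iter01 al conflict t al01 conflict01 (suc (Vec.sum t))

    Inj≡ : AvgInj w N order (size al conflict) ≡ S₁ * R
    Inj≡ = trans (AvgInj-size w N order id everyone) (cong (λ l → S₁ * mean l) (List.filter-all (T? ∘ everyone) (All.universal (λ _ → tt) (allFin order))))

    0≤R : 0ℚ ≤ R
    0≤R = 0≤𝔼-length 𝓘𝓖

    S₁R≤A : S₁ * R ≤ A
    S₁R≤A = subst (_≤ A) Inj≡ (AvgInj≤Avg w N 0≤w Nw≡1 order (size al conflict) (λ t → proj₁ (size01 t)))

    A≤S₁R : A ≤ S₁ * R + n * (n * n) * w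
    A≤S₁R = subst (λ z → A ≤ z + n * (n * n) * w) Inj≡
      (Avg≤AvgInj w N 0≤w Nw≡1 order n (size al conflict) (0≤ι order) (λ t → proj₁ (size01 t)) (λ t → proj₂ (size01 t)))

    S₁≤1 : S₁ ≤ 1ℚ
    S₁≤1 = subst (S₁ ≤_) (Avg-const w N Nw≡1 order 1ℚ) (AvgInj≤Avg w N 0≤w Nw≡1 order (λ _ → 1ℚ) (λ _ → 0≤1))

    1≤S₁ : 1ℚ ≤ S₁ + 1ℚ * (n * n) * w
    1≤S₁ = subst (_≤ S₁ + 1ℚ * (n * n) * w) (Avg-const w N Nw≡1 order 1ℚ)
      (Avg≤AvgInj w N 0≤w Nw≡1 order 1ℚ (λ _ → 1ℚ) 0≤1 (λ _ → 0≤1) (λ _ → ℚ.≤-refl))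

    E*n≡R : E * n ≡ R
    E*n≡R = trans (cong (_* n) (trans (𝔼-cong {X = λ S → ℤ.+ length S / order} {Y = λ S → δ * ι (length S)} scale 𝓘𝓖) (𝔼-* δ (ι ∘ length) 𝓘𝓖)))
      (trans (solve 3 (λ d r n → d :* r :* n := d :* n :* r) refl δ R n) (trans (cong (_* R) (/-*ι 1 order)) (ℚ.*-identityˡ R)))
      where
      δ : ℚ
      δ = ℤ.+ 1 / order
      scale : ∀ (S : List Node) → ℤ.+ length S / order ≡ δ * ι (length S)
      scale S = trans (solve 1 (λ a → a := con 1ℚ :* a) refl (ℤ.+ length S / order))
        (trans (cong (_* (ℤ.+ length S / order)) (sym (/-*ι 1 order)))
        (trans (solve 3 (λ d n a → d :* n :* a := d :* (a :* n)) refl δ n (ℤ.+ length S / order))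
          (cong (δ *_) (/-*ι (length S) order))))

    -- Per node, the sizes counted on labelings with ties cost at most n^2 w (for `E≥`), and the
    -- weight missing from `S₁` costs n^2 E w (for `E≤`). The sum serves both.
    error-constant : ℚ
    error-constant = n * n * (1ℚ + E)

    0<n : 0ℚ < n
    0<n = 0<ι order

    0≤E : 0ℚ ≤ E
    0≤E = *-cancelʳ 0<n (subst₂ _≤_ (sym (ℚ.*-zeroˡ n)) (sym E*n≡R) 0≤R)

    E≤ : E ≤ ρ∞ + γ + error-constant * w
    E≤ = *-cancelʳ 0<n (begin
      E * n
        ≡⟨ trans E*n≡R (sym (ℚ.*-identityˡ R)) ⟩
      1ℚ * R
        ≤⟨ *-monoʳ 0≤R 1≤S₁ ⟩
      (S₁ + 1ℚ * (n * n) * w) * R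
        ≡⟨ trans (solve 4 (λ s n w r → (s :+ con 1ℚ :* (n :* n) :* w) :* r := s :* r :+ r :* (n :* n) :* w) refl S₁ n w R)
            (cong (λ z → S₁ * R + z * (n * n) * w) (sym E*n≡R)) ⟩
      S₁ * R + E * n * (n * n) * w
        ≤⟨ ℚ.+-monoˡ-≤ _ (ℚ.≤-trans S₁R≤A A≤) ⟩
      n * (ρ∞ + γ) + E * n * (n * n) * w
        ≤⟨ ≤-from (*-nonneg (*-nonneg (0≤ι order) (*-nonneg (0≤ι order) (0≤ι order))) 0≤w)
            (solve 5 (λ r c n e w → (r :+ c :+ n :* n :* (con 1ℚ :+ e) :* w) :* n := n :* (r :+ c) :+ e :* n :* (n :* n) :* w :+ n :* (n :* n) :* w)
              refl ρ∞ γ n E w) ⟩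
      (ρ∞ + γ + error-constant * w) * n ∎)
      where open ℚ.≤-Reasoning

    E≥ : ρ∞ ≤ E + γ + error-constant * w
    E≥ = *-cancelʳ 0<n (begin
      ρ∞ * n
        ≡⟨ ℚ.*-comm ρ∞ n ⟩
      n * ρ∞
        ≤⟨ ℚ.≤-trans A≥ (ℚ.+-monoˡ-≤ (n * γ) A≤S₁R) ⟩
      S₁ * R + n * (n * n) * w + n * γ
        ≤⟨ ℚ.+-monoˡ-≤ (n * γ) (ℚ.+-monoˡ-≤ (n * (n * n) * w) (*-monoʳ 0≤R S₁≤1)) ⟩
      1ℚ * R + n * (n * n) * w + n * γ
        ≡⟨ cong (λ z → z + n * (n * n) * w + n * γ) (trans (ℚ.*-identityˡ R) (sym E*n≡R)) ⟩
      E * n + n * (n * n) * w + n * γ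
        ≤⟨ ≤-from (*-nonneg (*-nonneg 0≤E (*-nonneg (0≤ι order) (*-nonneg (0≤ι order) (0≤ι order)))) 0≤w)
            (solve 4 (λ c n e w → (e :+ c :+ n :* n :* (con 1ℚ :+ e) :* w) :* n := e :* n :+ n :* (n :* n) :* w :+ n :* c :+ e :* (n :* (n :* n)) :* w)
              refl γ n E w) ⟩
      (E + γ + error-constant * w) * n ∎)
      where open ℚ.≤-Reasoning

-- Passing to the limit

ceiling : ∀ {C} → 0ℚ ≤ C → ∃[ K ] C ≤ ι K
ceiling {mkℚ (ℤ.+ a) b _} _ = a , subst (_≤ ι a) (ℚ.↥p/↧p≡p (mkℚ (ℤ.+ a) b _)) (*-cancelʳ (0<ι (suc b))
  (ℚ.≤-trans (ℚ.≤-reflexive (trans (/-*ι a (suc b)) (sym (ℚ.*-identityʳ (ι a))))) (*-monoˡ (0≤ι a) (ι-mono {1} {suc b} (ℕ.s≤s ℕ.z≤n)))))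
ceiling {mkℚ (ℤ.-[1+ a ]) b _} (ℚ.*≤* ())

reciprocal : ∀ {ε} → 0ℚ < ε → ∃[ q ] 1ℚ ≤ ε * ι (suc q)
reciprocal {mkℚ (ℤ.+ suc a) b _} _ = b , subst (λ z → 1ℚ ≤ z * ι (suc b)) (ℚ.↥p/↧p≡p (mkℚ (ℤ.+ suc a) b _))
  (ℚ.≤-trans (ι-mono {1} {suc a} (ℕ.s≤s ℕ.z≤n)) (ℚ.≤-reflexive (sym (/-*ι (suc a) (suc b)))))
reciprocal {mkℚ (ℤ.+ zero) b _} (ℚ.*<* (ℤ.+<+ ()))
reciprocal {mkℚ (ℤ.-[1+ a ]) b _} (ℚ.*<* ())

-- Used with `k` = 2 m, for which `fine` is the step size condition of `y^m≥`.
record Mesh (k : ℕ) : Set where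
  field
    N    : ℕ
    w    : ℚ
    0≤w  : 0ℚ ≤ w
    Nw≡1 : ι N * w ≡ 1ℚ
    fine : ι k * w ≤ 1ℚ

mesh : ∀ k {C ε} → 0ℚ ≤ C → 0ℚ < ε → ∃[ μ ] C * Mesh.w {k} μ < ε
mesh k {C} {ε} 0≤C 0<ε with ceiling 0≤C | reciprocal 0<ε
... | K , C≤K | q , 1≤εq = record
    { N = N ; w = w ; 0≤w = 0≤w ; Nw≡1 = Nw≡1
    ; fine = subst (ι k * w ≤_) Nw≡1 (*-monoʳ 0≤w (ι-mono (ℕ.m≤n+m k (suc q ℕ.* suc K))))
    } , ℚ.≰⇒> (λ ε≤Cw → ℚ.<-irrefl refl (ℚ.<-≤-trans K<Nε (ℚ.≤-trans (*-monoˡ (0≤ι N) ε≤Cw) (ℚ.≤-trans (ℚ.≤-reflexive NCw≡C) C≤K))))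
  where
  N : ℕ
  -- `K` bounds `C` and `suc q` bounds 1/ε, so N ε ≥ K + 1 > C. The summand `k` provides `fine`.
  N = suc q ℕ.* suc K ℕ.+ k
  w : ℚ
  w = ℤ.+ 1 / N
  0≤w : 0ℚ ≤ w
  0≤w = 0≤/ 1 N
  Nw≡1 : ι N * w ≡ 1ℚ
  Nw≡1 = trans (ℚ.*-comm (ι N) w) (/-*ι 1 N)
  NCw≡C : ι N * (C * w) ≡ C
  NCw≡C = trans (solve 3 (λ n c w → n :* (c :* w) := n :* w :* c) refl (ι N) C w) (trans (cong (_* C) Nw≡1) (ℚ.*-identityˡ C))
  K<Nε : ι K < ι N * ε
  K<Nε = ℚ.<-≤-trans (ℚ.<-≤-trans (subst₂ _<_ (ℚ.+-identityˡ (ι K)) (sym (ι-suc K)) (ℚ.+-monoˡ-< (ι K) 0<1))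
      (ℚ.≤-trans (ℚ.≤-reflexive (sym (ℚ.*-identityˡ (ι (suc K))))) (*-monoʳ (0≤ι (suc K)) 1≤εq)))
    (ℚ.≤-trans (ℚ.≤-reflexive (solve 3 (λ e q k → e :* q :* k := q :* k :* e) refl ε (ι (suc q)) (ι (suc K))))
      (*-monoʳ (ℚ.<⇒≤ 0<ε) (ℚ.≤-trans (ℚ.≤-reflexive (sym (ι-* (suc q) (suc K)))) (ι-mono (ℕ.m≤m+n (suc q ℕ.* suc K) k)))))

≤-of-meshes : ∀ k {C a b} → 0ℚ ≤ C → (∀ (μ : Mesh k) → a ≤ b + C * Mesh.w μ) → a ≤ b
≤-of-meshes k {C} {a} {b} 0≤C h = ℚ.≮⇒≥ λ b<a →
  let μ , Cw<ε = mesh k 0≤C (subst (_< a - b) (ℚ.+-inverseʳ b) (ℚ.+-monoˡ-< (- b) b<a))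
  in ℚ.<-irrefl refl (ℚ.≤-<-trans (h μ) (subst (b + C * Mesh.w μ <_) (solve 2 (λ a b → b :+ (a :- b) := a) refl a b) (ℚ.+-monoʳ-< b Cw<ε)))

module Root (m′ : ℕ) where

  m : ℕ
  m = suc m′

  -- The exponent -2/(r-2) is unreduced in `limit`, so the power there is by definition the `m`-th
  -- root of `a` = (r-1)^(-2).
  b a : ℚ
  b = ι (suc m)
  a = suc m ^ℤ ℤ.-[1+ 1 ]

  ab²≡1 : a * (b * b) ≡ 1ℚ
  ab²≡1 = trans (cong (a *_) (trans (cong (b *_) (sym (ℚ.*-identityʳ b))) (sym (ι-^ (suc m) 2)))) (/-*ι 1 (suc m ℕ.^ 2) {{ℕ.m^n≢0 (suc m) 2}})

  0≤b : 0ℚ ≤ b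
  0≤b = 0≤ι (suc m)

  1≤b : 1ℚ ≤ b
  1≤b = ι-mono {1} {suc m} (ℕ.s≤s ℕ.z≤n)

  0<b² : 0ℚ < b * b
  0<b² = ℚ.<-≤-trans 0<1 (*-mono 0≤1 1≤b 0≤1 1≤b)

  -- Chosen so that (1 + c w)^2 ≤ 1 + κ w for w ≤ 1, with the `c` of `Recursion`.
  κ : ℚ
  κ = let M = ι m ; c = M * M + M * M in c + c + c * c

  0≤κ : 0ℚ ≤ κ
  0≤κ = let 0≤M² = *-nonneg (0≤ι m) (0≤ι m) ; 0≤c = +-nonneg 0≤M² 0≤M² in +-nonneg (+-nonneg 0≤c 0≤c) (*-nonneg 0≤c 0≤c)

  module At (μ : Mesh (m ℕ.+ m)) where
    open Mesh μ public
    open Recursion m N w 0≤w Nw≡1 public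

    Y : ℚ
    Y = y N * y N

    0≤y : 0ℚ ≤ y N
    0≤y = proj₁ (y-bounds N)

    0≤Y : 0ℚ ≤ Y
    0≤Y = *-nonneg 0≤y 0≤y

    Y≤1 : Y ≤ 1ℚ
    Y≤1 = *-mono 0≤y (proj₂ (y-bounds N)) 0≤y (proj₂ (y-bounds N))

    1-Y≤2ρ : 1ℚ - Y ≤ ρ∞ + ρ∞
    1-Y≤2ρ with 2ρ∞ N
    ... | e , 0≤e , _ , eq = ≤-from 0≤e eq

    2ρ≤1-Y+w : ρ∞ + ρ∞ ≤ 1ℚ - Y + w
    2ρ≤1-Y+w with 2ρ∞ N
    ... | e , _ , e≤ , eq = ℚ.≤-trans (ℚ.≤-reflexive eq) (ℚ.+-monoʳ-≤ (1ℚ - Y)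
      (ℚ.≤-trans e≤ (ℚ.≤-reflexive (trans (cong (_* w) Nw≡1) (ℚ.*-identityˡ w)))))

    -- Places `Y` in the set whose supremum is the root. At j = N the bound `y^m≤` reads y^m b ≤ 1,
    -- and squaring it gives the claim.
    Y^m≤a : Y ^ℕ m ≤ a
    Y^m≤a = *-cancelʳ 0<b² (begin
      Y ^ℕ m * (b * b)
        ≡⟨ trans (cong (_* (b * b)) (^-distrib-* (y N) (y N) m)) (solve 2 (λ y b → y :* y :* (b :* b) := y :* b :* (y :* b)) refl (y N ^ℕ m) b) ⟩
      y N ^ℕ m * b * (y N ^ℕ m * b)
        ≤⟨ *-mono 0≤yb yb≤1 0≤yb yb≤1 ⟩
      1ℚ
        ≡⟨ sym ab²≡1 ⟩
      a * (b * b) ∎)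
      where
      open ℚ.≤-Reasoning
      0≤yb : 0ℚ ≤ y N ^ℕ m * b
      0≤yb = *-nonneg (^-nonneg m 0≤y) 0≤b
      yb≤1 : y N ^ℕ m * b ≤ 1ℚ
      yb≤1 = subst (λ z → y N ^ℕ m * z ≤ 1ℚ) (trans (cong (λ z → 1ℚ + M * z) Nw≡1) (trans (cong (λ z → 1ℚ + z) (ℚ.*-identityʳ M)) (sym (ι-suc m)))) (y^m≤ N)

    -- At j = N, `y^m≥` gives 1 ≤ x b z, because 1 + M + c w ≤ (1 + M)(1 + c w) = b z. Squaring
    -- yields a ≤ Y^m z^2 ≤ (Y z^2)^m, so s ≤ Y z^2.
    maximal : ∀ {s} → 0ℚ ≤ s → s ^ℕ m ≤ a → s ≤ Y + κ * w
    maximal {s} 0≤s s^m≤a = ℚ.≤-trans (^-cancel-≤ m (*-nonneg 0≤Y 0≤z²) power) (begin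
      Y * (z * z)
        ≡⟨ solve 3 (λ y c w → y :* ((con 1ℚ :+ c :* w) :* (con 1ℚ :+ c :* w)) := y :+ y :* ((c :+ c :+ c :* c :* w) :* w)) refl Y c w ⟩
      Y + Y * ((c + c + c * c * w) * w)
        ≤⟨ ℚ.+-monoʳ-≤ Y (*-mono 0≤Y Y≤1 (*-nonneg 0≤κ′ 0≤w) (*-monoʳ 0≤w (ℚ.+-monoʳ-≤ (c + c) (*-monoˡ (*-nonneg 0≤c 0≤c) w≤1)))) ⟩
      Y + 1ℚ * ((c + c + c * c * 1ℚ) * w)
        ≡⟨ solve 3 (λ y c w → y :+ con 1ℚ :* ((c :+ c :+ c :* c :* con 1ℚ) :* w) := y :+ (c :+ c :+ c :* c) :* w) refl Y c w ⟩
      Y + κ * w ∎)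
      where
      open ℚ.≤-Reasoning
      z x : ℚ
      z = 1ℚ + c * w
      x = y N ^ℕ m
      0≤x : 0ℚ ≤ x
      0≤x = ^-nonneg m 0≤y
      0≤cw : 0ℚ ≤ c * w
      0≤cw = *-nonneg 0≤c 0≤w
      0≤κ′ : 0ℚ ≤ c + c + c * c * w
      0≤κ′ = +-nonneg (+-nonneg 0≤c 0≤c) (*-nonneg (*-nonneg 0≤c 0≤c) 0≤w)
      1≤z : 1ℚ ≤ z
      1≤z = ≤-from 0≤cw refl
      1≤z² : 1ℚ ≤ z * z
      1≤z² = *-mono 0≤1 1≤z 0≤1 1≤z
      0≤z² : 0ℚ ≤ z * z
      0≤z² = ℚ.≤-trans 0≤1 1≤z²
      1≤xbz : 1ℚ ≤ x * (b * z)
      1≤xbz = ℚ.≤-trans (subst (λ e → 1ℚ ≤ x * (1ℚ + (M + c * w) * e)) Nw≡1 (y^m≥ (subst (λ e → e * w ≤ 1ℚ) (ι-+ m m) fine) N))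
        (*-monoˡ 0≤x (≤-from (*-nonneg (0≤ι m) 0≤cw)
          (trans (cong (_* z) (ι-suc m)) (solve 2 (λ m e → (con 1ℚ :+ m) :* (con 1ℚ :+ e) := con 1ℚ :+ (m :+ e) :* con 1ℚ :+ m :* e) refl M (c * w)))))
      z²≤ : z * z ≤ (z * z) ^ℕ m
      z²≤ = ℚ.≤-trans (ℚ.≤-reflexive (sym (ℚ.*-identityʳ (z * z)))) (*-monoˡ 0≤z² (subst (_≤ (z * z) ^ℕ m′) (1^ m′) (^-mono m′ 0≤1 1≤z²)))
      power : s ^ℕ m ≤ (Y * (z * z)) ^ℕ m
      power = *-cancelʳ 0<b² (begin
        s ^ℕ m * (b * b)
          ≤⟨ *-monoʳ (ℚ.<⇒≤ 0<b²) s^m≤a ⟩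
        a * (b * b)
          ≡⟨ ab²≡1 ⟩
        1ℚ
          ≤⟨ *-mono 0≤1 1≤xbz 0≤1 1≤xbz ⟩
        x * (b * z) * (x * (b * z))
          ≡⟨ solve 3 (λ x b z → x :* (b :* z) :* (x :* (b :* z)) := x :* x :* (z :* z) :* (b :* b)) refl x b z ⟩
        x * x * (z * z) * (b * b)
          ≤⟨ *-monoʳ (ℚ.<⇒≤ 0<b²) (*-monoˡ (*-nonneg 0≤x 0≤x) z²≤) ⟩
        x * x * (z * z) ^ℕ m * (b * b)
          ≡⟨ cong (_* (b * b)) (trans (cong (_* (z * z) ^ℕ m) (sym (^-distrib-* (y N) (y N) m))) (sym (^-distrib-* Y (z * z) m))) ⟩
        (Y * (z * z)) ^ℕ m * (b * b) ∎)

-- From estimates on meshes to inequalities between cuts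

<-from : ∀ {a b d} → 0ℚ < d → b ≡ a + d → a < b
<-from {a} {b} {d} 0<d refl = subst (_< a + d) (ℚ.+-identityʳ a) (ℚ.+-monoʳ-< a 0<d)

0<-diff : ∀ {a b} → a < b → 0ℚ < b - a
0<-diff {a} {b} a<b = subst (_< b - a) (ℚ.+-inverseʳ a) (ℚ.+-monoˡ-< (- a) a<b)

0≤½ : 0ℚ ≤ ½
0≤½ = ℚ.nonNegative⁻¹ ½

½-pos : ∀ {a} → 0ℚ < a → 0ℚ < ½ * a
½-pos {a} p = ℚ.*-monoʳ-<-pos ½ p

-- Both estimates concern 2 E because the cuts of `_/2` test `q + q`.
module Squeeze (m′ : ℕ) {I : Set} (E C : I → ℚ) (e : ℚ) (0≤C : ∀ Γ → 0ℚ ≤ C Γ)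
  (upper : ∀ Γ μ → E Γ + E Γ ≤ 1ℚ - Root.At.Y m′ μ + Mesh.w μ + (e + e) + (C Γ + C Γ) * Mesh.w μ)
  (lower : ∀ Γ μ → 1ℚ - Root.At.Y m′ μ ≤ E Γ + E Γ + (e + e) + (C Γ + C Γ) * Mesh.w μ)
  where

  open Root m′

  lim : ℝ̄
  lim = limit (suc (suc m)) (ℕ.s≤s (ℕ.s≤s (ℕ.s≤s ℕ.z≤n)))

  lower-bound : (lim ⊕ (- e)) ≤ᴿ inf E
  lower-bound = below , above
    where
    below : ∀ {q} → ℝ̄.L (lim ⊕ (- e)) q → ℝ̄.L (inf E) q
    -- `u` bounds the root from above, so the witness is a lower bound for every `E Γ`, and `u<`
    -- puts it strictly above `q`.
    below {q} (u , u< , bound) = ½ * (1ℚ - u) - e ,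
      <-from (½-pos (0<-diff u<)) (solve 3 (λ q u e → con ½ :* (con 1ℚ :- u) :- e := q :+ con ½ :* (con 1ℚ :- (q :- (:- e) :+ (q :- (:- e))) :- u)) refl q u e) ,
      λ Γ → ≤-of-meshes (m ℕ.+ m) (0≤C Γ) (λ μ → let open At μ in
        ≤-from (+-nonneg (*-nonneg 0≤½ (0≤-diff (lower Γ μ))) (*-nonneg 0≤½ (0≤-diff (bound (Y , 0≤Y , Y^m≤a)))))
          (solve 6 (λ E C w u Y e → E :+ C :* w := con ½ :* (con 1ℚ :- u) :- e :+ (con ½ :* (E :+ E :+ (e :+ e) :+ (C :+ C) :* w :- (con 1ℚ :- Y)) :+ con ½ :* (u :- Y))) refl (E Γ) (C Γ) w u Y e))
    above : ∀ {q} → ℝ̄.U (inf E) q → ℝ̄.U (lim ⊕ (- e)) q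
    above {q} (Γ , E<q) = let
      μ , small = mesh (m ℕ.+ m) (+-nonneg (0≤C Γ) (0≤C Γ)) (ℚ.+-mono-< (0<-diff E<q) (0<-diff E<q))
      open At μ in (Y , 0≤Y , Y^m≤a) ,
      <-from (ℚ.+-mono-≤-< (0≤-diff (lower Γ μ)) (0<-diff small))
        (solve 6 (λ E C w q Y e → Y := con 1ℚ :- (q :- (:- e) :+ (q :- (:- e))) :+ ((E :+ E :+ (e :+ e) :+ (C :+ C) :* w :- (con 1ℚ :- Y)) :+ (q :- E :+ (q :- E) :- (C :+ C) :* w))) refl (E Γ) (C Γ) w q Y e)

  upper-bound : sup E ≤ᴿ (lim ⊕ e)
  upper-bound = below , above
    where
    below : ∀ {q} → ℝ̄.L (sup E) q → ℝ̄.L (lim ⊕ e) q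
    below {q} (Γ , q<E) = let
      -- The coefficients of `w` to absorb are 2 C and 1 from `upper` and κ from `maximal`; together
      -- they must stay below 2 (E - q).
      μ , small = mesh (m ℕ.+ m) (+-nonneg (+-nonneg (+-nonneg (0≤C Γ) (0≤C Γ)) 0≤1) 0≤κ) (ℚ.+-mono-< (0<-diff q<E) (0<-diff q<E))
      open At μ in Y + κ * w ,
      <-from (ℚ.+-mono-≤-< (0≤-diff (upper Γ μ)) (0<-diff small))
        (solve 7 (λ E C w q Y e k → con 1ℚ :- (q :- e :+ (q :- e)) := Y :+ k :* w :+ ((con 1ℚ :- Y :+ w :+ (e :+ e) :+ (C :+ C) :* w :- (E :+ E)) :+ (E :- q :+ (E :- q) :- (C :+ C :+ con 1ℚ :+ k) :* w))) refl (E Γ) (C Γ) w q Y e κ) ,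
      λ (s , 0≤s , s^m≤a) → maximal 0≤s s^m≤a
    above : ∀ {q} → ℝ̄.U (lim ⊕ e) q → ℝ̄.U (sup E) q
    above {q} ((s , 0≤s , s^m≤a) , <s) = ½ * (1ℚ - s) + e ,
      <-from (½-pos (0<-diff <s)) (solve 3 (λ q s e → q := con ½ :* (con 1ℚ :- s) :+ e :+ con ½ :* (s :- (con 1ℚ :- (q :- e :+ (q :- e))))) refl q s e) ,
      λ Γ → ≤-of-meshes (m ℕ.+ m) (+-nonneg (0≤C Γ) (*-nonneg 0≤½ (+-nonneg 0≤1 0≤κ))) (λ μ → let open At μ in
        ≤-from (+-nonneg (*-nonneg 0≤½ (0≤-diff (upper Γ μ))) (*-nonneg 0≤½ (0≤-diff (maximal 0≤s s^m≤a))))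
          (solve 7 (λ E C w s Y e k → con ½ :* (con 1ℚ :- s) :+ e :+ (C :+ con ½ :* (con 1ℚ :+ k)) :* w := E :+ (con ½ :* (con 1ℚ :- Y :+ w :+ (e :+ e) :+ (C :+ C) :* w :- (E :+ E)) :+ con ½ :* (Y :+ k :* w :- s))) refl (E Γ) (C Γ) w s Y e κ))

module Estimate (g′ m′ : ℕ) where
  open Root m′

  g r : ℕ
  g = suc (suc (suc (suc g′)))
  r = suc (suc m)

  h : ℕ
  h = ⌊ g′ /2⌋

  e : ℚ
  e = error g r

  2h<g : suc (suc h ℕ.+ suc h) ℕ.≤ g
  2h<g = ℕ.s≤s (ℕ.s≤s (ℕ.≤-trans (ℕ.≤-reflexive (ℕ.+-suc h h)) (ℕ.s≤s (ℕ.≤-trans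
    (ℕ.≤-trans (ℕ.+-monoʳ-≤ h (ℕ.⌊n/2⌋≤⌈n/2⌉ g′)) (ℕ.≤-reflexive (ℕ.⌊n/2⌋+⌈n/2⌉≡n g′))) (ℕ.n≤1+n g′)))))

  module _ (μ : Mesh (m ℕ.+ m)) where
    open At μ

    γ≤e : ∣ ρ h - ρ (suc h) ∣ ≤ e
    γ≤e = *-cancelʳ (0<ι (suc (suc h) !) {{ℕ._!≢0 (suc (suc h))}}) (begin
      ∣ ρ h - ρ (suc h) ∣ * ι (suc (suc h) !)
        ≡⟨ trans (cong (_* ι (suc (suc h) !)) (∣-∣-sym (ρ h) (ρ (suc h)))) (ℚ.*-comm ∣ ρ (suc h) - ρ h ∣ (ι (suc (suc h) !))) ⟩
      ι (suc (suc h) !) * ∣ ρ (suc h) - ρ h ∣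
        ≤⟨ ρ-gap h ⟩
      ι r * ι d ^ℕ h
        -- Since g = g′ + 4, the exponent ⌊(g-2)/2⌋ in `error` is `suc h`; the extra factor r - 1 is
        -- at least 1.
        ≤⟨ *-monoˡ (0≤ι r) (subst (_≤ ι d * ι d ^ℕ h) (ℚ.*-identityˡ (ι d ^ℕ h)) (*-monoʳ (^-nonneg h 0≤b) 1≤b)) ⟩
      ι r * ι d ^ℕ suc h
        ≡⟨ sym (trans (ι-* r (d ℕ.^ suc h)) (cong (ι r *_) (ι-^ d (suc h)))) ⟩
      ι (r ℕ.* d ℕ.^ suc h)
        ≡⟨ sym (/-*ι (r ℕ.* d ℕ.^ suc h) (suc (suc h) !) {{ℕ._!≢0 (suc (suc h))}}) ⟩
      e * ι (suc (suc h) !) ∎)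
      where open ℚ.≤-Reasoning

  module _ (Γ : 𝒢 g r) where
    open 𝒢 Γ

    E C : ℚ
    E = expectedRatio graph
    C = ι (Graph.order graph) * ι (Graph.order graph) * (1ℚ + E)

    0≤C : 0ℚ ≤ C
    0≤C = *-nonneg (*-nonneg (0≤ι (Graph.order graph)) (0≤ι (Graph.order graph)))
      -- `E` does not involve the mesh, so the trivial one with N = 1 and w = 1 will do.
      (+-nonneg 0≤1 (LocalLaw.0≤E graph g girth m regular 1 1ℚ 0≤1 refl h 2h<g))

    module _ (μ : Mesh (m ℕ.+ m)) where
      open At μ

      upper : E + E ≤ 1ℚ - Y + w + (e + e) + (C + C) * w
      upper = ℚ.≤-trans (ℚ.+-mono-≤ E≤ρ E≤ρ) (ℚ.≤-trans
        (ℚ.≤-reflexive (solve 3 (λ r e c → r :+ e :+ c :+ (r :+ e :+ c) := r :+ r :+ (e :+ e) :+ (c :+ c)) refl ρ∞ e (C * w)))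
        (ℚ.≤-trans (ℚ.+-monoˡ-≤ (C * w + C * w) (ℚ.+-monoˡ-≤ (e + e) 2ρ≤1-Y+w))
          (ℚ.≤-reflexive (cong (1ℚ - Y + w + (e + e) +_) (sym (ℚ.*-distribʳ-+ w C C))))))
        where
        E≤ρ : E ≤ ρ∞ + e + C * w
        E≤ρ = ℚ.≤-trans (LocalLaw.E≤ graph g girth m regular N w 0≤w Nw≡1 h 2h<g)
          (ℚ.+-monoˡ-≤ (C * w) (ℚ.+-monoʳ-≤ ρ∞ (γ≤e μ)))

      lower : 1ℚ - Y ≤ E + E + (e + e) + (C + C) * w
      lower = ℚ.≤-trans 1-Y≤2ρ (ℚ.≤-trans (ℚ.+-mono-≤ ρ≤E ρ≤E)
        (ℚ.≤-reflexive (solve 4 (λ r e c w → r :+ e :+ c :* w :+ (r :+ e :+ c :* w) := r :+ r :+ (e :+ e) :+ (c :+ c) :* w) refl E e C w)))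
        where
        ρ≤E : ρ∞ ≤ E + e + C * w
        ρ≤E = ℚ.≤-trans (LocalLaw.E≥ graph g girth m regular N w 0≤w Nw≡1 h 2h<g)
          (ℚ.+-monoˡ-≤ (C * w) (ℚ.+-monoʳ-≤ E (γ≤e μ)))

  open Squeeze m′ E C e 0≤C (λ Γ μ → upper Γ μ) (λ Γ μ → lower Γ μ) public using (lower-bound; upper-bound)

inf≤sup : {I : Set} (f : I → ℚ) → I → inf f ≤ᴿ sup f
inf≤sup f i = (λ (l , q<l , l≤) → i , ℚ.<-≤-trans q<l (l≤ i)) , (λ (u , u<q , ≤u) → i , ℚ.≤-<-trans (≤u i) u<q)

-- Regular graphs of large girth

unique-⊆-length : ∀ {A : Set} {xs ys : List A} → Unique xs → (∀ {x} → x ∈ xs → x ∈ ys) → length xs ℕ.≤ length ys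
unique-⊆-length {xs = xs} {ys} u sub = injective⇒≤ {f = λ i → index (sub (∈-lookup {xs = xs} i))} λ {i} {j} e →
  lookup-injective u i j (trans (lookup-index (sub (∈-lookup {xs = xs} i)))
    (trans (cong (lookup ys) e) (sym (lookup-index (sub (∈-lookup {xs = xs} j))))))

map-≗-∈ : ∀ {A B : Set} {f h : A → B} {xs} → map f xs ≡ map h xs → ∀ {x} → x ∈ xs → f x ≡ h x
map-≗-∈ {xs = _ ∷ _} e (here refl) = List.∷-injectiveˡ e
map-≗-∈ {xs = _ ∷ _} e (there x∈) = map-≗-∈ (List.∷-injectiveʳ e) x∈

listsUpTo : ∀ {A : Set} → List A → ℕ → List (List A)
listsUpTo as zero    = [] ∷ []
listsUpTo as (suc n) = [] ∷ cartesianProductWith _∷_ as (listsUpTo as n)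

∈-listsUpTo⁺ : ∀ {A : Set} (as : List A) n l → All (_∈ as) l → length l ℕ.≤ n → l ∈ listsUpTo as n
∈-listsUpTo⁺ as zero    []      _          _         = here refl
∈-listsUpTo⁺ as (suc n) []      _          _         = here refl
∈-listsUpTo⁺ as (suc n) (x ∷ l) (x∈ ∷ l∈) (ℕ.s≤s len) = there (∈-cartesianProductWith⁺ _∷_ x∈ (∈-listsUpTo⁺ as n l l∈ len))

∈-listsUpTo⁻ : ∀ {A : Set} (as : List A) n {l} → l ∈ listsUpTo as n → All (_∈ as) l × length l ℕ.≤ n
∈-listsUpTo⁻ as zero    (here refl) = [] , ℕ.z≤n
∈-listsUpTo⁻ as (suc n) (here refl) = [] , ℕ.z≤n
∈-listsUpTo⁻ as (suc n) (there l∈) with ∈-cartesianProductWith⁻ _∷_ as (listsUpTo as n) l∈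
... | x , l , x∈ , l∈′ , refl with ∈-listsUpTo⁻ as n l∈′
...   | all , len = x∈ ∷ all , ℕ.s≤s len

module HighGirth (g r : ℕ) (0<g : 0 ℕ.< g) where

  Word : Set
  Word = List (Fin r)

  Starts : Fin r → Word → Set
  Starts k []      = ⊥
  Starts k (x ∷ w) = k ≡ x

  starts? : ∀ k w → Dec (Starts k w)
  starts? k []      = no (λ ())
  starts? k (x ∷ w) = k ≟ x

  extend : Fin r → Word → Word
  extend k w = if does (length w ℕ.<? g) then k ∷ w else w

  -- Moves along the edge of colour k in the ball of radius g of the r-regular tree, whose vertices are
  -- the words without repeated adjacent letters. Words with repeated leading letters are fixed, which keeps toggle k an involution.
  toggle : Fin r → Word → Word
  toggle k []      = extend k []
  toggle k (x ∷ w) = if does (k ≟ x) then (if does (starts? k w) then x ∷ w else w) else extend k (x ∷ w)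

  toggle-extend : ∀ k w → ¬ Starts k w → toggle k w ≡ extend k w
  toggle-extend k []      _  = refl
  toggle-extend k (x ∷ w) ¬s rewrite dec-false (k ≟ x) ¬s = refl

  toggle-fresh : ∀ k w → ¬ Starts k w → length w ℕ.< g → toggle k w ≡ k ∷ w
  toggle-fresh k w ¬s len = trans (toggle-extend k w ¬s) (cong (λ b → if b then k ∷ w else w) (dec-true (length w ℕ.<? g) len))

  toggle-full : ∀ k w → ¬ Starts k w → ¬ length w ℕ.< g → toggle k w ≡ w
  toggle-full k w ¬s len = trans (toggle-extend k w ¬s) (cong (λ b → if b then k ∷ w else w) (dec-false (length w ℕ.<? g) len))

  toggle-drop : ∀ k w → ¬ Starts k w → toggle k (k ∷ w) ≡ w
  toggle-drop k w ¬s rewrite dec-true (k ≟ k) refl | dec-false (starts? k w) ¬s = refl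

  toggle-stuck : ∀ k w → Starts k w → toggle k (k ∷ w) ≡ k ∷ w
  toggle-stuck k w s rewrite dec-true (k ≟ k) refl | dec-true (starts? k w) s = refl

  -- A step away from the root; no step, at the boundary of the ball or at a word that starts with
  -- `k` twice; a step towards the root.
  data Toggled (k : Fin r) (w : Word) : Set where
    grows : ¬ Starts k w → length w ℕ.< g → toggle k w ≡ k ∷ w → Toggled k w
    fixed : toggle k w ≡ w → Toggled k w
    drops : ∀ w′ → w ≡ k ∷ w′ → ¬ Starts k w′ → toggle k w ≡ w′ → Toggled k w

  toggled : ∀ k w → Toggled k w
  toggled k w with starts? k w
  toggled k w | no ¬s with length w ℕ.<? g
  ... | yes len = grows ¬s len (toggle-fresh k w ¬s len)
  ... | no  len = fixed (toggle-full k w ¬s len)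
  toggled k (x ∷ w) | yes refl with starts? k w
  ... | yes s = fixed (toggle-stuck k w s)
  ... | no ¬s = drops w refl ¬s (toggle-drop k w ¬s)

  toggle-involutive : ∀ k w → length w ℕ.≤ g → toggle k (toggle k w) ≡ w
  toggle-involutive k w len with toggled k w
  ... | grows ¬s _ e      = trans (cong (toggle k) e) (toggle-drop k w ¬s)
  ... | fixed e           = trans (cong (toggle k) e) e
  ... | drops w′ refl ¬s e = trans (cong (toggle k) e) (toggle-fresh k w′ ¬s len)

  toggle-length : ∀ k w → length w ℕ.≤ g → length (toggle k w) ℕ.≤ g
  toggle-length k w len with toggled k w
  ... | grows _ len′ e   = subst (λ z → length z ℕ.≤ g) (sym e) len′
  ... | fixed e          = subst (λ z → length z ℕ.≤ g) (sym e) len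
  ... | drops w′ refl _ e = subst (λ z → length z ℕ.≤ g) (sym e) (ℕ.<⇒≤ len)

  toggle-[] : ∀ k → toggle k [] ≡ k ∷ []
  toggle-[] k = toggle-fresh k [] (λ ()) 0<g

  toggle≡[] : ∀ k w → toggle k w ≡ [] → length w ℕ.≤ 1
  toggle≡[] k w t≡[] with toggled k w
  ... | grows _ _ e      = contradiction (trans (sym e) t≡[]) (λ ())
  ... | fixed e          = subst (λ z → length z ℕ.≤ 1) (trans (sym t≡[]) e) ℕ.z≤n
  ... | drops w′ refl _ e = subst (λ z → length (k ∷ z) ℕ.≤ 1) (trans (sym t≡[]) e) ℕ.≤-refl

  ball : List Word
  ball = listsUpTo (allFin r) g

  ∈-ball : ∀ w → length w ℕ.≤ g → w ∈ ball
  ∈-ball w = ∈-listsUpTo⁺ (allFin r) g w (All.universal ∈-allFin w)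

  ball-length : ∀ {w} → w ∈ ball → length w ℕ.≤ g
  ball-length w∈ = proj₂ (∈-listsUpTo⁻ (allFin r) g w∈)

  toggle-ball : ∀ k {w} → w ∈ ball → toggle k w ∈ ball
  toggle-ball k {w} w∈ = ∈-ball (toggle k w) (toggle-length k w (ball-length w∈))

  _≟ʷ_ : DecidableEquality Word
  _≟ʷ_ = List.≡-dec _≟_

  _≟ˡ_ : DecidableEquality (List Word)
  _≟ˡ_ = List.≡-dec _≟ʷ_

  -- Some toggles fix words at the boundary, so single words as nodes would give loops. A list that
  -- covers the ball contains `[]`, which every toggle moves, and covering persists because each
  -- toggle permutes the ball.
  Covers : List Word → Set
  Covers f = All (_∈ f) ball

  covers? : ∀ f → Dec (Covers f)
  covers? f = all? (λ w → _∈?_ _≟ʷ_ w f) ball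

  -- Every state has the entry [], which a short reduced word of toggles moves; so there are no short cycles.
  states : List (List Word)
  states = deduplicate _≟ˡ_ (filter covers? (listsUpTo ball (length ball)))

  states-unique : Unique states
  states-unique = deduplicate-! _≟ˡ_ (filter covers? (listsUpTo ball (length ball)))

  ∈-states⁺ : ∀ f → All (_∈ ball) f → length f ℕ.≤ length ball → Covers f → f ∈ states
  ∈-states⁺ f f⊆ len cov = ∈-deduplicate⁺ _≟ˡ_ (∈-filter⁺ covers? (∈-listsUpTo⁺ ball (length ball) f f⊆ len) cov)

  ∈-states⁻ : ∀ {f} → f ∈ states → (All (_∈ ball) f × length f ℕ.≤ length ball) × Covers f
  ∈-states⁻ {f} f∈ with ∈-filter⁻ covers? {xs = listsUpTo ball (length ball)} (∈-deduplicate⁻ _≟ˡ_ (filter covers? (listsUpTo ball (length ball))) f∈)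
  ... | f∈′ , cov = ∈-listsUpTo⁻ ball (length ball) f∈′ , cov

  ball∈states : ball ∈ states
  ball∈states = ∈-states⁺ ball (All.tabulate id) ℕ.≤-refl (All.tabulate id)

  act : Fin r → List Word → List Word
  act k = map (toggle k)

  act-involutive : ∀ k {f} → f ∈ states → act k (act k f) ≡ f
  act-involutive k {f} f∈ = trans (sym (List.map-∘ f))
    (List.map-id-local (All.map (λ {w} w∈ → toggle-involutive k w (ball-length w∈)) (proj₁ (proj₁ (∈-states⁻ f∈)))))

  act-states : ∀ k {f} → f ∈ states → act k f ∈ states
  act-states k {f} f∈ with ∈-states⁻ f∈
  ... | (f⊆ , len) , cov = ∈-states⁺ (act k f) (All.map⁺ (All.map (toggle-ball k) f⊆))
    (subst (ℕ._≤ length ball) (sym (List.length-map (toggle k) f)) len)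
    (All.tabulate (λ {w} w∈ → subst (_∈ act k f) (toggle-involutive k w (ball-length w∈)) (∈-map⁺ (toggle k) (All.lookup cov (toggle-ball k w∈)))))

  []∈state : ∀ {f} → f ∈ states → [] ∈ f
  []∈state f∈ = All.lookup (proj₂ (∈-states⁻ f∈)) (∈-ball [] ℕ.z≤n)

  State : Set
  State = Fin (length states)

  at : State → List Word
  at i = lookup states i

  at∈ : ∀ i → at i ∈ states
  at∈ i = ∈-lookup i

  at-injective : ∀ i j → at i ≡ at j → i ≡ j
  at-injective = lookup-injective states-unique

  Edge : State → State → Set
  Edge i j = ∃[ k ] at j ≡ act k (at i)

  edge? : ∀ i j → Dec (Edge i j)
  edge? i j = any? (λ k → at j ≟ˡ act k (at i))

  edge-sym : ∀ {i j} → Edge i j → Edge j i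
  edge-sym {i} {j} (k , e) = k , sym (trans (cong (act k) e) (act-involutive k (at∈ i)))

  edge-irr : ∀ {i} → ¬ Edge i i
  edge-irr {i} (k , e) with trans (map-≗-∈ (trans (List.map-id (at i)) e) ([]∈state (at∈ i))) (toggle-[] k)
  ... | ()

  states-nonEmpty : NonZero (length states)
  states-nonEmpty with states | ball∈states
  ... | _ ∷ _ | _ = _

  graph : Graph
  graph = record
    { order    = length states
    ; nonEmpty = states-nonEmpty
    ; adj      = λ i j → does (edge? i j)
    ; adj-sym  = λ i j → does-⇔ (mk⇔ (edge-sym {i} {j}) (edge-sym {j} {i})) (edge? i j) (edge? j i)
    ; adj-irr  = λ i → dec-false (edge? i i) edge-irr
    }

  neighbour : State → Fin r → State
  neighbour i k = index (act-states k (at∈ i))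

  at-neighbour : ∀ i k → at (neighbour i k) ≡ act k (at i)
  at-neighbour i k = sym (lookup-index (act-states k (at∈ i)))

  -- Different colours take the entry `[]` to different one-letter words, so the r neighbours of a
  -- state are distinct.
  neighbour-injective : ∀ i {k l} → neighbour i k ≡ neighbour i l → k ≡ l
  neighbour-injective i {k} {l} e = List.∷-injectiveˡ (trans (sym (toggle-[] k)) (trans
    (map-≗-∈ (trans (sym (at-neighbour i k)) (trans (cong at e) (at-neighbour i l))) ([]∈state (at∈ i))) (toggle-[] l)))

  to-does : ∀ {P : Set} (P? : Dec P) → P → T (does P?)
  to-does P? p = subst T (sym (dec-true P? p)) _

  regular : Regular r graph
  regular i = trans (ℕ.≤-antisym (unique-⊆-length (filter⁺ adj? (allFin⁺ (length states))) to)
      (unique-⊆-length (tabulate⁺ (neighbour-injective i)) from)) (List.length-tabulate (neighbour i))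
    where
    adj? : ∀ j → Dec (T (does (edge? i j)))
    adj? j = T? (does (edge? i j))
    to : ∀ {j} → j ∈ filter adj? (allFin (length states)) → j ∈ List.tabulate (neighbour i)
    to {j} j∈ with from-does (edge? i j) (proj₂ (∈-filter⁻ adj? {xs = allFin (length states)} j∈))
    ... | k , e = subst (_∈ List.tabulate (neighbour i)) (at-injective (neighbour i k) j (trans (at-neighbour i k) (sym e))) (∈-tabulate⁺ {f = neighbour i} k)
    from : ∀ {j} → j ∈ List.tabulate (neighbour i) → j ∈ filter adj? (allFin (length states))
    from j∈ with ∈-tabulate⁻ j∈
    ... | k , refl = ∈-filter⁺ adj? (∈-allFin (neighbour i k)) (to-does (edge? i (neighbour i k)) (k , at-neighbour i k))

  module _ {m} (c : Cycle graph m) (short : suc m ℕ.< g) where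
    open Cycle c

    F : Fin (suc m) → List Word
    F t = at (node t)

    -- `S` is the composite of the toggles along the cycle up to position `t`. The last clause says
    -- that the first letter of `S []` is the colour of the edge just traversed.
    Traced : Fin (suc m) → Set
    Traced t = ∃[ S ] F t ≡ map S (F zero) × length (S []) ≡ toℕ t ×
      (∀ l → Starts l (S []) → ∃[ t′ ] F t ≡ act l (F t′) × suc (toℕ t′) ≡ toℕ t)

    -- The entry that starts as [] grows by one letter per step, as the cycle never backtracks.
    trace-step : ∀ i → Traced (inject₁ i) → Traced (suc i)
    trace-step i (S , F≡ , len , back) = toggle l ∘ S ,
      trans e (trans (cong (act l) F≡) (sym (List.map-∘ (F zero)))) ,
      trans (cong length grown) (cong suc (trans len (toℕ-inject₁ i))) ,
      λ l′ s → inject₁ i , subst (λ z → F (suc i) ≡ act z (F (inject₁ i))) (sym (subst (Starts l′) grown s)) e , cong suc (toℕ-inject₁ i)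
      where
      edge : Edge (node (inject₁ i)) (node (suc i))
      edge = from-does (edge? (node (inject₁ i)) (node (suc i))) (step i)
      l : Fin r
      l = proj₁ edge
      e : F (suc i) ≡ act l (F (inject₁ i))
      e = proj₂ edge
      ¬starts : ¬ Starts l (S [])
      ¬starts s with back l s
      -- Repeating the colour of the previous edge would undo it and lead back to position `t′`, two
      -- steps earlier, against the distinctness of the nodes.
      ... | t′ , e′ , pred = ℕ.<-irrefl (cong toℕ (sym (distinct {suc i} {t′} (at-injective _ _ returned))))
        (ℕ.<-trans (ℕ.n<1+n (toℕ t′)) (ℕ.≤-reflexive (cong suc (trans pred (toℕ-inject₁ i)))))
        where
        returned : F (suc i) ≡ F t′
        returned = trans e (trans (cong (act l) e′) (act-involutive l (at∈ (node t′))))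
      grown : toggle l (S []) ≡ l ∷ S []
      grown = toggle-fresh l (S []) ¬starts (subst (ℕ._< g) (sym (trans len (toℕ-inject₁ i))) (ℕ.<-trans (toℕ<n i) (ℕ.<-trans (ℕ.n<1+n m) short)))

    trace : ∀ t → Traced t
    trace = <-weakInduction Traced (id , sym (List.map-id (F zero)) , refl , λ l ()) trace-step

    no-short-cycle : ⊥
    no-short-cycle with trace (fromℕ m) | from-does (edge? (node (fromℕ m)) (node zero)) close
    -- The closing edge must take `S []` back to `[]`. That bounds its length, which is `m`, by 1,
    -- whereas a cycle has m ≥ 2.
    ... | S , F≡ , len , _ | l , e = ℕ.<-irrefl refl (ℕ.<-≤-trans (ℕ.s≤s⁻¹ length≥3)
      (subst (ℕ._≤ 1) (trans len (toℕ-fromℕ m)) (toggle≡[] l (S []) (sym (map-≗-∈ {f = id}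
        (trans (List.map-id (F zero)) (trans e (trans (cong (act l) F≡) (sym (List.map-∘ (F zero)))))) ([]∈state (at∈ (node zero))))))))

  girth : Girth≥ g graph
  girth {m} c = ℕ.≮⇒≥ (no-short-cycle c)

  𝒢-inhabited : 𝒢 g r
  𝒢-inhabited = record { graph = graph ; regular = regular ; girth = girth }

theorem4 : (g r : ℕ) → 4 ℕ.≤ g → (r≥3 : 3 ℕ.≤ r) →
    (limit r r≥3 ⊕ (- error g r) ≤ᴿ inf (expectedRatio ∘ 𝒢.graph {g} {r})) ×
    (inf (expectedRatio ∘ 𝒢.graph {g} {r}) ≤ᴿ sup (expectedRatio ∘ 𝒢.graph {g} {r})) ×
    (sup (expectedRatio ∘ 𝒢.graph {g} {r}) ≤ᴿ limit r r≥3 ⊕ error g r)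
theorem4 (suc (suc (suc (suc g′)))) (suc (suc (suc m′))) 4≤g@(ℕ.s≤s (ℕ.s≤s (ℕ.s≤s (ℕ.s≤s _)))) (ℕ.s≤s (ℕ.s≤s (ℕ.s≤s ℕ.z≤n))) =
  lower-bound ,
  inf≤sup (expectedRatio ∘ 𝒢.graph) (HighGirth.𝒢-inhabited _ _ (ℕ.≤-trans (ℕ.s≤s ℕ.z≤n) 4≤g)) ,
  upper-bound
  where open Estimate g′ m′
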